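{- Let $q$ be a power of an odd prime and let $E\subset \mathbb F_q^2$. Let $\Delta(E)=\{\|x-y\|: x,y\in E\}$, where $\|x\|=x_1^2+x_2^2$. (i) If $q\equiv 3 \pmod 4$ and $|E|\ge q^{4/3}$, then $|\Delta(E)|>\frac{q}{1+\sqrt3}$. (ii) If $q\equiv 1\pmod 4$ is sufficiently large and $|E|\ge q^{4/3}$, then $|\Delta(E)|>\varepsilon_q\, q$, where $$\varepsilon_q=\frac{(1-2q^{ -1})^2}{1+\sqrt3-\sqrt3\,q^{ -2/3}},$$ so that $0<\varepsilon_q<1$ and $\varepsilon_q\to\frac{1}{1+\sqrt3}$ as $q\to\infty$.
   Context: $\mathbb F_q$ denotes the finite field with $q$ elements. For $x\in\mathbb F_q^d$, $\|x\|=x_1^2+\dots+x_d^2\in\mathbb F_q$ (this is not a metric, just the quadratic form). -}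

module Defs where

open import Level using (0ℓ)
open import Data.Nat as ℕ using (ℕ; zero; suc; _^_; _∸_)
open import Data.Nat.Primality using (Prime)
open import Data.Integer as ℤ using (ℤ; +_)
open import Data.Rational as ℚ using (ℚ; _<_; _≤_; _/_; 0ℚ; 1ℚ)
open import Data.Bool using (Bool; true; _∧_)
open import Data.Fin using (Fin)
open import Data.List using (List; filter; length; map; allFin; cartesianProduct)
open import Data.Bool.ListAction using (any)
open import Data.Product using (_×_; _,_; Σ; ∃; ∃-syntax)
open import Data.Sum using (_⊎_)
open import Relation.Binary.PropositionalEquality using (_≡_)
open import Relation.Binary.Definitions using (DecidableEquality)
open import Relation.Nullary using (¬_; does)
open import Relation.Unary using (Pred)
open import Algebra.Structures using (IsCommutativeRing)
open import Function.Bundles using (_↔_; Inverse)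

record FiniteField (q : ℕ) : Set₁ where
  infixl 6 _+_ _-_
  infixl 7 _*_
  field
    Carrier   : Set
    _+_ _*_   : Carrier → Carrier → Carrier
    -_        : Carrier → Carrier
    0# 1#     : Carrier
    isCommutativeRing : IsCommutativeRing _≡_ _+_ _*_ -_ 0# 1#
    0≢1       : ¬ (0# ≡ 1#)
    inverse   : ∀ x → ¬ (x ≡ 0#) → ∃[ y ] (x * y ≡ 1#)
    _≟_       : DecidableEquality Carrier
    enum      : Fin q ↔ Carrier

  _-_ : Carrier → Carrier → Carrier
  x - y = x + (- y)

  elems : List Carrier
  elems = map (Inverse.to enum) (allFin q)

  Pt : Set
  Pt = Carrier × Carrier

  points : List Pt
  points = cartesianProduct elems elems

  ‖_‖ : Pt → Carrier
  ‖ (x₁ , x₂) ‖ = x₁ * x₁ + x₂ * x₂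

  _−ᵥ_ : Pt → Pt → Pt
  (x₁ , x₂) −ᵥ (y₁ , y₂) = (x₁ - y₁ , x₂ - y₂)

  Subset : Set
  Subset = Pt → Bool

  card : Subset → ℕ
  card E = length (filter (λ x → Data.Bool._≟_ (E x) true) points)

  Δ : Subset → Carrier → Bool
  Δ E t = any (λ x → any (λ y → E x ∧ E y ∧ does (‖ x −ᵥ y ‖ ≟ t)) points) points

  cardΔ : Subset → ℕ
  cardΔ E = length (filter (λ t → Data.Bool._≟_ (Δ E t) true) elems)

OddPrimePower : ℕ → Set
OddPrimePower q = ∃[ p ] ∃[ k ] (Prime p × ¬ (p ≡ 2) × 1 ℕ.≤ k × q ≡ p ^ k)

⟦_⟧ : ℕ → ℚ
⟦ n ⟧ = (+ n) / 1

-- x < √3 · y  for rationals x, y (exact, via squaring)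
Lt√3 : ℚ → ℚ → Set
Lt√3 x y = (0ℚ ≤ y × (x < 0ℚ ⊎ x ℚ.* x < ⟦ 3 ⟧ ℚ.* (y ℚ.* y)))
         ⊎ (y < 0ℚ × x < 0ℚ × ⟦ 3 ⟧ ℚ.* (y ℚ.* y) < x ℚ.* x)


-- D > q / (1 + √3), i.e. D (1 + √3) > q, i.e. √3·D > q − D  (exact in ℕ)
GtQOver1+√3 : ℕ → ℕ → Set
GtQOver1+√3 q D = (q ∸ D) ^ 2 ℕ.< 3 ℕ.* (D ^ 2)

-- D > ε_q · q  where ε_q = (1 - 2/q)^2 / (1 + √3 - √3 q^(-2/3)).
-- Since 0 < q^(-2/3) < 1 the denominator is positive, and (multiplying by q > 0)
-- this is  (q-2)^2 - D q < √3 · q D (1 - q^(-2/3)).  The right side is continuous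
-- and non-increasing in u = q^(-2/3), so the strict inequality holds iff it holds
-- with u replaced by some rational t > q^(-2/3), i.e. t > 0 and t^3 q^2 > 1.
GtEpsQ : ℕ → ℕ → Set
GtEpsQ q D = ∃[ t ] (0ℚ < t × 1ℚ < t ℚ.* t ℚ.* t ℚ.* ⟦ q ^ 2 ⟧
               × Lt√3 (⟦ (q ∸ 2) ^ 2 ⟧ ℚ.- ⟦ D ℕ.* q ⟧)
                      (⟦ q ℕ.* D ⟧ ℚ.* (1ℚ ℚ.- t)))

{-# OPTIONS --safe #-}
module Submission where

-- The second moment Σ ν(t)² of the distance counting function is bounded by an L² → L⁴ extension argument for circles.
-- To stay clear of complex characters the Fourier side is replaced by the group ring of (F², +): L(a) = (π ∗ a)(0) is the
-- sum of the transform of a over the non-isotropic frequencies, and is positive on a ∗ star a because π is, up to scale,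
-- an idempotent. The element s = Σ_θ e_θ ∗ star e_θ, over rotations θ, plays the role of the mass of the transform of E on
-- circles. Then L(s²)³ ≤ L(s)² L(s⁴) by Cauchy-Schwarz, L(s⁴) ≤ |E|³ Σ_x L(h_x⁴) by convexity since s = Σ_{x ∈ E} h_x, and
-- Σ_x L(h_x⁴) ≤ 3q² L(s²) because four rotations with sum zero cancel in pairs: this is where √3 comes from.
-- For q ≡ 3 (mod 4) the plane is the field F[i]; for q ≡ 1 it is F × F in isotropic coordinates, and then the pairs at
-- isotropic distance have to be tracked through both sides of the final inequality.

-- Where the constants come from: write `n` for the number of points, `D` for the number of
-- distances and `S` for the second moment. Up to lower order terms `q² S = q n⁴ + m₂`, and the
-- extension bound reads `m₂ ≤ √3 q n^(3/2) m₁` with `m₁` close to `n (q² - n)`. As soon as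
-- `n³ ≥ q⁴` this gives `q² S ≤ (1 + √3) q n⁴`, and `n⁴ ≤ D S` yields the density `1 / (1 + √3)`.
-- For `q ≡ 1` the factor `(1 - 2/q)²` is the price of discarding the pairs at distance zero, and
-- the saving `√3 q^(-2/3)` is the factor `q² - n` inside `m₁`. The isotropic frequencies have to go
-- because a nonzero isotropic `ω` is a zero divisor: a sum over all `x` of values at `c + ω x`
-- vanishes only for a kernel with mean zero along each isotropic axis. All estimates live in the
-- integers. Semidefinite forms replace square roots, √3 occurs only squared, and rational numbers
-- enter only when the last inequality is translated.

module DistanceSets where

  open import Defs
  open import Level using (0ℓ)
  open import Data.Nat as ℕ using (ℕ; zero; suc; z≤n; s≤s)
  import Data.Nat.Properties as ℕₚ
  open import Data.Integer as ℤ using (ℤ; +_; -[1+_]; 0ℤ; 1ℤ; _+_; _*_; _-_; -_; _≤_; _<_; +≤+; _⊖_)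
  open import Data.Integer.Properties as ℤₚ using (*-identityˡ; *-identityʳ; *-zeroʳ; *-zeroˡ; +-identityʳ; +-identityˡ; *-comm; +-comm; +-mono-≤)
  open import Data.Integer.Tactic.RingSolver using (solve-∀)
  open import Data.List using (List; []; _∷_; _++_; map; filter; length; cartesianProduct; allFin)
  import Data.List.Properties as Listₚ
  import Data.Product.Properties as ×ₚ
  open import Data.List.Relation.Unary.Any using (here; there)
  open import Data.List.Membership.Propositional using (_∈_)
  open import Data.List.Membership.Propositional.Properties using (∈-filter⁻; ∈-map⁻)
  open import Data.Fin as Fin using (Fin)
  import Data.Fin.Properties as Finₚ
  open import Data.Product using (_×_; _,_; proj₁; proj₂; ∃)
  open import Data.Sum as Sum using (_⊎_; inj₁; inj₂)
  open import Data.Empty using (⊥; ⊥-elim)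
  open import Function using (_∘_; Inverse)
  open import Relation.Nullary using (¬_; ¬?; Dec; does; yes; no; contradiction)
  open import Relation.Binary.Definitions using (DecidableEquality; tri<; tri≈; tri>)
  open import Relation.Unary using (Decidable)
  open import Relation.Binary.PropositionalEquality using (_≡_; _≢_; refl; sym; trans; cong; cong₂; subst; module ≡-Reasoning)
  open import Algebra.Structures using (IsCommutativeRing; IsAbelianGroup)
  open import Algebra.Bundles using (CommutativeRing)
  import Algebra.Solver.Ring
  import Algebra.Solver.Ring.AlmostCommutativeRing as ACR
  open import Data.Maybe using (Maybe; just; nothing)
  open import Data.Bool as Bool using (Bool; true; false; _∧_)
  open import Data.Bool.ListAction using (any)
  open import Data.Rational as ℚ using (ℚ; 0ℚ; 1ℚ)
  open import Data.Nat.DivMod using (_%_; _/_; [m+kn]%n≡m%n; m*n%n≡0; m≡m%n+[m/n]*n; m/n*n≤m; m%n<n)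
  import Data.Rational.Properties as ℚₚ
  import Data.Rational.Unnormalised as ℚᵘ
  import Data.Rational.Unnormalised.Properties as ℚᵘₚ
  open import Data.Rational.Solver using (module +-*-Solver)

  -- Finite sums

  private variable
    I J : Set
    𝒫 𝒬 : Set

  Σ : List I → (I → ℤ) → ℤ
  Σ []  f = 0ℤ
  Σ (x ∷ xs) f = f x + Σ xs f

  𝟙 : Dec 𝒫 → ℤ
  𝟙 (yes _) = 1ℤ
  𝟙 (no _)  = 0ℤ

  𝟙-yes : (d : Dec 𝒫) → 𝒫 → 𝟙 d ≡ 1ℤ
  𝟙-yes (yes _) p = refl
  𝟙-yes (no ¬p) p = contradiction p ¬p

  𝟙-no : (d : Dec 𝒫) → ¬ 𝒫 → 𝟙 d ≡ 0ℤ
  𝟙-no (yes p) ¬p = contradiction p ¬p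
  𝟙-no (no _)  _  = refl

  𝟙-cong : (d : Dec 𝒫) (e : Dec 𝒬) → (𝒫 → 𝒬) → (𝒬 → 𝒫) → 𝟙 d ≡ 𝟙 e
  𝟙-cong (yes p) e f g = sym (𝟙-yes e (f p))
  𝟙-cong (no ¬p) e f g = sym (𝟙-no e (λ q → ¬p (g q)))

  𝟙≥0 : (d : Dec 𝒫) → 0ℤ ≤ 𝟙 d
  𝟙≥0 (yes _) = +≤+ z≤n
  𝟙≥0 (no _)  = +≤+ z≤n

  𝟙-subst : (_≟_ : DecidableEquality I) (x p : I) (f : I → ℤ) → 𝟙 (x ≟ p) * f x ≡ 𝟙 (x ≟ p) * f p
  𝟙-subst _≟_ x p f with x ≟ p
  ... | yes refl = refl
  ... | no  _  = refl

  Σ-cong-∈ : (xs : List I) {f g : I → ℤ} → (∀ x → x ∈ xs → f x ≡ g x) → Σ xs f ≡ Σ xs g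
  Σ-cong-∈ []  h = refl
  Σ-cong-∈ (x ∷ xs) h = cong₂ _+_ (h x (here refl)) (Σ-cong-∈ xs (λ y y∈ → h y (there y∈)))

  Σ-cong : (xs : List I) {f g : I → ℤ} → (∀ x → f x ≡ g x) → Σ xs f ≡ Σ xs g
  Σ-cong xs h = Σ-cong-∈ xs (λ x _ → h x)

  Σ-zero : (xs : List I) → Σ xs (λ _ → 0ℤ) ≡ 0ℤ
  Σ-zero []  = refl
  Σ-zero (x ∷ xs) = trans (+-identityˡ _) (Σ-zero xs)

  Σ-+ : (xs : List I) (f g : I → ℤ) → Σ xs (λ x → f x + g x) ≡ Σ xs f + Σ xs g
  Σ-+ []  f g = refl
  Σ-+ (x ∷ xs) f g = trans (cong (_+_ (f x + g x)) (Σ-+ xs f g)) (interchange (f x) (g x) (Σ xs f) (Σ xs g))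
    where interchange : ∀ a b c d → a + b + (c + d) ≡ a + c + (b + d)
          interchange = solve-∀

  Σ-*ˡ : (xs : List I) (c : ℤ) (f : I → ℤ) → Σ xs (λ x → c * f x) ≡ c * Σ xs f
  Σ-*ˡ []  c f = sym (*-zeroʳ c)
  Σ-*ˡ (x ∷ xs) c f = trans (cong (_+_ (c * f x)) (Σ-*ˡ xs c f)) (sym (ℤₚ.*-distribˡ-+ c (f x) (Σ xs f)))

  Σ-*ʳ : (xs : List I) (c : ℤ) (f : I → ℤ) → Σ xs (λ x → f x * c) ≡ Σ xs f * c
  Σ-*ʳ xs c f = trans (Σ-cong xs (λ x → *-comm (f x) c)) (trans (Σ-*ˡ xs c f) (*-comm c _))

  Σ-neg : (xs : List I) (f : I → ℤ) → Σ xs (λ x → - f x) ≡ - Σ xs f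
  Σ-neg []  f = refl
  Σ-neg (x ∷ xs) f = trans (cong (_+_ (- f x)) (Σ-neg xs f)) (sym (ℤₚ.neg-distrib-+ (f x) _))

  Σ-- : (xs : List I) (f g : I → ℤ) → Σ xs (λ x → f x - g x) ≡ Σ xs f - Σ xs g
  Σ-- xs f g = trans (Σ-+ xs f (λ x → - g x)) (cong (_+_ (Σ xs f)) (Σ-neg xs g))

  Σ-swap : (xs : List I) (ys : List J) (f : I → J → ℤ) →
           Σ xs (λ x → Σ ys (f x)) ≡ Σ ys (λ y → Σ xs (λ x → f x y))
  Σ-swap []  ys f = sym (Σ-zero ys)
  Σ-swap (x ∷ xs) ys f = trans (cong (_+_ (Σ ys (f x))) (Σ-swap xs ys f)) (sym (Σ-+ ys (f x) _))

  Σ-product : (xs : List I) (ys : List J) (f : I → ℤ) (g : J → ℤ) →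
              Σ xs (λ x → Σ ys (λ y → f x * g y)) ≡ Σ xs f * Σ ys g
  Σ-product xs ys f g = trans (Σ-cong xs (λ x → Σ-*ˡ ys (f x) g)) (Σ-*ʳ xs (Σ ys g) f)

  Σ-mono-∈ : (xs : List I) {f g : I → ℤ} → (∀ x → x ∈ xs → f x ≤ g x) → Σ xs f ≤ Σ xs g
  Σ-mono-∈ []  h = ℤₚ.≤-refl
  Σ-mono-∈ (x ∷ xs) h = +-mono-≤ (h x (here refl)) (Σ-mono-∈ xs (λ y y∈ → h y (there y∈)))

  Σ-mono : (xs : List I) {f g : I → ℤ} → (∀ x → f x ≤ g x) → Σ xs f ≤ Σ xs g
  Σ-mono xs h = Σ-mono-∈ xs (λ x _ → h x)

  Σ≥0-∈ : (xs : List I) {f : I → ℤ} → (∀ x → x ∈ xs → 0ℤ ≤ f x) → 0ℤ ≤ Σ xs f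
  Σ≥0-∈ []  h = ℤₚ.≤-refl
  Σ≥0-∈ (x ∷ xs) h = +-mono-≤ (h x (here refl)) (Σ≥0-∈ xs (λ y y∈ → h y (there y∈)))

  Σ≥0 : (xs : List I) {f : I → ℤ} → (∀ x → 0ℤ ≤ f x) → 0ℤ ≤ Σ xs f
  Σ≥0 xs h = Σ≥0-∈ xs (λ x _ → h x)

  Σ-++ : (xs ys : List I) (f : I → ℤ) → Σ (xs ++ ys) f ≡ Σ xs f + Σ ys f
  Σ-++ []  ys f = sym (+-identityˡ _)
  Σ-++ (x ∷ xs) ys f = trans (cong (_+_ (f x)) (Σ-++ xs ys f)) (sym (ℤₚ.+-assoc (f x) _ _))

  Σ-map : (g : I → J) (xs : List I) (f : J → ℤ) → Σ (map g xs) f ≡ Σ xs (f ∘ g)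
  Σ-map g []  f = refl
  Σ-map g (x ∷ xs) f = cong (_+_ (f (g x))) (Σ-map g xs f)

  Σ-filter : {𝒫 : I → Set} (P? : Decidable 𝒫) (xs : List I) (f : I → ℤ) →
             Σ (filter P? xs) f ≡ Σ xs (λ x → 𝟙 (P? x) * f x)
  Σ-filter P? []  f = refl
  Σ-filter P? (x ∷ xs) f with P? x
  ... | yes _ = cong₂ _+_ (sym (*-identityˡ (f x))) (Σ-filter P? xs f)
  ... | no  _ = trans (Σ-filter P? xs f) (sym (+-identityˡ _))

  Σ-cartesianProduct : (xs : List I) (ys : List J) (f : I × J → ℤ) →
                       Σ (cartesianProduct xs ys) f ≡ Σ xs (λ x → Σ ys (λ y → f (x , y)))
  Σ-cartesianProduct []  ys f = refl
  Σ-cartesianProduct (x ∷ xs) ys f = trans (Σ-++ (map (x ,_) ys) _ f)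
    (cong₂ _+_ (Σ-map (x ,_) ys f) (Σ-cartesianProduct xs ys f))

  Σ-length : (xs : List I) → Σ xs (λ _ → 1ℤ) ≡ + length xs
  Σ-length []  = refl
  Σ-length (x ∷ xs) = cong (_+_ 1ℤ) (Σ-length xs)

  Σ-const : (xs : List I) (c : ℤ) → Σ xs (λ _ → c) ≡ + length xs * c
  Σ-const xs c = trans (Σ-cong xs (λ _ → sym (*-identityˡ c)))
    (trans (Σ-*ʳ xs c (λ _ → 1ℤ)) (cong (_* c) (Σ-length xs)))

  -- Membership with multiplicity exactly one, phrased as a sum so that it can be rewritten inside
  -- other sums.
  Once : DecidableEquality I → List I → I → Set
  Once _≟_ xs p = Σ xs (λ x → 𝟙 (x ≟ p)) ≡ 1ℤ

  module _ (_≟_ : DecidableEquality I) where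

    Σ-pick : (xs : List I) (p : I) → Once _≟_ xs p → (f : I → ℤ) → Σ xs (λ x → 𝟙 (x ≟ p) * f x) ≡ f p
    Σ-pick xs p once f = begin
      Σ xs (λ x → 𝟙 (x ≟ p) * f x) ≡⟨ Σ-cong xs (λ x → 𝟙-subst _≟_ x p f) ⟩
      Σ xs (λ x → 𝟙 (x ≟ p) * f p) ≡⟨ Σ-*ʳ xs (f p) (λ x → 𝟙 (x ≟ p)) ⟩
      Σ xs (λ x → 𝟙 (x ≟ p)) * f p ≡⟨ cong (_* f p) once ⟩
      1ℤ * f p  ≡⟨ *-identityˡ (f p) ⟩
      f p  ∎
      where open ≡-Reasoning

    Once-filter : {𝒫 : I → Set} (P? : Decidable 𝒫) (xs : List I) (p : I) → 𝒫 p → Once _≟_ xs p → Once _≟_ (filter P? xs) p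
    Once-filter P? xs p Pp once = begin
      Σ (filter P? xs) (λ x → 𝟙 (x ≟ p))  ≡⟨ Σ-filter P? xs _ ⟩
      Σ xs (λ x → 𝟙 (P? x) * 𝟙 (x ≟ p))  ≡⟨ Σ-cong xs (λ x → *-comm (𝟙 (P? x)) _) ⟩
      Σ xs (λ x → 𝟙 (x ≟ p) * 𝟙 (P? x))  ≡⟨ Σ-pick xs p once _ ⟩
      𝟙 (P? p)  ≡⟨ 𝟙-yes (P? p) Pp ⟩
      1ℤ  ∎
      where open ≡-Reasoning

  -- Insert the indicator of `y = σ x`, exchange the sums and read it as the indicator of `x = τ y`.
  -- The inverse laws are required on the lists only, because `units`, `half` and `nonzero` are
  -- proper sublists on which alone the maps are inverse to each other.
  Σ-bijection : (_≟_ : DecidableEquality I) (_≟′_ : DecidableEquality J) (xs : List I) (ys : List J)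
                (σ : I → J) (τ : J → I) →
                (∀ x → x ∈ xs → Once _≟′_ ys (σ x)) → (∀ y → y ∈ ys → Once _≟_ xs (τ y)) →
                (∀ x → x ∈ xs → τ (σ x) ≡ x) → (∀ y → y ∈ ys → σ (τ y) ≡ y) →
                (f : J → ℤ) → Σ xs (f ∘ σ) ≡ Σ ys f
  Σ-bijection _≟_ _≟′_ xs ys σ τ σ-once τ-once τσ στ f = begin
    Σ xs (f ∘ σ)  ≡⟨ Σ-cong-∈ xs (λ x x∈ → sym (Σ-pick _≟′_ ys (σ x) (σ-once x x∈) f)) ⟩
    Σ xs (λ x → Σ ys (λ y → 𝟙 (y ≟′ σ x) * f y))  ≡⟨ Σ-swap xs ys _ ⟩
    Σ ys (λ y → Σ xs (λ x → 𝟙 (y ≟′ σ x) * f y))  ≡⟨ Σ-cong-∈ ys inner ⟩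
    Σ ys f  ∎
    where
    open ≡-Reasoning
    inner : ∀ y → y ∈ ys → Σ xs (λ x → 𝟙 (y ≟′ σ x) * f y) ≡ f y
    inner y y∈ = begin
      Σ xs (λ x → 𝟙 (y ≟′ σ x) * f y)  ≡⟨ Σ-cong-∈ xs (λ x x∈ → cong (_* f y) (𝟙-cong (y ≟′ σ x) (x ≟ τ y)
                                           (λ { refl → sym (τσ x x∈) }) (λ { refl → sym (στ y y∈) }))) ⟩
      Σ xs (λ x → 𝟙 (x ≟ τ y) * f y)   ≡⟨ Σ-pick _≟_ xs (τ y) (τ-once y y∈) (λ _ → f y) ⟩
      f y  ∎

  -- Integer inequalities, certified by an explicit nonnegative difference and a ring identity

  i≤j+ : {i j : ℤ} (d : ℤ) → 0ℤ ≤ d → j ≡ i + d → i ≤ j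
  i≤j+ {i} {j} d 0≤d eq = subst (i ≤_) (sym eq) (subst (_≤ i + d) (+-identityʳ i) (ℤₚ.+-monoʳ-≤ i 0≤d))

  i<j+ : {i j : ℤ} (d : ℤ) → 0ℤ < d → j ≡ i + d → i < j
  i<j+ {i} {j} d 0<d eq = subst (i <_) (sym eq) (subst (_< i + d) (+-identityʳ i) (ℤₚ.+-monoʳ-< i 0<d))

  subst₂′ : {a b c d : ℤ} → a ≡ b → c ≡ d → a ≤ c → b ≤ d
  subst₂′ refl refl p = p

  subst₂< : {a b c d : ℤ} → a ≡ b → c ≡ d → a < c → b < d
  subst₂< refl refl p = p

  0≤+ : {a b : ℤ} → 0ℤ ≤ a → 0ℤ ≤ b → 0ℤ ≤ a + b
  0≤+ = +-mono-≤

  0<+ : {a b : ℤ} → 0ℤ < a → 0ℤ ≤ b → 0ℤ < a + b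
  0<+ = ℤₚ.+-mono-<-≤

  0≤* : {a b : ℤ} → 0ℤ ≤ a → 0ℤ ≤ b → 0ℤ ≤ a * b
  0≤* {+ m} {+ n} _ _ = subst (0ℤ ≤_) (ℤₚ.pos-* m n) (+≤+ z≤n)

  0<* : {a b : ℤ} → 0ℤ < a → 0ℤ < b → 0ℤ < a * b
  0<* {+ suc m} {+ suc n} _ _ = ℤ.+<+ (s≤s z≤n)
  0<* {+ zero}  {+ suc n} (ℤ.+<+ ()) _
  0<* {+ m}  {+ zero} _ (ℤ.+<+ ())

  0≤² : (a : ℤ) → 0ℤ ≤ a * a
  0≤² (+ n)  = 0≤* {+ n} {+ n} (+≤+ z≤n) (+≤+ z≤n)
  0≤² -[1+ n ] = +≤+ z≤n

  *-mono-≤₀ : {a b c d : ℤ} → 0ℤ ≤ a → 0ℤ ≤ c → a ≤ b → c ≤ d → a * c ≤ b * d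
  *-mono-≤₀ {a} {b} {c} {d} 0≤a 0≤c a≤b c≤d =
    i≤j+ ((b - a) * d + a * (d - c))
      (0≤+ (0≤* (ℤₚ.i≤j⇒0≤j-i a≤b) (ℤₚ.≤-trans 0≤c c≤d)) (0≤* 0≤a (ℤₚ.i≤j⇒0≤j-i c≤d)))
      (identity a b c d)
    where identity : ∀ a b c d → b * d ≡ a * c + ((b - a) * d + a * (d - c))
          identity = solve-∀

  *-cancel-≤ : {a b : ℤ} (c : ℤ) → 0ℤ < c → c * a ≤ c * b → a ≤ b
  *-cancel-≤ {a} {b} (+ suc n) _ h = ℤₚ.*-cancelˡ-≤-pos a b (+ suc n) h
  *-cancel-≤ (+ zero) (ℤ.+<+ ()) h

  -- Cauchy-Schwarz for an integral semidefinite form, without roots or division: for `a > 0` the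
  -- value at `(- b , a)` is `a (a c - b²)`. The degenerate case `a = 0` has to be settled
  -- separately, by showing `b = 0`.
  discriminant : (a b c : ℤ) → (∀ x y → 0ℤ ≤ x * x * a + + 2 * (x * y * b) + y * y * c) → b * b ≤ a * c
  discriminant a b c form with ℤₚ.<-cmp 0ℤ a
  ... | tri< 0<a _ _ =
    *-cancel-≤ a 0<a (ℤₚ.0≤i-j⇒j≤i (subst (0ℤ ≤_) (identity a b c) (form (- b) a)))
    where identity : ∀ a b c → (- b) * (- b) * a + + 2 * ((- b) * a * b) + a * a * c ≡ a * (a * c) - a * (b * b)
          identity = solve-∀
  ... | tri> _ _ a<0 =
    contradiction a<0 (ℤₚ.≤⇒≯ (subst (0ℤ ≤_) (identity a b c) (form 1ℤ 0ℤ)))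
    where identity : ∀ a b c → 1ℤ * 1ℤ * a + + 2 * (1ℤ * 0ℤ * b) + 0ℤ * 0ℤ * c ≡ a
          identity = solve-∀
  ... | tri≈ _ refl _ with 0ℤ ℤ.<? b * b
  ...   | no  b²≯0 = subst (b * b ≤_) (sym (*-zeroˡ c)) (ℤₚ.≮⇒≥ b²≯0)
  ...   | yes 0<b² = contradiction c<0 (ℤₚ.≤⇒≯ 0≤c)
    where
    value₁ : ∀ b c → 0ℤ * 0ℤ * 0ℤ + + 2 * (0ℤ * 1ℤ * b) + 1ℤ * 1ℤ * c ≡ c
    value₁ = solve-∀
    0≤c : 0ℤ ≤ c
    0≤c = subst (0ℤ ≤_) (value₁ b c) (form 0ℤ 1ℤ)
    -- With `a = 0` the value at `(x , 1)` is `2 x b + c`; for `b² ≥ 1` and `c ≥ 0` this choice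
    -- makes it `c - 2 b² (c + 1)`, which is negative.
    x = - (b * (c + 1ℤ))
    value₂ : ∀ b c → 0ℤ ≡ c + ((- (b * (c + 1ℤ))) * (- (b * (c + 1ℤ))) * 0ℤ + + 2 * ((- (b * (c + 1ℤ))) * 1ℤ * b) + 1ℤ * 1ℤ * c
      + (+ 2 * ((b * b - 1ℤ) * (c + 1ℤ)) + + 2))
    value₂ = solve-∀
    c<0 : c < 0ℤ
    c<0 = i<j+ _ (ℤₚ.<-≤-trans (ℤ.+<+ (s≤s z≤n)) (i≤j+ {+ 2} _ (0≤+ (form x 1ℤ)
            (0≤* {+ 2} (+≤+ z≤n) (0≤* (ℤₚ.i≤j⇒0≤j-i (ℤₚ.i<j⇒suc[i]≤j 0<b²)) (0≤+ 0≤c (+≤+ z≤n)))))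
            (rearrange b c x))) (value₂ b c)
      where
      rearrange : ∀ b c x → x * x * 0ℤ + + 2 * (x * 1ℤ * b) + 1ℤ * 1ℤ * c + (+ 2 * ((b * b - 1ℤ) * (c + 1ℤ)) + + 2)
        ≡ + 2 + (x * x * 0ℤ + + 2 * (x * 1ℤ * b) + 1ℤ * 1ℤ * c + + 2 * ((b * b - 1ℤ) * (c + 1ℤ)))
      rearrange = solve-∀

  Σ-Cauchy-Schwarz : (xs : List I) (f g : I → ℤ) →
    Σ xs (λ x → f x * g x) * Σ xs (λ x → f x * g x) ≤ Σ xs (λ x → f x * f x) * Σ xs (λ x → g x * g x)
  Σ-Cauchy-Schwarz xs f g = discriminant _ _ _ λ x y →
    subst (0ℤ ≤_) (expand x y) (Σ≥0 xs (λ i → 0≤² (x * f i + y * g i)))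
    where
    open ≡-Reasoning
    square : ∀ x y a b → (x * a + y * b) * (x * a + y * b) ≡ x * x * (a * a) + + 2 * (x * y) * (a * b) + y * y * (b * b)
    square = solve-∀
    expand : ∀ x y → Σ xs (λ i → (x * f i + y * g i) * (x * f i + y * g i)) ≡
      x * x * Σ xs (λ i → f i * f i) + + 2 * (x * y * Σ xs (λ i → f i * g i)) + y * y * Σ xs (λ i → g i * g i)
    expand x y = begin
      _ ≡⟨ Σ-cong xs (λ i → square x y (f i) (g i)) ⟩
      _ ≡⟨ trans (Σ-+ xs _ _) (cong₂ _+_ (Σ-+ xs _ _) refl) ⟩
      _ ≡⟨ cong₂ _+_ (cong₂ _+_ (Σ-*ˡ xs (x * x) _) (trans (Σ-*ˡ xs (+ 2 * (x * y)) _) (ℤₚ.*-assoc (+ 2) (x * y) _))) (Σ-*ˡ xs (y * y) _) ⟩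
      _ ∎

  -- Coefficients in the ring itself would not do: in an abstract ring 1 - 1 = 0 is not decided by computation.
  module IntegerCoefficients {c ℓ} (R : CommutativeRing c ℓ) where
    private
      module R = CommutativeRing R
      open import Algebra.Properties.Ring R.ring
      open import Algebra.Properties.AbelianGroup R.+-abelianGroup
      open import Algebra.Properties.Semiring.Mult.TCOptimised R.semiring using (1+×; ×-homo-+; ×1-homo-*) renaming (_×_ to _·_)
      open import Relation.Binary.Reasoning.Setoid R.setoid

    embed : ℤ → R.Carrier
    embed (+ n)  = n · R.1#
    embed -[1+ n ] = R.- (suc n · R.1#)

    private
      cancel : ∀ a x y → (a R.+ x) R.- (a R.+ y) R.≈ x R.- y
      cancel a x y = begin
        (a R.+ x) R.- (a R.+ y)  ≈⟨ R.+-cong (R.+-comm a x) (R.sym (⁻¹-∙-comm a y)) ⟩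
        (x R.+ a) R.+ (R.- a R.- y)  ≈⟨ R.+-assoc x a _ ⟩
        x R.+ (a R.+ (R.- a R.- y))  ≈⟨ R.+-congˡ (R.+-assoc a (R.- a) _) ⟨
        x R.+ (a R.- a R.- y)  ≈⟨ R.+-congˡ (R.+-congʳ (R.-‿inverseʳ a)) ⟩
        x R.+ (R.0# R.- y)  ≈⟨ R.+-congˡ (R.+-identityˡ _) ⟩
        x R.- y  ∎

      embed-⊖ : ∀ m n → embed (m ⊖ n) R.≈ m · R.1# R.- n · R.1#
      embed-⊖ zero  zero  = R.sym (R.-‿inverseʳ R.0#)
      embed-⊖ zero  (suc n) = R.sym (R.+-identityˡ _)
      embed-⊖ (suc m) zero  = begin
        suc m · R.1#  ≈⟨ R.+-identityʳ _ ⟨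
        suc m · R.1# R.+ R.0#  ≈⟨ R.+-congˡ ε⁻¹≈ε ⟨
        suc m · R.1# R.- R.0#  ∎
      embed-⊖ (suc m) (suc n) = begin
        embed (suc m ⊖ suc n)  ≡⟨ cong embed (ℤₚ.[1+m]⊖[1+n]≡m⊖n m n) ⟩
        embed (m ⊖ n)  ≈⟨ embed-⊖ m n ⟩
        m · R.1# R.- n · R.1#  ≈⟨ cancel R.1# _ _ ⟨
        (R.1# R.+ m · R.1#) R.- (R.1# R.+ n · R.1#)
          ≈⟨ R.+-cong (1+× m R.1#) (R.-‿cong (1+× n R.1#)) ⟨
        suc m · R.1# R.- suc n · R.1#  ∎

      embed-neg : ∀ i → embed (- i) R.≈ R.- embed i
      embed-neg (+ zero)  = R.sym ε⁻¹≈ε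
      embed-neg (+ suc n)   = R.refl
      embed-neg -[1+ n ]  = R.sym (⁻¹-involutive _)

      embed-+ : ∀ i j → embed (i + j) R.≈ embed i R.+ embed j
      embed-+ (+ m)  (+ n)  = ×-homo-+ R.1# m n
      embed-+ (+ m)  -[1+ n ] = embed-⊖ m (suc n)
      embed-+ -[1+ m ] (+ n)  = R.trans (embed-⊖ n (suc m)) (R.+-comm _ _)
      embed-+ -[1+ m ] -[1+ n ] = begin
        R.- (suc (suc (m ℕ.+ n)) · R.1#)  ≡⟨ cong (λ k → R.- (suc k · R.1#)) (ℕₚ.+-suc m n) ⟨
        R.- ((suc m ℕ.+ suc n) · R.1#)  ≈⟨ R.-‿cong (×-homo-+ R.1# (suc m) (suc n)) ⟩
        R.- (suc m · R.1# R.+ suc n · R.1#) ≈⟨ ⁻¹-∙-comm _ _ ⟨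
        R.- (suc m · R.1#) R.- suc n · R.1# ∎

      embed-pos-* : ∀ m n → embed (+ m * + n) R.≈ embed (+ m) R.* embed (+ n)
      embed-pos-* m n = R.trans (R.reflexive (cong embed (sym (ℤₚ.pos-* m n)))) (×1-homo-* m n)

      embed-* : ∀ i j → embed (i * j) R.≈ embed i R.* embed j
      embed-* (+ m)  (+ n)  = embed-pos-* m n
      embed-* (+ m)  -[1+ n ] = begin
        embed (+ m * - (+ suc n))  ≡⟨ cong embed (ℤₚ.neg-distribʳ-* (+ m) (+ suc n)) ⟨
        embed (- (+ m * + suc n))  ≈⟨ embed-neg (+ m * + suc n) ⟩
        R.- embed (+ m * + suc n)  ≈⟨ R.-‿cong (embed-pos-* m (suc n)) ⟩
        R.- (embed (+ m) R.* embed (+ suc n)) ≈⟨ -‿distribʳ-* _ _ ⟩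
        embed (+ m) R.* R.- embed (+ suc n) ∎
      embed-* -[1+ m ] (+ n) = begin
        embed (- (+ suc m) * + n)  ≡⟨ cong embed (ℤₚ.neg-distribˡ-* (+ suc m) (+ n)) ⟨
        embed (- (+ suc m * + n))  ≈⟨ embed-neg (+ suc m * + n) ⟩
        R.- embed (+ suc m * + n)  ≈⟨ R.-‿cong (embed-pos-* (suc m) n) ⟩
        R.- (embed (+ suc m) R.* embed (+ n)) ≈⟨ -‿distribˡ-* _ _ ⟩
        R.- embed (+ suc m) R.* embed (+ n) ∎
      embed-* -[1+ m ] -[1+ n ] = begin
        embed (+ suc m * + suc n)  ≈⟨ embed-pos-* (suc m) (suc n) ⟩
        embed (+ suc m) R.* embed (+ suc n) ≈⟨ ⁻¹-involutive _ ⟨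
        R.- R.- (embed (+ suc m) R.* embed (+ suc n)) ≈⟨ R.-‿cong (-‿distribˡ-* _ _) ⟩
        R.- (R.- embed (+ suc m) R.* embed (+ suc n)) ≈⟨ -‿distribʳ-* _ _ ⟩
        R.- embed (+ suc m) R.* R.- embed (+ suc n) ∎

      morphism : CommutativeRing.rawRing ℤₚ.+-*-commutativeRing ACR.-Raw-AlmostCommutative⟶ ACR.fromCommutativeRing R
      morphism = record
        { ⟦_⟧ = embed ; +-homo = embed-+ ; *-homo = embed-* ; -‿homo = embed-neg ; 0-homo = R.refl ; 1-homo = R.refl }

      _coeff≟_ : ∀ i j → Maybe (embed i R.≈ embed j)
      i coeff≟ j with i ℤ.≟ j
      ... | yes refl = just R.refl
      ... | no _  = nothing

    open Algebra.Solver.Ring _ _ morphism _coeff≟_ public using (solve; _:=_; _:+_; _:*_; :-_; _:-_; con; Polynomial)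

  record FiniteRing : Set₁ where
    infixl 6 _⊕_
    infixl 7 _⊗_
    infix  8 ⊖_
    infix  4 _≟_
    field
      Carrier : Set
      _⊕_ _⊗_ : Carrier → Carrier → Carrier
      ⊖_  : Carrier → Carrier
      0# 1#   : Carrier
      isCommutativeRing : IsCommutativeRing _≡_ _⊕_ _⊗_ ⊖_ 0# 1#
      _≟_  : DecidableEquality Carrier
      all  : List Carrier
      once  : ∀ p → Once _≟_ all p

    ring : CommutativeRing 0ℓ 0ℓ
    ring = record { isCommutativeRing = isCommutativeRing }

  -- The group ring of the additive group of K.
  module GroupRing (K : FiniteRing) where
    open FiniteRing K
    open CommutativeRing ring using () renaming (+-comm to ⊕-comm)
    open IntegerCoefficients ring

    Elem : Set
    Elem = Carrier → ℤ

    infix  4 _≈_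
    infixl 6 _⊞_
    infixl 7 _∗_

    _≈_ : Elem → Elem → Set
    a ≈ b = ∀ u → a u ≡ b u

    _⊞_ _∗_ : Elem → Elem → Elem
    (a ⊞ b) u = a u + b u
    (a ∗ b) u = Σ all (λ v → a v * b (u ⊕ ⊖ v))

    -- The coefficients are integers, so `star` is complex conjugation of the transform.
    ⊟_ star : Elem → Elem
    (⊟ a) u = - a u
    star a u = a (⊖ u)

    δ : Carrier → Elem
    δ p u = 𝟙 (u ≟ p)

    zer one : Elem
    zer _ = 0ℤ
    one = δ 0#

    -- Integer scalars as ring elements, so that the ring solver can carry them as ordinary
    -- variables.
    κ : ℤ → Elem
    κ c u = c * δ 0# u

    Σ-bij : (σ τ : Carrier → Carrier) → (∀ x → τ (σ x) ≡ x) → (∀ x → σ (τ x) ≡ x) →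
            (f : Carrier → ℤ) → Σ all (λ x → f (σ x)) ≡ Σ all f
    Σ-bij σ τ τσ στ = Σ-bijection _≟_ _≟_ all all σ τ (λ x _ → once (σ x)) (λ x _ → once (τ x)) (λ x _ → τσ x) (λ x _ → στ x)

    private
      i1 : ∀ u v → u ⊕ ⊖ (u ⊕ ⊖ v) ≡ v
      i1 = solve 2 (λ u v → (u :+ :- (u :+ :- v)) := v) refl
      i2 : ∀ u w → (u ⊕ w) ⊕ ⊖ w ≡ u
      i2 = solve 2 (λ u w → (u :+ w) :+ :- w := u) refl
      i3 : ∀ u w → (u ⊕ ⊖ w) ⊕ w ≡ u
      i3 = solve 2 (λ u w → (u :+ :- w) :+ w := u) refl
      i4 : ∀ u v w → u ⊕ ⊖ (v ⊕ w) ≡ (u ⊕ ⊖ w) ⊕ ⊖ v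
      i4 = solve 3 (λ u v w → u :+ :- (v :+ w) := (u :+ :- w) :+ :- v) refl
      i5 : ∀ u → ⊖ (⊖ u) ≡ u
      i5 = solve 1 (λ u → :- (:- u) := u) refl
      i6 : ∀ u v → ⊖ u ⊕ ⊖ (⊖ v) ≡ ⊖ (u ⊕ ⊖ v)
      i6 = solve 2 (λ u v → :- u :+ :- (:- v) := :- (u :+ :- v)) refl
      i7 : ∀ u → u ⊕ ⊖ 0# ≡ u
      i7 = solve 1 (λ u → u :+ :- con 0ℤ := u) refl

    ∗-cong : ∀ {a b c d} → a ≈ b → c ≈ d → a ∗ c ≈ b ∗ d
    ∗-cong a≈b c≈d u = Σ-cong all (λ v → cong₂ _*_ (a≈b v) (c≈d _))

    ∗-comm : ∀ a b → a ∗ b ≈ b ∗ a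
    ∗-comm a b u = begin
      Σ all (λ v → a v * b (u ⊕ ⊖ v))
        ≡⟨ Σ-bij (λ v → u ⊕ ⊖ v) (λ v → u ⊕ ⊖ v) (i1 u) (i1 u) _ ⟨
      Σ all (λ v → a (u ⊕ ⊖ v) * b (u ⊕ ⊖ (u ⊕ ⊖ v)))
        ≡⟨ Σ-cong all (λ v → trans (*-comm (a (u ⊕ ⊖ v)) _) (cong (λ t → b t * a (u ⊕ ⊖ v)) (i1 u v))) ⟩
      Σ all (λ v → b v * a (u ⊕ ⊖ v)) ∎
      where open ≡-Reasoning

    ∗-assoc : ∀ a b c → (a ∗ b) ∗ c ≈ a ∗ (b ∗ c)
    ∗-assoc a b c u = begin
      Σ all (λ v → Σ all (λ w → a w * b (v ⊕ ⊖ w)) * c (u ⊕ ⊖ v))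
        ≡⟨ Σ-cong all (λ v → sym (Σ-*ʳ all (c (u ⊕ ⊖ v)) _)) ⟩
      Σ all (λ v → Σ all (λ w → a w * b (v ⊕ ⊖ w) * c (u ⊕ ⊖ v)))
        ≡⟨ Σ-swap all all _ ⟩
      Σ all (λ w → Σ all (λ v → a w * b (v ⊕ ⊖ w) * c (u ⊕ ⊖ v)))
        ≡⟨ Σ-cong all (λ w → sym (Σ-bij (_⊕ w) (_⊕ ⊖ w) (λ x → i2 x w) (λ x → i3 x w) _)) ⟩
      Σ all (λ w → Σ all (λ v → a w * b (v ⊕ w ⊕ ⊖ w) * c (u ⊕ ⊖ (v ⊕ w))))
        ≡⟨ Σ-cong all (λ w → Σ-cong all (λ v → trans (ℤₚ.*-assoc (a w) _ _)
             (cong₂ (λ s t → a w * (b s * c t)) (i2 v w) (i4 u v w)))) ⟩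
      Σ all (λ w → Σ all (λ v → a w * (b v * c (u ⊕ ⊖ w ⊕ ⊖ v))))
        ≡⟨ Σ-cong all (λ w → Σ-*ˡ all (a w) _) ⟩
      Σ all (λ w → a w * Σ all (λ v → b v * c (u ⊕ ⊖ w ⊕ ⊖ v))) ∎
      where open ≡-Reasoning

    δ∗ : ∀ p a u → (δ p ∗ a) u ≡ a (u ⊕ ⊖ p)
    δ∗ p a u = Σ-pick _≟_ all p (once p) (λ v → a (u ⊕ ⊖ v))

    ∗-identityˡ : ∀ a → one ∗ a ≈ a
    ∗-identityˡ a u = trans (δ∗ 0# a u) (cong a (i7 u))

    ∗-distribˡ : ∀ a b c → a ∗ (b ⊞ c) ≈ (a ∗ b) ⊞ (a ∗ c)
    ∗-distribˡ a b c u = trans (Σ-cong all (λ v → ℤₚ.*-distribˡ-+ (a v) _ _)) (Σ-+ all _ _)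

    ∗-distribʳ : ∀ c a b → (a ⊞ b) ∗ c ≈ (a ∗ c) ⊞ (b ∗ c)
    ∗-distribʳ c a b u = trans (Σ-cong all (λ v → ℤₚ.*-distribʳ-+ _ (a v) (b v))) (Σ-+ all _ _)

    groupRing : CommutativeRing 0ℓ 0ℓ
    groupRing = record
      { Carrier = Elem ; _≈_ = _≈_ ; _+_ = _⊞_ ; _*_ = _∗_ ; -_ = ⊟_ ; 0# = zer ; 1# = one
      ; isCommutativeRing = record
        { isRing = record
          { +-isAbelianGroup = record
            { isGroup = record
              { isMonoid = record
                { isSemigroup = record
                  { isMagma = record
                    { isEquivalence = record
                      { refl = λ _ → refl ; sym = λ h u → sym (h u) ; trans = λ h k u → trans (h u) (k u) }
                    ; ∙-cong = λ h k u → cong₂ _+_ (h u) (k u) }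
                  ; assoc = λ a b c u → ℤₚ.+-assoc (a u) (b u) (c u) }
                ; identity = (λ a u → ℤₚ.+-identityˡ (a u)) , (λ a u → ℤₚ.+-identityʳ (a u)) }
              ; inverse = (λ a u → ℤₚ.+-inverseˡ (a u)) , (λ a u → ℤₚ.+-inverseʳ (a u))
              ; ⁻¹-cong = λ h u → cong -_ (h u) }
            ; comm = λ a b u → ℤₚ.+-comm (a u) (b u) }
          ; *-cong = λ {a} {b} {c} {d} → ∗-cong {a} {b} {c} {d}
          ; *-assoc = ∗-assoc
          ; *-identity = ∗-identityˡ , (λ a u → trans (∗-comm a one u) (∗-identityˡ a u))
          ; distrib = ∗-distribˡ , ∗-distribʳ }
        ; *-comm = ∗-comm } }

    star-∗ : ∀ a b → star (a ∗ b) ≈ star a ∗ star b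
    star-∗ a b u = begin
      Σ all (λ v → a v * b (⊖ u ⊕ ⊖ v))
        ≡⟨ Σ-bij ⊖_ ⊖_ i5 i5 _ ⟨
      Σ all (λ v → a (⊖ v) * b (⊖ u ⊕ ⊖ (⊖ v)))
        ≡⟨ Σ-cong all (λ v → cong (λ t → a (⊖ v) * b t) (i6 u v)) ⟩
      Σ all (λ v → a (⊖ v) * b (⊖ (u ⊕ ⊖ v))) ∎
      where open ≡-Reasoning

    ΣR : {I : Set} → List I → (I → Elem) → Elem
    ΣR xs f u = Σ xs (λ i → f i u)

    ΣR-∗ʳ : {I : Set} (xs : List I) (f : I → Elem) (a : Elem) → ΣR xs f ∗ a ≈ ΣR xs (λ i → f i ∗ a)
    ΣR-∗ʳ xs f a u = trans (Σ-cong all (λ v → sym (Σ-*ʳ xs (a (u ⊕ ⊖ v)) (λ i → f i v)))) (Σ-swap all xs _)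

    ΣR-∗ˡ : {I : Set} (xs : List I) (a : Elem) (f : I → Elem) → a ∗ ΣR xs f ≈ ΣR xs (λ i → a ∗ f i)
    ΣR-∗ˡ xs a f u = trans (Σ-cong all (λ v → sym (Σ-*ˡ xs (a v) (λ i → f i (u ⊕ ⊖ v))))) (Σ-swap all xs _)

    κ∗ : ∀ c a u → (κ c ∗ a) u ≡ c * a u
    κ∗ c a u = begin
      Σ all (λ v → c * δ 0# v * a (u ⊕ ⊖ v))   ≡⟨ Σ-cong all (λ v → ℤₚ.*-assoc c (δ 0# v) _) ⟩
      Σ all (λ v → c * (δ 0# v * a (u ⊕ ⊖ v))) ≡⟨ Σ-*ˡ all c _ ⟩
      c * (one ∗ a) u  ≡⟨ cong (c *_) (∗-identityˡ a u) ⟩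
      c * a u  ∎
      where open ≡-Reasoning

    δ-+ : ∀ p r → δ p ∗ δ r ≈ δ (p ⊕ r)
    δ-+ p r u = trans (δ∗ p (δ r) u) (𝟙-cong _ _
      (λ h → trans (sym (i3 u p)) (trans (cong (_⊕ p) h) (⊕-comm r p)))
      (λ h → trans (cong (_⊕ ⊖ p) (trans h (⊕-comm p r))) (i2 r p)))

    star-δ : ∀ p → star (δ p) ≈ δ (⊖ p)
    star-δ p u = 𝟙-cong _ _ (λ h → trans (sym (i5 u)) (cong ⊖_ h)) (λ h → trans (cong ⊖_ h) (i5 p))

    star-star : ∀ a → star (star a) ≈ a
    star-star a u = cong a (i5 u)

    star-one : star one ≈ one
    star-one u = trans (star-δ 0# u) (cong (λ t → δ t u) (solve 0 (:- con 0ℤ := con 0ℤ) refl))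

    star-κ : ∀ c → star (κ c) ≈ κ c
    star-κ c u = cong (c *_) (star-one u)

    -- Parseval without characters. Every later nonnegativity of the functional `L` comes down to
    -- this sum of squares.
    norm² : ∀ a → (a ∗ star a) 0# ≡ Σ all (λ v → a v * a v)
    norm² a = Σ-cong all (λ v → cong (λ t → a v * a t) (i8 v))
      where i8 : ∀ v → ⊖ (0# ⊕ ⊖ v) ≡ v
            i8 = solve 1 (λ v → :- (con 0ℤ :+ :- v) := v) refl

  -- The extension estimate

  -- The common ground of the field `F[i]` and of `F × F` with the swap as conjugation; rotations
  -- are the elements of norm one.
  record Geometry : Set₁ where
    field
      K : FiniteRing
    open FiniteRing K public
    field
      conj  : Carrier → Carrier
      conj-⊕  : ∀ z w → conj (z ⊕ w) ≡ conj z ⊕ conj w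
      conj-⊗  : ∀ z w → conj (z ⊗ w) ≡ conj z ⊗ conj w
      conj-⊖  : ∀ z → conj (⊖ z) ≡ ⊖ conj z
      conj-conj : ∀ z → conj (conj z) ≡ z
      conj-0  : conj 0# ≡ 0#
      conj-1  : conj 1# ≡ 1#

    Unit : Carrier → Set
    Unit z = z ⊗ conj z ≡ 1#

    Unit? : Decidable Unit
    Unit? z = (z ⊗ conj z) ≟ 1#

    units : List Carrier
    units = filter Unit? all

    field
      -- `F × F` has zero divisors, so cancellation is demanded only for a sum of two rotations.
      regular  : ∀ {z w} → Unit z → Unit w → ∀ r → (z ⊕ w) ⊗ r ≡ 0# → z ⊕ w ≡ 0# ⊎ r ≡ 0#
      -- M times the Fourier multiplier that keeps the non-isotropic frequencies
      π  : Carrier → ℤ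
      M  : ℤ
      0<M  : 0ℤ < M
      size  : Σ all (λ _ → 1ℤ) ≡ M
      π-invariant  : ∀ {θ} → Unit θ → ∀ u → π (θ ⊗ u) ≡ π u
      π-idempotent : ∀ u → Σ all (λ v → π v * π (u ⊕ ⊖ v)) ≡ M * π u
      -- This must also hold for a nonzero zero divisor `ω`, and that dictates which frequencies `π`
      -- has to remove.
      π-vanishing  : ∀ ω → ω ≢ 0# → ∀ c → Σ all (λ x → π (c ⊕ ω ⊗ x)) ≡ 0ℤ

    module KR = CommutativeRing ring
    open IntegerCoefficients ring public

    Unit-1 : Unit 1#
    Unit-1 = trans (KR.*-identityˡ _) conj-1

    Unit-⊖ : ∀ {z} → Unit z → Unit (⊖ z)
    Unit-⊖ {z} u = trans (cong (⊖ z ⊗_) (conj-⊖ z)) (trans (solve 2 (λ a b → :- a :* :- b := a :* b) refl z (conj z)) u)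

    Unit-conj : ∀ {z} → Unit z → Unit (conj z)
    Unit-conj {z} u = trans (cong (conj z ⊗_) (conj-conj z)) (trans (KR.*-comm _ _) u)

    Unit-⊗ : ∀ {z w} → Unit z → Unit w → Unit (z ⊗ w)
    Unit-⊗ {z} {w} u v = begin
      z ⊗ w ⊗ conj (z ⊗ w)  ≡⟨ cong (z ⊗ w ⊗_) (conj-⊗ z w) ⟩
      z ⊗ w ⊗ (conj z ⊗ conj w)  ≡⟨ solve 4 (λ a b c d → a :* b :* (c :* d) := a :* c :* (b :* d)) refl z w (conj z) (conj w) ⟩
      z ⊗ conj z ⊗ (w ⊗ conj w)  ≡⟨ cong₂ _⊗_ u v ⟩
      1# ⊗ 1#  ≡⟨ KR.*-identityˡ 1# ⟩
      1#  ∎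
      where open ≡-Reasoning

    ∈-units : ∀ {z} → z ∈ units → Unit z
    ∈-units z∈ = proj₂ (∈-filter⁻ Unit? {xs = all} z∈)

    once-units : ∀ {z} → Unit z → Once _≟_ units z
    once-units {z} u = Once-filter _≟_ Unit? all z u (once z)

    Σ-units-⊖ : (f : Carrier → ℤ) → Σ units (λ θ → f (⊖ θ)) ≡ Σ units f
    Σ-units-⊖ = Σ-bijection _≟_ _≟_ units units ⊖_ ⊖_ once-⊖ once-⊖ (λ x _ → ⊖⊖ x) (λ x _ → ⊖⊖ x)
      where
      once-⊖ : ∀ x → x ∈ units → Once _≟_ units (⊖ x)
      once-⊖ x x∈ = once-units (Unit-⊖ (∈-units x∈))
      ⊖⊖ : ∀ x → ⊖ (⊖ x) ≡ x
      ⊖⊖ = solve 1 (λ x → :- (:- x) := x) refl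

    Σ-units-⊗ : ∀ {z} → Unit z → (f : Carrier → ℤ) → Σ units (λ θ → f (z ⊗ θ)) ≡ Σ units f
    Σ-units-⊗ {z} u = Σ-bijection _≟_ _≟_ units units (z ⊗_) (conj z ⊗_)
      (λ x x∈ → once-units (Unit-⊗ u (∈-units x∈))) (λ x x∈ → once-units (Unit-⊗ (Unit-conj u) (∈-units x∈)))
      (λ x _ → trans (solve 3 (λ a b c → b :* (a :* c) := a :* b :* c) refl z (conj z) x) (1⊗ x))
      (λ x _ → trans (sym (KR.*-assoc _ _ _)) (1⊗ x))
      where
      1⊗ : ∀ x → z ⊗ conj z ⊗ x ≡ x
      1⊗ x = trans (cong (_⊗ x) u) (KR.*-identityˡ x)

    neg-unique : ∀ z w → z ⊕ w ≡ 0# → w ≡ ⊖ z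
    neg-unique z w h = trans (solve 2 (λ z w → w := (z :+ w) :+ :- z) refl z w)
      (trans (cong (_⊕ ⊖ z) h) (KR.+-identityˡ _))

    -- With e₁ = 0 and, after conjugating, e₃ = 0 the elementary symmetric functions give (a+b)(a+c)(b+c) = e₁e₂ - e₃ = 0.
    vanishing-sum : ∀ {a b c d} → Unit a → Unit b → Unit c → Unit d → a ⊕ b ⊕ (c ⊕ d) ≡ 0# →
      (b ≡ ⊖ a × d ≡ ⊖ c) ⊎ (c ≡ ⊖ a × d ≡ ⊖ b) ⊎ (d ≡ ⊖ a × c ≡ ⊖ b)
    vanishing-sum {a} {b} {c} {d} ua ub uc ud h = cases (regular ua ub _ product≡0)
      where
      open ≡-Reasoning
      conj-sum : conj a ⊕ conj b ⊕ (conj c ⊕ conj d) ≡ 0#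
      conj-sum = begin
        conj a ⊕ conj b ⊕ (conj c ⊕ conj d) ≡⟨ cong₂ _⊕_ (conj-⊕ a b) (conj-⊕ c d) ⟨
        conj (a ⊕ b) ⊕ conj (c ⊕ d)  ≡⟨ conj-⊕ _ _ ⟨
        conj (a ⊕ b ⊕ (c ⊕ d))  ≡⟨ cong conj h ⟩
        conj 0#  ≡⟨ conj-0 ⟩
        0#  ∎
      e₂ = a ⊗ b ⊕ a ⊗ c ⊕ b ⊗ c
      product≡0 : (a ⊕ b) ⊗ ((a ⊕ c) ⊗ (b ⊕ c)) ≡ 0#
      product≡0 = begin
        (a ⊕ b) ⊗ ((a ⊕ c) ⊗ (b ⊕ c))
          -- The coefficients `con 1ℤ` are placeholders, next rewritten as `a ⊗ conj a` and so on;
          -- the third symmetric function of the four rotations thereby becomes their product times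
          -- the conjugate of their sum.
          ≡⟨ solve 4 (λ a b c d → (a :+ b) :* ((a :+ c) :* (b :+ c)) :=
               (a :+ b :+ (c :+ d)) :* (a :* b :+ a :* c :+ b :* c)
               :+ :- (con 1ℤ :* (b :* c :* d) :+ con 1ℤ :* (a :* c :* d) :+ con 1ℤ :* (a :* b :* d) :+ con 1ℤ :* (a :* b :* c))) refl a b c d ⟩
        (a ⊕ b ⊕ (c ⊕ d)) ⊗ e₂ ⊕ ⊖ (1# ⊗ (b ⊗ c ⊗ d) ⊕ 1# ⊗ (a ⊗ c ⊗ d) ⊕ 1# ⊗ (a ⊗ b ⊗ d) ⊕ 1# ⊗ (a ⊗ b ⊗ c))
          ≡⟨ cong₂ _⊕_ (trans (cong (_⊗ e₂) h) (KR.zeroˡ e₂)) (cong ⊖_ (cong₂ _⊕_ (cong₂ _⊕_ (cong₂ _⊕_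
               (cong (_⊗ (b ⊗ c ⊗ d)) (sym ua)) (cong (_⊗ (a ⊗ c ⊗ d)) (sym ub)))
               (cong (_⊗ (a ⊗ b ⊗ d)) (sym uc))) (cong (_⊗ (a ⊗ b ⊗ c)) (sym ud)))) ⟩
        0# ⊕ ⊖ (a ⊗ conj a ⊗ (b ⊗ c ⊗ d) ⊕ b ⊗ conj b ⊗ (a ⊗ c ⊗ d) ⊕ c ⊗ conj c ⊗ (a ⊗ b ⊗ d) ⊕ d ⊗ conj d ⊗ (a ⊗ b ⊗ c))
          ≡⟨ solve 8 (λ a b c d x y z w → con 0ℤ :+ :- (a :* x :* (b :* c :* d) :+ b :* y :* (a :* c :* d) :+ c :* z :* (a :* b :* d)
               :+ d :* w :* (a :* b :* c)) := :- (a :* b :* c :* d) :* (x :+ y :+ (z :+ w))) refl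
               a b c d (conj a) (conj b) (conj c) (conj d) ⟩
        ⊖ (a ⊗ b ⊗ c ⊗ d) ⊗ (conj a ⊕ conj b ⊕ (conj c ⊕ conj d))
          ≡⟨ cong (⊖ (a ⊗ b ⊗ c ⊗ d) ⊗_) conj-sum ⟩
        ⊖ (a ⊗ b ⊗ c ⊗ d) ⊗ 0#
          ≡⟨ KR.zeroʳ _ ⟩
        0# ∎
      opposite : ∀ p q r s → a ⊕ b ⊕ (c ⊕ d) ≡ p ⊕ q ⊕ (r ⊕ s) → p ⊕ q ≡ 0# → q ≡ ⊖ p × s ≡ ⊖ r
      opposite p q r s eq pq = neg-unique p q pq ,
        neg-unique r s (trans (sym (KR.+-identityˡ _)) (trans (cong (_⊕ (r ⊕ s)) (sym pq)) (trans (sym eq) h)))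
      cases : a ⊕ b ≡ 0# ⊎ (a ⊕ c) ⊗ (b ⊕ c) ≡ 0# → _
      cases (inj₁ ab) = inj₁ (opposite a b c d refl ab)
      cases (inj₂ rest) with regular ua uc (b ⊕ c) rest
      ... | inj₁ ac = inj₂ (inj₁ (opposite a c b d (solve 4 (λ a b c d → a :+ b :+ (c :+ d) := a :+ c :+ (b :+ d)) refl a b c d) ac))
      ... | inj₂ bc with opposite b c a d (solve 4 (λ a b c d → a :+ b :+ (c :+ d) := b :+ c :+ (a :+ d)) refl a b c d) bc
      ...   | c≡ , d≡ = inj₂ (inj₂ (d≡ , c≡))

  -- `dominated` expresses that `Es` has no repetitions, in a form that passes to isotropic
  -- coordinates by a bijection of sums.
  module Energy (G : Geometry) (Es : List (Geometry.Carrier G))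
    (dominated : (f : Geometry.Carrier G → ℤ) → (∀ x → 0ℤ ≤ f x) → Σ Es f ≤ Σ (Geometry.all G) f)
    (nonempty : 0ℤ < + length Es) where

    open Geometry G
    open GroupRing K
    private
      module A = CommutativeRing groupRing
      module AS = IntegerCoefficients groupRing
      open AS using () renaming (solve to solveA; con to conA; _:=_ to _≔_; _:+_ to _⊞′_; _:*_ to _∗′_; _:-_ to _⊟′_)

    n : ℤ
    n = + length Es

    e : Carrier → Elem
    e θ = ΣR Es (λ y → δ (θ ⊗ y))

    k : Carrier → Carrier → Elem
    k θ x = e θ ∗ δ (⊖ (θ ⊗ x))

    -- Up to sign conventions, the transform of `h x` at a frequency is the sum, over the circle
    -- through that frequency, of the transform of `Es` times the character at `x`: the extension
    -- operator of the circle, evaluated at `x`. Summing over `x` in `Es` completes each product to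
    -- a squared modulus, which is why `s` reappears as the mass on circles.
    h : Carrier → Elem
    h x = ΣR units (λ θ → k θ x)

    s : Elem
    s = ΣR Es h

    L : Elem → ℤ
    L a = (π ∗ a) 0#

    L-cong : ∀ {a b} → a ≈ b → L a ≡ L b
    L-cong a≈b = ∗-cong {π} (λ _ → refl) a≈b 0#

    L-⊞ : ∀ a b → L (a ⊞ b) ≡ L a + L b
    L-⊞ a b = ∗-distribˡ π a b 0#

    L-κ : ∀ c a → L (κ c ∗ a) ≡ c * L a
    L-κ c a = trans (solveA 3 (λ p x y → p ∗′ (x ∗′ y) ≔ x ∗′ (p ∗′ y)) (λ {_} _ → refl) π (κ c) a 0#) (κ∗ c (π ∗ a) 0#)

    L-Σ : {I : Set} (xs : List I) (f : I → Elem) → L (ΣR xs f) ≡ Σ xs (λ i → L (f i))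
    L-Σ xs f = ΣR-∗ˡ xs π f 0#

    ΣR-∗ : {I J : Set} (xs : List I) (ys : List J) (f : I → Elem) (g : J → Elem) →
           ΣR xs f ∗ ΣR ys g ≈ ΣR xs (λ i → ΣR ys (λ j → f i ∗ g j))
    ΣR-∗ xs ys f g u = trans (ΣR-∗ʳ xs f (ΣR ys g) u) (Σ-cong xs (λ i → ΣR-∗ˡ ys (f i) g u))

    π-even : ∀ u → π (⊖ u) ≡ π u
    π-even u = trans (cong π (solve 1 (λ u → :- u := :- con 1ℤ :* u) refl u)) (π-invariant (Unit-⊖ Unit-1) u)

    L≥0 : ∀ a → 0ℤ ≤ L (a ∗ star a)
    L≥0 a = *-cancel-≤ M 0<M (subst (_≤ M * L (a ∗ star a)) (sym (*-zeroʳ M)) (subst (0ℤ ≤_) (sym scaled) (Σ≥0 all (λ v → 0≤² ((π ∗ a) v)))))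
      where
      open ≡-Reasoning
      b = a ∗ star a
      κM∗π : κ M ∗ π ≈ π ∗ π
      κM∗π u = trans (κ∗ M π u) (sym (π-idempotent u))
      scaled : M * L b ≡ Σ all (λ v → (π ∗ a) v * (π ∗ a) v)
      scaled = begin
        M * (π ∗ b) 0#  ≡⟨ κ∗ M (π ∗ b) 0# ⟨
        (κ M ∗ (π ∗ b)) 0#  ≡⟨ A.*-assoc (κ M) π b 0# ⟨
        (κ M ∗ π ∗ b) 0#  ≡⟨ A.*-congʳ {b} κM∗π 0# ⟩
        (π ∗ π ∗ (a ∗ star a)) 0#  ≡⟨ solveA 3 (λ p x y → p ∗′ p ∗′ (x ∗′ y) ≔ (p ∗′ x) ∗′ (p ∗′ y)) (λ _ → refl) π a (star a) 0# ⟩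
        ((π ∗ a) ∗ (π ∗ star a)) 0#  ≡⟨ A.*-congˡ {π ∗ a} {π ∗ star a} {star (π ∗ a)} (λ u → sym (trans (star-∗ π a u)
                                              (A.*-congʳ {star a} {star π} {π} π-even u))) 0# ⟩
        ((π ∗ a) ∗ star (π ∗ a)) 0#  ≡⟨ norm² (π ∗ a) ⟩
        Σ all (λ v → (π ∗ a) v * (π ∗ a) v) ∎

    L≥0-self : ∀ c → star c ≈ c → 0ℤ ≤ L (c ∗ c)
    L≥0-self c self = subst (0ℤ ≤_) (L-cong (A.*-congˡ {c} {star c} {c} self)) (L≥0 c)

    star-e : ∀ θ → star (e θ) ≈ ΣR Es (λ y → δ (⊖ (θ ⊗ y)))
    star-e θ u = Σ-cong Es (λ y → star-δ (θ ⊗ y) u)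

    e-⊖ : ∀ θ → e (⊖ θ) ≈ star (e θ)
    e-⊖ θ u = trans (Σ-cong Es (λ y → cong (λ p → δ p u) (solve 2 (λ θ y → :- θ :* y := :- (θ :* y)) refl θ y))) (sym (star-e θ u))

    energy : Carrier → Elem
    energy θ = e θ ∗ star (e θ)

    s≈ : s ≈ ΣR units energy
    s≈ u = begin
      Σ Es (λ x → Σ units (λ θ → (e θ ∗ δ (⊖ (θ ⊗ x))) u)) ≡⟨ Σ-swap Es units _ ⟩
      Σ units (λ θ → Σ Es (λ x → (e θ ∗ δ (⊖ (θ ⊗ x))) u)) ≡⟨ Σ-cong units (λ θ → ΣR-∗ˡ Es (e θ) (λ x → δ (⊖ (θ ⊗ x))) u) ⟨
      Σ units (λ θ → (e θ ∗ ΣR Es (λ x → δ (⊖ (θ ⊗ x)))) u) ≡⟨ Σ-cong units (λ θ → A.*-congˡ {e θ} {star (e θ)} (star-e θ) u) ⟨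
      Σ units (λ θ → energy θ u) ∎
      where open ≡-Reasoning

    star-energy : ∀ θ → star (energy θ) ≈ energy θ
    star-energy θ u = begin
      star (e θ ∗ star (e θ)) u  ≡⟨ star-∗ (e θ) (star (e θ)) u ⟩
      (star (e θ) ∗ star (star (e θ))) u ≡⟨ A.*-congˡ {star (e θ)} {star (star (e θ))} (star-star (e θ)) u ⟩
      (star (e θ) ∗ e θ) u  ≡⟨ A.*-comm (star (e θ)) (e θ) u ⟩
      energy θ u  ∎
      where open ≡-Reasoning

    star-s : star s ≈ s
    star-s u = trans (s≈ (⊖ u)) (trans (Σ-cong units (λ θ → star-energy θ u)) (sym (s≈ u)))

    -- Minus one is a rotation, and `star` exchanges the summands of `θ` and `⊖ θ`. The transform of
    -- `h x` is thus real, so that its fourth power and the convexity argument make sense.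
    star-h : ∀ x → star (h x) ≈ h x
    star-h x u = begin
      Σ units (λ θ → star (k θ x) u) ≡⟨ Σ-cong units (λ θ → step θ) ⟩
      Σ units (λ θ → k (⊖ θ) x u)  ≡⟨ Σ-units-⊖ (λ θ → k θ x u) ⟩
      Σ units (λ θ → k θ x u)  ∎
      where
      open ≡-Reasoning
      step : ∀ θ → star (k θ x) u ≡ k (⊖ θ) x u
      step θ = begin
        star (k θ x) u  ≡⟨ star-∗ (e θ) (δ (⊖ (θ ⊗ x))) u ⟩
        (star (e θ) ∗ star (δ (⊖ (θ ⊗ x)))) u  ≡⟨ A.*-cong {star (e θ)} {e (⊖ θ)} (λ v → sym (e-⊖ θ v)) (λ v → trans (star-δ _ v)
                                                        (cong (λ p → δ p v) (solve 2 (λ θ x → :- (:- (θ :* x)) := :- (:- θ :* x)) refl θ x))) u ⟩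
        k (⊖ θ) x u  ∎

    -- Moments of `s` and the Cauchy-Schwarz inequalities between them

    L₁ L₂ L₃ L₄ : ℤ
    L₁ = L s
    L₂ = L (s ∗ s)
    L₃ = L (s ∗ (s ∗ s))
    L₄ = L ((s ∗ s) ∗ (s ∗ s))

    star-combination : ∀ x y a b → star a ≈ a → star b ≈ b → star (κ x ∗ a ⊞ κ y ∗ b) ≈ κ x ∗ a ⊞ κ y ∗ b
    star-combination x y a b sa sb u = cong₂ _+_
      (trans (star-∗ (κ x) a u) (A.*-cong {star (κ x)} {κ x} (star-κ x) sa u))
      (trans (star-∗ (κ y) b u) (A.*-cong {star (κ y)} {κ y} (star-κ y) sb u))

    -- Turns the expanded square of a combination with scalars `x` and `y` into the binary form that
    -- `discriminant` expects.
    L-form : ∀ x y a b c → L ((κ x ∗ (κ x ∗ a) ⊞ (κ x ∗ (κ y ∗ b) ⊞ κ x ∗ (κ y ∗ b))) ⊞ κ y ∗ (κ y ∗ c))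
             ≡ x * x * L a + + 2 * (x * y * L b) + y * y * L c
    L-form x y a b c = begin
      _ ≡⟨ trans (L-⊞ (X ⊞ (Y ⊞ Y)) Z) (cong₂ _+_ (trans (L-⊞ X (Y ⊞ Y)) (cong₂ _+_ (term x x a)
            (trans (L-⊞ Y Y) (cong₂ _+_ (term x y b) (term x y b))))) (term y y c)) ⟩
      x * (x * L a) + (x * (y * L b) + x * (y * L b)) + y * (y * L c)
        ≡⟨ collect x y (L a) (L b) (L c) ⟩
      _ ∎
      where
      open ≡-Reasoning
      X = κ x ∗ (κ x ∗ a)
      Y = κ x ∗ (κ y ∗ b)
      Z = κ y ∗ (κ y ∗ c)
      term : ∀ x y a → L (κ x ∗ (κ y ∗ a)) ≡ x * (y * L a)
      term x y a = trans (L-κ x (κ y ∗ a)) (cong (x *_) (L-κ y a))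
      collect : ∀ x y a b c → x * (x * a) + (x * (y * b) + x * (y * b)) + y * (y * c) ≡ x * x * a + + 2 * (x * y * b) + y * y * c
      collect = solve-∀

    -- Each summand `e θ ∗ star (e θ)` of `s` is absorbed into the square as
    -- `(e θ ∗ c) ∗ star (e θ ∗ c)`. So `s` may serve as a nonnegative weight, which the odd moments
    -- require.
    L-s∗≥0 : ∀ c → star c ≈ c → 0ℤ ≤ L (s ∗ (c ∗ c))
    L-s∗≥0 c self = subst (0ℤ ≤_) (sym expand) (Σ≥0 units (λ θ → L≥0 (e θ ∗ c)))
      where
      open ≡-Reasoning
      expand : L (s ∗ (c ∗ c)) ≡ Σ units (λ θ → L ((e θ ∗ c) ∗ star (e θ ∗ c)))
      expand = begin
        L (s ∗ (c ∗ c))  ≡⟨ L-cong (λ u → trans (A.*-congʳ {c ∗ c} s≈ u) (ΣR-∗ʳ units energy (c ∗ c) u)) ⟩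
        L (ΣR units (λ θ → energy θ ∗ (c ∗ c))) ≡⟨ L-Σ units (λ θ → energy θ ∗ (c ∗ c)) ⟩
        Σ units (λ θ → L (energy θ ∗ (c ∗ c)))  ≡⟨ Σ-cong units (λ θ → L-cong (λ u → begin
            (energy θ ∗ (c ∗ c)) u  ≡⟨ solveA 3 (λ x y z → (x ∗′ y) ∗′ (z ∗′ z) ≔ (x ∗′ z) ∗′ (y ∗′ z)) (λ _ → refl) (e θ) (star (e θ)) c u ⟩
            ((e θ ∗ c) ∗ (star (e θ) ∗ c)) u  ≡⟨ A.*-congˡ {e θ ∗ c} (λ v → trans (star-∗ (e θ) c v) (A.*-congˡ {star (e θ)} {star c} self v)) u ⟨
            ((e θ ∗ c) ∗ star (e θ ∗ c)) u  ∎)) ⟩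
        Σ units (λ θ → L ((e θ ∗ c) ∗ star (e θ ∗ c))) ∎

    -- Cauchy-Schwarz with weight `s`, tested on `κ x ∗ s ⊞ κ y ∗ one`. The companion for `L₃` has
    -- weight one and is tested on `κ x ∗ (s ∗ s) ⊞ κ y ∗ s`.
    L₂²≤L₁L₃ : L₂ * L₂ ≤ L₃ * L₁
    L₂²≤L₁L₃ = discriminant L₃ L₂ L₁ λ x y → subst (0ℤ ≤_)
      (trans (L-cong (solveA 3 (λ s x y → s ∗′ ((x ∗′ s ⊞′ y ∗′ conA 1ℤ) ∗′ (x ∗′ s ⊞′ y ∗′ conA 1ℤ)) ≔
          (x ∗′ (x ∗′ (s ∗′ (s ∗′ s))) ⊞′ (x ∗′ (y ∗′ (s ∗′ s)) ⊞′ x ∗′ (y ∗′ (s ∗′ s)))) ⊞′ y ∗′ (y ∗′ s)) (λ _ → refl) s (κ x) (κ y)))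
        (L-form x y (s ∗ (s ∗ s)) (s ∗ s) s))
      (L-s∗≥0 _ (star-combination x y s one star-s star-one))

    L₃²≤L₂L₄ : L₃ * L₃ ≤ L₄ * L₂
    L₃²≤L₂L₄ = discriminant L₄ L₃ L₂ λ x y → subst (0ℤ ≤_)
      (trans (L-cong (solveA 3 (λ s x y → (x ∗′ (s ∗′ s) ⊞′ y ∗′ s) ∗′ (x ∗′ (s ∗′ s) ⊞′ y ∗′ s) ≔
          (x ∗′ (x ∗′ ((s ∗′ s) ∗′ (s ∗′ s))) ⊞′ (x ∗′ (y ∗′ (s ∗′ (s ∗′ s))) ⊞′ x ∗′ (y ∗′ (s ∗′ (s ∗′ s))))) ⊞′ y ∗′ (y ∗′ (s ∗′ s))) (λ _ → refl) s (κ x) (κ y)))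
        (L-form x y ((s ∗ s) ∗ (s ∗ s)) (s ∗ (s ∗ s)) (s ∗ s)))
      (L≥0-self _ (star-combination x y (s ∗ s) s (λ u → trans (star-∗ s s u) (A.*-cong {star s} {s} star-s star-s u)) star-s))

    fourth : Elem → Elem
    fourth a = (a ∗ a) ∗ (a ∗ a)

    H : ℤ
    H = Σ all (λ x → L (fourth (h x)))

    fourth≥0 : ∀ x → 0ℤ ≤ L (fourth (h x))
    fourth≥0 x = L≥0-self (h x ∗ h x) (λ u → trans (star-∗ (h x) (h x) u) (A.*-cong {star (h x)} {h x} (star-h x) (star-h x) u))

    -- (nh)⁴ - 4(nh)s³ + 3s⁴ = ((nh-s)(nh+s))² + 2((nh-s)s)²: the convexity of t ↦ t⁴, summed over x.
    L₄-convexity : n * L₄ ≤ n * n * n * n * H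
    L₄-convexity = ℤₚ.≤-trans (ℤₚ.0≤i-j⇒j≤i (subst (0ℤ ≤_) summed (Σ≥0 Es pointwise)))
      (ℤₚ.*-monoˡ-≤-nonNeg (n * n * n * n) {{ℤ.nonNegative n⁴≥0}} (dominated _ fourth≥0))
      where
      open ≡-Reasoning
      N = κ n
      n≥0 = ℤₚ.<⇒≤ nonempty
      n⁴≥0 : 0ℤ ≤ n * n * n * n
      n⁴≥0 = 0≤* (0≤* (0≤² n) n≥0) n≥0
      P Q T : Carrier → Elem
      P x = (N ∗ h x ⊞ ⊟ s) ∗ (N ∗ h x ⊞ s)
      Q x = (N ∗ h x ⊞ ⊟ s) ∗ s
      T x = N ∗ (h x ∗ (s ∗ (s ∗ s)))
      star-Nh : ∀ x → star (N ∗ h x) ≈ N ∗ h x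
      star-Nh x u = trans (star-∗ N (h x) u) (A.*-cong {star N} {N} (star-κ n) (star-h x) u)
      star-minus : ∀ x → star (N ∗ h x ⊞ ⊟ s) ≈ N ∗ h x ⊞ ⊟ s
      star-minus x u = cong₂ _-_ (star-Nh x u) (star-s u)
      star-P : ∀ x → star (P x) ≈ P x
      star-P x u = trans (star-∗ (N ∗ h x ⊞ ⊟ s) (N ∗ h x ⊞ s) u) (A.*-cong {star (N ∗ h x ⊞ ⊟ s)} {N ∗ h x ⊞ ⊟ s}
        (star-minus x) (λ v → cong₂ _+_ (star-Nh x v) (star-s v)) u)
      star-Q : ∀ x → star (Q x) ≈ Q x
      star-Q x u = trans (star-∗ (N ∗ h x ⊞ ⊟ s) s u) (A.*-cong {star (N ∗ h x ⊞ ⊟ s)} {N ∗ h x ⊞ ⊟ s} (star-minus x) star-s u)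
      ident : ∀ x → P x ∗ P x ⊞ (Q x ∗ Q x ⊞ Q x ∗ Q x) ≈
        (N ∗ (N ∗ (N ∗ (N ∗ fourth (h x)))) ⊞ (fourth s ⊞ (fourth s ⊞ fourth s))) ⊞ ⊟ ((T x ⊞ T x) ⊞ (T x ⊞ T x))
      ident x = solveA 3 (λ N h s →
        let P = (N ∗′ h ⊟′ s) ∗′ (N ∗′ h ⊞′ s); Q = (N ∗′ h ⊟′ s) ∗′ s; T = N ∗′ (h ∗′ (s ∗′ (s ∗′ s))); F = (s ∗′ s) ∗′ (s ∗′ s) in
        P ∗′ P ⊞′ (Q ∗′ Q ⊞′ Q ∗′ Q) ≔ (N ∗′ (N ∗′ (N ∗′ (N ∗′ ((h ∗′ h) ∗′ (h ∗′ h))))) ⊞′ (F ⊞′ (F ⊞′ F))) ⊟′ ((T ⊞′ T) ⊞′ (T ⊞′ T)))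
        (λ _ → refl) N (h x) s
      L-⊟ : ∀ a → L (⊟ a) ≡ - L a
      L-⊟ a = trans (Σ-cong all (λ v → sym (ℤₚ.neg-distribʳ-* (π v) _))) (Σ-neg all _)
      value : Carrier → ℤ
      value x = n * (n * (n * (n * L (fourth (h x))))) + (L₄ + (L₄ + L₄)) - ((n * L (h x ∗ (s ∗ (s ∗ s))) + n * L (h x ∗ (s ∗ (s ∗ s)))) + (n * L (h x ∗ (s ∗ (s ∗ s))) + n * L (h x ∗ (s ∗ (s ∗ s)))))
      pointwise : ∀ x → 0ℤ ≤ value x
      pointwise x = subst (0ℤ ≤_) eq (0≤+ (L≥0-self (P x) (star-P x)) (0≤+ (L≥0-self (Q x) (star-Q x)) (L≥0-self (Q x) (star-Q x))))
        where
        F₁ = N ∗ (N ∗ (N ∗ (N ∗ fourth (h x))))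
        F₂ = fourth s ⊞ (fourth s ⊞ fourth s)
        F₃ = (T x ⊞ T x) ⊞ (T x ⊞ T x)
        κ⁴ : L F₁ ≡ n * (n * (n * (n * L (fourth (h x)))))
        κ⁴ = trans (L-κ n (N ∗ (N ∗ (N ∗ fourth (h x))))) (cong (n *_) (trans (L-κ n (N ∗ (N ∗ fourth (h x)))) (cong (n *_)
               (trans (L-κ n (N ∗ fourth (h x))) (cong (n *_) (L-κ n (fourth (h x))))))))
        LT = L-κ n (h x ∗ (s ∗ (s ∗ s)))
        eq : L (P x ∗ P x) + (L (Q x ∗ Q x) + L (Q x ∗ Q x)) ≡ value x
        eq = begin
          L (P x ∗ P x) + (L (Q x ∗ Q x) + L (Q x ∗ Q x))  ≡⟨ cong (_+_ (L (P x ∗ P x))) (L-⊞ (Q x ∗ Q x) (Q x ∗ Q x)) ⟨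
          L (P x ∗ P x) + L (Q x ∗ Q x ⊞ Q x ∗ Q x)  ≡⟨ L-⊞ (P x ∗ P x) (Q x ∗ Q x ⊞ Q x ∗ Q x) ⟨
          L (P x ∗ P x ⊞ (Q x ∗ Q x ⊞ Q x ∗ Q x))  ≡⟨ L-cong (ident x) ⟩
          L ((F₁ ⊞ F₂) ⊞ ⊟ F₃)  ≡⟨ trans (L-⊞ (F₁ ⊞ F₂) (⊟ F₃)) (cong₂ _+_ (L-⊞ F₁ F₂) (L-⊟ F₃)) ⟩
          (L F₁ + L F₂) - L F₃  ≡⟨ cong₂ _-_ (cong₂ _+_ κ⁴ (trans (L-⊞ (fourth s) (fourth s ⊞ fourth s)) (cong (_+_ L₄) (L-⊞ (fourth s) (fourth s)))))
                                                                (trans (L-⊞ (T x ⊞ T x) (T x ⊞ T x)) (cong₂ _+_ (trans (L-⊞ (T x) (T x)) (cong₂ _+_ LT LT)) (trans (L-⊞ (T x) (T x)) (cong₂ _+_ LT LT)))) ⟩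
          value x ∎
      -- Since `s` is the sum of the `h x`, the cross terms contribute `- 4 n L₄` against the
      -- `+ 3 n L₄` of the constant terms.
      ΣL-hs³ : Σ Es (λ x → L (h x ∗ (s ∗ (s ∗ s)))) ≡ L₄
      ΣL-hs³ = begin
        Σ Es (λ x → L (h x ∗ (s ∗ (s ∗ s))))   ≡⟨ L-Σ Es (λ x → h x ∗ (s ∗ (s ∗ s))) ⟨
        L (ΣR Es (λ x → h x ∗ (s ∗ (s ∗ s))))  ≡⟨ L-cong (λ u → ΣR-∗ʳ Es h (s ∗ (s ∗ s)) u) ⟨
        L (s ∗ (s ∗ (s ∗ s)))  ≡⟨ L-cong (λ u → sym (A.*-assoc s s (s ∗ s) u)) ⟩
        L₄  ∎
      summed : Σ Es value ≡ n * n * n * n * Σ Es (λ x → L (fourth (h x))) - n * L₄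
      summed = begin
        Σ Es value ≡⟨ Σ-cong Es (λ x → regroup n (L (fourth (h x))) L₄ (L (h x ∗ (s ∗ (s ∗ s))))) ⟩
        Σ Es (λ x → n * n * n * n * L (fourth (h x)) + (+ 3 * L₄ + (- (+ 4 * n)) * L (h x ∗ (s ∗ (s ∗ s)))))
          ≡⟨ trans (Σ-+ Es _ _) (cong₂ _+_ (Σ-*ˡ Es (n * n * n * n) _) (trans (Σ-+ Es _ _) (cong₂ _+_ (Σ-const Es (+ 3 * L₄)) (trans (Σ-*ˡ Es (- (+ 4 * n)) _) (cong (- (+ 4 * n) *_) ΣL-hs³))))) ⟩
        n * n * n * n * Σ Es (λ x → L (fourth (h x))) + (n * (+ 3 * L₄) + (- (+ 4 * n)) * L₄)
          ≡⟨ collect n (Σ Es (λ x → L (fourth (h x)))) L₄ ⟩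
        n * n * n * n * Σ Es (λ x → L (fourth (h x))) - n * L₄ ∎
        where
        regroup : ∀ n f l t → n * (n * (n * (n * f))) + (l + (l + l)) - ((n * t + n * t) + (n * t + n * t)) ≡ n * n * n * n * f + (+ 3 * l + (- (+ 4 * n)) * t)
        regroup = solve-∀
        collect : ∀ n f l → n * n * n * n * f + (n * (+ 3 * l) + (- (+ 4 * n)) * l) ≡ n * n * n * n * f - n * l
        collect = solve-∀

    -- The fourth moment of `h`: quadruples of rotations

    W : Carrier → Carrier → ℤ
    W θ φ = L (energy θ ∗ energy φ)

    W≥0 : ∀ θ φ → 0ℤ ≤ W θ φ
    W≥0 θ φ = subst (0ℤ ≤_) (L-cong (λ u → trans (A.*-congˡ {e θ ∗ e φ} (star-∗ (e θ) (e φ)) u)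
      (solveA 4 (λ a b c d → (a ∗′ b) ∗′ (c ∗′ d) ≔ (a ∗′ c) ∗′ (b ∗′ d)) (λ _ → refl) (e θ) (e φ) (star (e θ)) (star (e φ)) u)))
      (L≥0 (e θ ∗ e φ))

    L₂≡ΣW : L₂ ≡ Σ units (λ θ → Σ units (W θ))
    L₂≡ΣW = begin
      L (s ∗ s)  ≡⟨ L-cong (A.*-cong {s} {ΣR units energy} s≈ s≈) ⟩
      L (ΣR units energy ∗ ΣR units energy)  ≡⟨ L-cong (ΣR-∗ units units energy energy) ⟩
      L (ΣR units (λ θ → ΣR units (λ φ → energy θ ∗ energy φ))) ≡⟨ L-Σ units (λ θ → ΣR units (λ φ → energy θ ∗ energy φ)) ⟩
      Σ units (λ θ → L (ΣR units (λ φ → energy θ ∗ energy φ))) ≡⟨ Σ-cong units (λ θ → L-Σ units (λ φ → energy θ ∗ energy φ)) ⟩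
      Σ units (λ θ → Σ units (W θ))  ∎
      where open ≡-Reasoning

    quad : Carrier → Carrier → Carrier → Carrier → Carrier → Elem
    quad a b c d x = (k a x ∗ k b x) ∗ (k c x ∗ k d x)

    eeee : Carrier → Carrier → Carrier → Carrier → Elem
    eeee a b c d = (e a ∗ e b) ∗ (e c ∗ e d)

    quad≈ : ∀ a b c d x → quad a b c d x ≈ eeee a b c d ∗ δ (⊖ ((a ⊕ b ⊕ (c ⊕ d)) ⊗ x))
    quad≈ a b c d x u = trans
      (solveA 8 (λ a b c d x y z w → ((a ∗′ x) ∗′ (b ∗′ y)) ∗′ ((c ∗′ z) ∗′ (d ∗′ w)) ≔ ((a ∗′ b) ∗′ (c ∗′ d)) ∗′ ((x ∗′ y) ∗′ (z ∗′ w))) (λ _ → refl)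
        (e a) (e b) (e c) (e d) (p a) (p b) (p c) (p d) u)
      (A.*-congˡ {eeee a b c d} (λ v → trans (A.*-cong {p a ∗ p b} (δ-+ (q a) (q b)) (δ-+ (q c) (q d)) v)
        (trans (δ-+ (q a ⊕ q b) (q c ⊕ q d) v) (cong (λ t → δ t v)
          (solve 5 (λ a b c d x → :- (a :* x) :+ :- (b :* x) :+ (:- (c :* x) :+ :- (d :* x)) := :- ((a :+ b :+ (c :+ d)) :* x)) refl a b c d x)))) u)
      where
      q : Carrier → Carrier
      q θ = ⊖ (θ ⊗ x)
      p : Carrier → Elem
      p θ = δ (q θ)

    -- The four translations merge into a single one by `(a ⊕ b ⊕ (c ⊕ d)) ⊗ x`, so `x` is left only
    -- in the argument of `π`.
    Σ-quad : ∀ a b c d → Σ all (λ x → L (quad a b c d x)) ≡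
      Σ all (λ v → eeee a b c d v * Σ all (λ x → π (0# ⊕ ⊖ v ⊕ (a ⊕ b ⊕ (c ⊕ d)) ⊗ x)))
    Σ-quad a b c d = begin
      Σ all (λ x → L (quad a b c d x))   ≡⟨ Σ-cong all (λ x → trans (L-cong (quad≈ a b c d x)) (shift x)) ⟩
      Σ all (λ x → Σ all (λ v → eeee a b c d v * π (0# ⊕ ⊖ v ⊕ ω ⊗ x))) ≡⟨ Σ-swap all all _ ⟩
      Σ all (λ v → Σ all (λ x → eeee a b c d v * π (0# ⊕ ⊖ v ⊕ ω ⊗ x))) ≡⟨ Σ-cong all (λ v → Σ-*ˡ all (eeee a b c d v) _) ⟩
      _ ∎
      where
      open ≡-Reasoning
      ω = a ⊕ b ⊕ (c ⊕ d)
      shift : ∀ x → L (eeee a b c d ∗ δ (⊖ (ω ⊗ x))) ≡ Σ all (λ v → eeee a b c d v * π (0# ⊕ ⊖ v ⊕ ω ⊗ x))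
      shift x = begin
        (π ∗ (eeee a b c d ∗ δ (⊖ (ω ⊗ x)))) 0#   ≡⟨ solveA 3 (λ p q r → p ∗′ (q ∗′ r) ≔ q ∗′ (r ∗′ p)) (λ _ → refl) π (eeee a b c d) (δ (⊖ (ω ⊗ x))) 0# ⟩
        (eeee a b c d ∗ (δ (⊖ (ω ⊗ x)) ∗ π)) 0#   ≡⟨ Σ-cong all (λ v → cong (eeee a b c d v *_) (trans (δ∗ (⊖ (ω ⊗ x)) π (0# ⊕ ⊖ v))
                                                      (cong (λ t → π (0# ⊕ ⊖ v ⊕ t)) (solve 1 (λ t → :- (:- t) := t) refl (ω ⊗ x))))) ⟩
        _ ∎

    -- One term for each way of splitting four rotations into opposite pairs. A quadruple such as
    -- `a`, `⊖ a`, `a`, `⊖ a` is split in more than one way; as `W` is nonnegative, counting it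
    -- repeatedly still gives an upper bound.
    pairings : Carrier → Carrier → Carrier → Carrier → ℤ
    pairings a b c d = 𝟙 (b ≟ ⊖ a) * 𝟙 (d ≟ ⊖ c) * W a c + 𝟙 (c ≟ ⊖ a) * 𝟙 (d ≟ ⊖ b) * W a b + 𝟙 (d ≟ ⊖ a) * 𝟙 (c ≟ ⊖ b) * W a b

    private
      term≥0 : {P Q : Set} (p : Dec P) (q : Dec Q) {w : ℤ} → 0ℤ ≤ w → 0ℤ ≤ 𝟙 p * 𝟙 q * w
      term≥0 p q w = 0≤* (0≤* (𝟙≥0 p) (𝟙≥0 q)) w

    -- If the rotations do not add up to zero, `π-vanishing` kills the sum over `x`. If they do, the
    -- summand does not depend on `x`, the sum contributes the factor `M`, and `vanishing-sum` names
    -- a pairing whose term is the whole value.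
    Σ-quad-≤ : ∀ a b c d → Unit a → Unit b → Unit c → Unit d → Σ all (λ x → L (quad a b c d x)) ≤ M * pairings a b c d
    Σ-quad-≤ a b c d ua ub uc ud with (a ⊕ b ⊕ (c ⊕ d)) ≟ 0#
    ... | no ω≢0 = subst (_≤ M * pairings a b c d) (sym (begin
        _ ≡⟨ Σ-quad a b c d ⟩
        _ ≡⟨ Σ-cong all (λ v → trans (cong (eeee a b c d v *_) (π-vanishing _ ω≢0 _)) (*-zeroʳ (eeee a b c d v))) ⟩
        _ ≡⟨ Σ-zero all ⟩
        0ℤ ∎)) (0≤* (ℤₚ.<⇒≤ 0<M) (0≤+ (0≤+ (term≥0 (b ≟ ⊖ a) (d ≟ ⊖ c) (W≥0 a c)) (term≥0 (c ≟ ⊖ a) (d ≟ ⊖ b) (W≥0 a b))) (term≥0 (d ≟ ⊖ a) (c ≟ ⊖ b) (W≥0 a b))))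
      where
      open ≡-Reasoning
    ... | yes ω≡0 = subst (_≤ M * pairings a b c d) (sym total) (ℤₚ.*-monoˡ-≤-nonNeg M {{ℤ.nonNegative (ℤₚ.<⇒≤ 0<M)}} (cases (vanishing-sum ua ub uc ud ω≡0)))
      where
      open ≡-Reasoning
      term≡ : {P Q : Set} (p : Dec P) (q : Dec Q) {w : ℤ} → P → Q → 𝟙 p * 𝟙 q * w ≡ w
      term≡ p q {w} x y = trans (cong (_* w) (cong₂ _*_ (𝟙-yes p x) (𝟙-yes q y))) (*-identityˡ w)
      total : Σ all (λ x → L (quad a b c d x)) ≡ M * L (eeee a b c d)
      total = begin
        Σ all (λ x → L (quad a b c d x)) ≡⟨ Σ-quad a b c d ⟩
        Σ all (λ v → eeee a b c d v * Σ all (λ x → π (0# ⊕ ⊖ v ⊕ (a ⊕ b ⊕ (c ⊕ d)) ⊗ x)))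
          ≡⟨ Σ-cong all (λ v → cong (eeee a b c d v *_) (trans (Σ-cong all (λ x → cong π (begin
               0# ⊕ ⊖ v ⊕ (a ⊕ b ⊕ (c ⊕ d)) ⊗ x ≡⟨ cong (λ t → 0# ⊕ ⊖ v ⊕ t ⊗ x) ω≡0 ⟩
               0# ⊕ ⊖ v ⊕ 0# ⊗ x  ≡⟨ solve 2 (λ v x → con 0ℤ :+ :- v :+ con 0ℤ :* x := con 0ℤ :+ :- v) refl v x ⟩
               0# ⊕ ⊖ v  ∎)))
               (trans (Σ-const all (π (0# ⊕ ⊖ v))) (cong (_* π (0# ⊕ ⊖ v)) (trans (sym (Σ-length all)) size))))) ⟩
        Σ all (λ v → eeee a b c d v * (M * π (0# ⊕ ⊖ v)))
          ≡⟨ Σ-cong all (λ v → swap (eeee a b c d v) M (π (0# ⊕ ⊖ v))) ⟩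
        Σ all (λ v → M * (eeee a b c d v * π (0# ⊕ ⊖ v)))
          ≡⟨ Σ-*ˡ all M _ ⟩
        M * (eeee a b c d ∗ π) 0#
          ≡⟨ cong (M *_) (∗-comm (eeee a b c d) π 0#) ⟩
        M * L (eeee a b c d) ∎
        where
        swap : ∀ x m y → x * (m * y) ≡ m * (x * y)
        swap = solve-∀
      matching : ∀ p q → eeee p (⊖ p) q (⊖ q) ≈ energy p ∗ energy q
      matching p q = A.*-cong {e p ∗ e (⊖ p)} {energy p} (A.*-congˡ {e p} {e (⊖ p)} (e-⊖ p)) (A.*-congˡ {e q} {e (⊖ q)} (e-⊖ q))
      cases : _ → L (eeee a b c d) ≤ pairings a b c d
      cases (inj₁ (refl , refl)) = i≤j+ _ (0≤+ (term≥0 (c ≟ ⊖ a) (d ≟ ⊖ b) (W≥0 a b)) (term≥0 (d ≟ ⊖ a) (c ≟ ⊖ b) (W≥0 a b)))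
        (trans (ℤₚ.+-assoc (𝟙 (b ≟ ⊖ a) * 𝟙 (d ≟ ⊖ c) * W a c) _ _) (cong (λ t → t + (𝟙 (c ≟ ⊖ a) * 𝟙 (d ≟ ⊖ b) * W a b + 𝟙 (d ≟ ⊖ a) * 𝟙 (c ≟ ⊖ b) * W a b))
          (trans (term≡ (b ≟ ⊖ a) (d ≟ ⊖ c) refl refl) (L-cong (λ u → sym (matching a c u))))))
      cases (inj₂ (inj₁ (refl , refl))) = i≤j+ _ (0≤+ (term≥0 (b ≟ ⊖ a) (d ≟ ⊖ c) (W≥0 a c)) (term≥0 (d ≟ ⊖ a) (c ≟ ⊖ b) (W≥0 a b)))
        (trans (rotate (𝟙 (b ≟ ⊖ a) * 𝟙 (d ≟ ⊖ c) * W a c) (𝟙 (c ≟ ⊖ a) * 𝟙 (d ≟ ⊖ b) * W a b) (𝟙 (d ≟ ⊖ a) * 𝟙 (c ≟ ⊖ b) * W a b))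
          (cong (λ t → t + (𝟙 (b ≟ ⊖ a) * 𝟙 (d ≟ ⊖ c) * W a c + 𝟙 (d ≟ ⊖ a) * 𝟙 (c ≟ ⊖ b) * W a b))
          (trans (term≡ (c ≟ ⊖ a) (d ≟ ⊖ b) refl refl) (L-cong (λ u → trans (sym (matching a b u))
            (solveA 4 (λ a b c d → (a ∗′ c) ∗′ (b ∗′ d) ≔ (a ∗′ b) ∗′ (c ∗′ d)) (λ _ → refl) (e a) (e b) (e c) (e d) u))))))
        where
        rotate : ∀ x y z → x + y + z ≡ y + (x + z)
        rotate = solve-∀
      cases (inj₂ (inj₂ (refl , refl))) = i≤j+ _ (0≤+ (term≥0 (b ≟ ⊖ a) (d ≟ ⊖ c) (W≥0 a c)) (term≥0 (c ≟ ⊖ a) (d ≟ ⊖ b) (W≥0 a b)))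
        (trans (+-comm _ (𝟙 (d ≟ ⊖ a) * 𝟙 (c ≟ ⊖ b) * W a b))
          (cong (λ t → t + (𝟙 (b ≟ ⊖ a) * 𝟙 (d ≟ ⊖ c) * W a c + 𝟙 (c ≟ ⊖ a) * 𝟙 (d ≟ ⊖ b) * W a b))
          (trans (term≡ (d ≟ ⊖ a) (c ≟ ⊖ b) refl refl) (L-cong (λ u → trans (sym (matching a b u))
            (solveA 4 (λ a b c d → (a ∗′ d) ∗′ (b ∗′ c) ≔ (a ∗′ b) ∗′ (c ∗′ d)) (λ _ → refl) (e a) (e b) (e c) (e d) u))))))

    private
      -- The order `a`, `c`, `b`, `d` is the one in which the product of `h x ∗ h x` with itself
      -- expands.
      Σ₄ : (Carrier → Carrier → Carrier → Carrier → ℤ) → ℤ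
      Σ₄ f = Σ units (λ a → Σ units (λ c → Σ units (λ b → Σ units (λ d → f a b c d))))

      Σ₄-mono : ∀ {f g} → (∀ a b c d → Unit a → Unit b → Unit c → Unit d → f a b c d ≤ g a b c d) → Σ₄ f ≤ Σ₄ g
      Σ₄-mono h = Σ-mono-∈ units (λ a a∈ → Σ-mono-∈ units (λ c c∈ → Σ-mono-∈ units (λ b b∈ → Σ-mono-∈ units (λ d d∈ →
        h a b c d (∈-units a∈) (∈-units b∈) (∈-units c∈) (∈-units d∈)))))

      Σ₄-+ : ∀ f g → Σ₄ (λ a b c d → f a b c d + g a b c d) ≡ Σ₄ f + Σ₄ g
      Σ₄-+ f g = trans (Σ-cong units (λ a → trans (Σ-cong units (λ c → trans (Σ-cong units (λ b →
        Σ-+ units _ _)) (Σ-+ units _ _))) (Σ-+ units _ _))) (Σ-+ units _ _)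

      Σ₄-*ˡ : ∀ m f → Σ₄ (λ a b c d → m * f a b c d) ≡ m * Σ₄ f
      Σ₄-*ˡ m f = trans (Σ-cong units (λ a → trans (Σ-cong units (λ c → trans (Σ-cong units (λ b →
        Σ-*ˡ units m _)) (Σ-*ˡ units m _))) (Σ-*ˡ units m _))) (Σ-*ˡ units m _)

      Σ-Σ₄ : {I : Set} (xs : List I) (f : I → Carrier → Carrier → Carrier → Carrier → ℤ) →
             Σ xs (λ x → Σ₄ (f x)) ≡ Σ₄ (λ a b c d → Σ xs (λ x → f x a b c d))
      Σ-Σ₄ xs f = trans (Σ-swap xs units _) (Σ-cong units (λ a → trans (Σ-swap xs units _) (Σ-cong units (λ c →
        trans (Σ-swap xs units _) (Σ-cong units (λ b → Σ-swap xs units _))))))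

      Σ-once : ∀ {p} → Unit p → (w : ℤ) → Σ units (λ x → 𝟙 (x ≟ ⊖ p) * w) ≡ w
      Σ-once {p} up w = Σ-pick _≟_ units (⊖ p) (once-units (Unit-⊖ up)) (λ _ → w)

      factor : ∀ x y w → x * y * w ≡ x * (y * w)
      factor x y w = ℤₚ.*-assoc x y w

      swapped : ∀ x y w → x * y * w ≡ y * (x * w)
      swapped = solve-∀

    -- Here and in the two variants below, the two indicators determine two of the rotations, and
    -- the free ones run over all pairs as in `L₂≡ΣW`.
    L₂≡Σ₄ac : Σ₄ (λ a b c d → 𝟙 (b ≟ ⊖ a) * 𝟙 (d ≟ ⊖ c) * W a c) ≡ L₂
    L₂≡Σ₄ac = trans (Σ-cong-∈ units (λ a a∈ → Σ-cong-∈ units (λ c c∈ → trans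
      (Σ-cong units (λ b → trans (Σ-cong units (λ d → swapped (𝟙 (b ≟ ⊖ a)) (𝟙 (d ≟ ⊖ c)) (W a c))) (Σ-once (∈-units c∈) (𝟙 (b ≟ ⊖ a) * W a c))))
      (Σ-once (∈-units a∈) (W a c))))) (sym L₂≡ΣW)

    L₂≡Σ₄ab : Σ₄ (λ a b c d → 𝟙 (c ≟ ⊖ a) * 𝟙 (d ≟ ⊖ b) * W a b) ≡ L₂
    L₂≡Σ₄ab = trans (Σ-cong-∈ units (λ a a∈ → trans
      (Σ-cong units (λ c → trans (Σ-cong-∈ units (λ b b∈ → trans
        (Σ-cong units (λ d → swapped (𝟙 (c ≟ ⊖ a)) (𝟙 (d ≟ ⊖ b)) (W a b)))
        (Σ-once (∈-units b∈) (𝟙 (c ≟ ⊖ a) * W a b)))) (Σ-*ˡ units (𝟙 (c ≟ ⊖ a)) (W a))))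
      (Σ-once (∈-units a∈) (Σ units (W a))))) (sym L₂≡ΣW)

    L₂≡Σ₄ab′ : Σ₄ (λ a b c d → 𝟙 (d ≟ ⊖ a) * 𝟙 (c ≟ ⊖ b) * W a b) ≡ L₂
    L₂≡Σ₄ab′ = trans (Σ-cong-∈ units (λ a a∈ → trans
      (Σ-cong units (λ c → Σ-cong units (λ b → trans
        (Σ-cong units (λ d → factor (𝟙 (d ≟ ⊖ a)) (𝟙 (c ≟ ⊖ b)) (W a b)))
        (Σ-once (∈-units a∈) (𝟙 (c ≟ ⊖ b) * W a b)))))
      (trans (Σ-swap units units _) (Σ-cong-∈ units (λ b b∈ → Σ-once (∈-units b∈) (W a b)))))) (sym L₂≡ΣW)

    H≡Σ₄ : H ≡ Σ₄ (λ a b c d → Σ all (λ x → L (quad a b c d x)))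
    H≡Σ₄ = trans (Σ-cong all expand) (Σ-Σ₄ all (λ x a b c d → L (quad a b c d x)))
      where
      open ≡-Reasoning
      expand : ∀ x → L (fourth (h x)) ≡ Σ₄ (λ a b c d → L (quad a b c d x))
      expand x = begin
        L (fourth (h x))
          ≡⟨ L-cong (A.*-cong {h x ∗ h x} {ΣR units F} hh≈ hh≈) ⟩
        L (ΣR units F ∗ ΣR units F)
          ≡⟨ L-cong (ΣR-∗ units units F F) ⟩
        L (ΣR units (λ a → ΣR units (λ c → F a ∗ F c)))
          ≡⟨ trans (L-Σ units (λ a → ΣR units (λ c → F a ∗ F c))) (Σ-cong units (λ a → L-Σ units (λ c → F a ∗ F c))) ⟩
        Σ units (λ a → Σ units (λ c → L (F a ∗ F c)))
          ≡⟨ Σ-cong units (λ a → Σ-cong units (λ c → trans (L-cong (ΣR-∗ units units (λ b → k a x ∗ k b x) (λ d → k c x ∗ k d x)))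
               (trans (L-Σ units (λ b → ΣR units (λ d → quad a b c d x))) (Σ-cong units (λ b → L-Σ units (λ d → quad a b c d x)))))) ⟩
        Σ₄ (λ a b c d → L (quad a b c d x)) ∎
        where
        F : Carrier → Elem
        F a = ΣR units (λ b → k a x ∗ k b x)
        hh≈ : h x ∗ h x ≈ ΣR units F
        hh≈ = ΣR-∗ units units (λ a → k a x) (λ b → k b x)

    H≤3ML₂ : H ≤ + 3 * M * L₂
    H≤3ML₂ = subst (_≤ + 3 * M * L₂) (sym H≡Σ₄) (subst (Σ₄ (λ a b c d → Σ all (λ x → L (quad a b c d x))) ≤_) total (Σ₄-mono Σ-quad-≤))
      where
      open ≡-Reasoning
      triple : ∀ m l → m * (l + l + l) ≡ + 3 * m * l
      triple = solve-∀
      total : Σ₄ (λ a b c d → M * pairings a b c d) ≡ + 3 * M * L₂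
      total = begin
        Σ₄ (λ a b c d → M * pairings a b c d) ≡⟨ Σ₄-*ˡ M pairings ⟩
        M * Σ₄ pairings  ≡⟨ cong (M *_) (trans (Σ₄-+ (λ a b c d → 𝟙 (b ≟ ⊖ a) * 𝟙 (d ≟ ⊖ c) * W a c + 𝟙 (c ≟ ⊖ a) * 𝟙 (d ≟ ⊖ b) * W a b) _)
                                                   (cong₂ _+_ (trans (Σ₄-+ (λ a b c d → 𝟙 (b ≟ ⊖ a) * 𝟙 (d ≟ ⊖ c) * W a c) _) (cong₂ _+_ L₂≡Σ₄ac L₂≡Σ₄ab)) L₂≡Σ₄ab′)) ⟩
        M * (L₂ + L₂ + L₂)  ≡⟨ triple M L₂ ⟩
        + 3 * M * L₂  ∎

    -- The moments expressed through differences of points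

    N : ℤ
    N = + length units

    N>0 : 0ℤ < N
    N>0 = subst (0ℤ <_) (Σ-length units) (ℤₚ.<-≤-trans (ℤ.+<+ (s≤s z≤n))
      (subst (_≤ Σ units (λ _ → 1ℤ)) (once-units Unit-1) (Σ-mono units (λ x → 𝟙≤1 (x ≟ 1#)))))
      where
      𝟙≤1 : {P : Set} (d : Dec P) → 𝟙 d ≤ 1ℤ
      𝟙≤1 (yes _) = ℤₚ.≤-refl
      𝟙≤1 (no _)  = +≤+ z≤n

    -- The first two moments per rotation. On the Fourier side `m₁` is the sum of the squared
    -- transform of `Es` over the non-isotropic frequencies, and in `m₂` each frequency is weighted
    -- with the mass of its circle.
    m₁ m₂ : ℤ
    m₁ = Σ Es (λ x → Σ Es (λ y → π (x ⊕ ⊖ y)))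
    m₂ = Σ units (λ θ → Σ Es (λ x → Σ Es (λ y → Σ Es (λ z → Σ Es (λ w → π (x ⊕ ⊖ y ⊕ θ ⊗ (z ⊕ ⊖ w)))))))

    energy≈ : ∀ θ → energy θ ≈ ΣR Es (λ x → ΣR Es (λ y → δ (θ ⊗ (x ⊕ ⊖ y))))
    energy≈ θ u = trans (A.*-congˡ {e θ} {star (e θ)} (star-e θ) u)
      (trans (ΣR-∗ Es Es (λ x → δ (θ ⊗ x)) (λ y → δ (⊖ (θ ⊗ y))) u)
        (Σ-cong Es (λ x → Σ-cong Es (λ y → trans (δ-+ (θ ⊗ x) (⊖ (θ ⊗ y)) u)
          (cong (λ p → δ p u) (solve 3 (λ θ x y → θ :* x :+ :- (θ :* y) := θ :* (x :+ :- y)) refl θ x y))))))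

    L-δ : ∀ c → L (δ c) ≡ π c
    L-δ c = trans (∗-comm π (δ c) 0#) (trans (δ∗ c π 0#) (trans (cong π (KR.+-identityˡ _)) (π-even c)))

    L₁≡Nm₁ : L₁ ≡ N * m₁
    L₁≡Nm₁ = begin
      L s  ≡⟨ L-cong s≈ ⟩
      L (ΣR units energy)  ≡⟨ L-Σ units energy ⟩
      Σ units (λ θ → L (energy θ))  ≡⟨ Σ-cong-∈ units (λ θ θ∈ → begin
          L (energy θ)  ≡⟨ L-cong (energy≈ θ) ⟩
          L (ΣR Es (λ x → ΣR Es (λ y → δ (θ ⊗ (x ⊕ ⊖ y))))) ≡⟨ L-Σ Es (λ x → ΣR Es (λ y → δ (θ ⊗ (x ⊕ ⊖ y)))) ⟩
          Σ Es (λ x → L (ΣR Es (λ y → δ (θ ⊗ (x ⊕ ⊖ y))))) ≡⟨ Σ-cong Es (λ x → trans (L-Σ Es (λ y → δ (θ ⊗ (x ⊕ ⊖ y))))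
                                                                (Σ-cong Es (λ y → trans (L-δ (θ ⊗ (x ⊕ ⊖ y))) (π-invariant (∈-units θ∈) (x ⊕ ⊖ y))))) ⟩
          m₁  ∎) ⟩
      Σ units (λ _ → m₁)  ≡⟨ Σ-const units m₁ ⟩
      N * m₁  ∎
      where open ≡-Reasoning

    pairSum : Carrier → ℤ
    pairSum θ = Σ Es (λ x → Σ Es (λ y → Σ Es (λ z → Σ Es (λ w → π (x ⊕ ⊖ y ⊕ θ ⊗ (z ⊕ ⊖ w))))))

    -- `π` is invariant, so only the relative rotation `conj θ ⊗ φ` matters; the double sum over
    -- rotations then collapses to `N` copies of `m₂`.
    W≡pairSum : ∀ {θ} φ → Unit θ → W θ φ ≡ pairSum (conj θ ⊗ φ)
    W≡pairSum {θ} φ uθ = begin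
      L (energy θ ∗ energy φ)
        ≡⟨ L-cong (A.*-cong {energy θ} {ΣR Es (λ x → ΣR Es (λ y → δ (θ ⊗ (x ⊕ ⊖ y))))} (energy≈ θ) (energy≈ φ)) ⟩
      L (ΣR Es (f θ) ∗ ΣR Es (f φ))
        ≡⟨ L-cong (ΣR-∗ʳ Es (f θ) (ΣR Es (f φ))) ⟩
      L (ΣR Es (λ x → f θ x ∗ ΣR Es (f φ)))
        ≡⟨ trans (L-Σ Es (λ x → f θ x ∗ ΣR Es (f φ))) (Σ-cong Es (λ x → trans (L-cong (ΣR-∗ʳ Es (λ y → δ (θ ⊗ (x ⊕ ⊖ y))) (ΣR Es (f φ))))
             (trans (L-Σ Es (λ y → δ (θ ⊗ (x ⊕ ⊖ y)) ∗ ΣR Es (f φ))) (Σ-cong Es (λ y → trans (L-cong (ΣR-∗ˡ Es (δ (θ ⊗ (x ⊕ ⊖ y))) (f φ)))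
             (trans (L-Σ Es (λ z → δ (θ ⊗ (x ⊕ ⊖ y)) ∗ f φ z)) (Σ-cong Es (λ z → trans (L-cong (ΣR-∗ˡ Es (δ (θ ⊗ (x ⊕ ⊖ y))) (λ w → δ (φ ⊗ (z ⊕ ⊖ w)))))
             (trans (L-Σ Es (λ w → δ (θ ⊗ (x ⊕ ⊖ y)) ∗ δ (φ ⊗ (z ⊕ ⊖ w)))) (Σ-cong Es (λ w → value x y z w))))))))))) ⟩
      pairSum (conj θ ⊗ φ) ∎
      where
      open ≡-Reasoning
      f : Carrier → Carrier → Elem
      f θ x = ΣR Es (λ y → δ (θ ⊗ (x ⊕ ⊖ y)))
      value : ∀ x y z w → L (δ (θ ⊗ (x ⊕ ⊖ y)) ∗ δ (φ ⊗ (z ⊕ ⊖ w))) ≡ π (x ⊕ ⊖ y ⊕ conj θ ⊗ φ ⊗ (z ⊕ ⊖ w))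
      value x y z w = begin
        L (δ (θ ⊗ (x ⊕ ⊖ y)) ∗ δ (φ ⊗ (z ⊕ ⊖ w)))  ≡⟨ L-cong (δ-+ (θ ⊗ (x ⊕ ⊖ y)) (φ ⊗ (z ⊕ ⊖ w))) ⟩
        L (δ (θ ⊗ (x ⊕ ⊖ y) ⊕ φ ⊗ (z ⊕ ⊖ w)))  ≡⟨ L-δ _ ⟩
        π (θ ⊗ (x ⊕ ⊖ y) ⊕ φ ⊗ (z ⊕ ⊖ w))  ≡⟨ cong (λ t → π (θ ⊗ (x ⊕ ⊖ y) ⊕ t)) (trans (cong (_⊗ (φ ⊗ (z ⊕ ⊖ w))) uθ) (KR.*-identityˡ _)) ⟨
        π (θ ⊗ (x ⊕ ⊖ y) ⊕ θ ⊗ conj θ ⊗ (φ ⊗ (z ⊕ ⊖ w)))   ≡⟨ cong π (solve 5 (λ θ c u φ v → θ :* u :+ θ :* c :* (φ :* v) := θ :* (u :+ c :* φ :* v)) refl θ (conj θ) (x ⊕ ⊖ y) φ (z ⊕ ⊖ w)) ⟩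
        π (θ ⊗ (x ⊕ ⊖ y ⊕ conj θ ⊗ φ ⊗ (z ⊕ ⊖ w)))  ≡⟨ π-invariant uθ _ ⟩
        π (x ⊕ ⊖ y ⊕ conj θ ⊗ φ ⊗ (z ⊕ ⊖ w))  ∎

    L₂≡Nm₂ : L₂ ≡ N * m₂
    L₂≡Nm₂ = begin
      L₂  ≡⟨ L₂≡ΣW ⟩
      Σ units (λ θ → Σ units (W θ))  ≡⟨ Σ-cong-∈ units (λ θ θ∈ → trans (Σ-cong units (λ φ → W≡pairSum φ (∈-units θ∈)))
                                                                    (Σ-units-⊗ (Unit-conj (∈-units θ∈)) pairSum)) ⟩
      Σ units (λ _ → m₂)  ≡⟨ Σ-const units m₂ ⟩
      N * m₂  ∎
      where open ≡-Reasoning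

    m₁≥0 : 0ℤ ≤ m₁
    m₁≥0 = *-cancel-≤ N N>0 (subst₂′ (sym (*-zeroʳ N)) L₁≡Nm₁
      (subst (0ℤ ≤_) (sym (trans (L-cong s≈) (L-Σ units energy))) (Σ≥0 units (λ θ → L≥0 (e θ)))))

    -- The inequality between `L₂` and `L₁` is quadratic in both, so the number of rotations cancels
    -- and `m₁`, `m₂` obey it as well.
    energy-bound : m₂ * m₂ ≤ + 3 * M * (n * n * n) * (m₁ * m₁)
    energy-bound = *-cancel-≤ (N * N) (0<* N>0 N>0) (subst₂′ (rescale₂ N m₂) (rescale₁ N m₁ (+ 3 * M * (n * n * n)))
      (subst₂′ (cong₂ _*_ L₂≡Nm₂ L₂≡Nm₂) (cong (λ t → + 3 * M * (n * n * n) * (t * t)) L₁≡Nm₁) bound))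
      where
      open ℤₚ.≤-Reasoning
      rescale₂ : ∀ N m → (N * m) * (N * m) ≡ N * N * (m * m)
      rescale₂ = solve-∀
      rescale₁ : ∀ N m c → c * ((N * m) * (N * m)) ≡ N * N * (c * (m * m))
      rescale₁ = solve-∀
      L₂≥0 : 0ℤ ≤ L₂
      L₂≥0 = L≥0-self s star-s
      n≥0 = ℤₚ.<⇒≤ nonempty
      L₁²≥0 = 0≤² L₁
      shuffle₁ : ∀ l m → l * (l * (l * l)) ≡ (l * l) * (l * l)
      shuffle₁ = solve-∀
      shuffle₂ : ∀ a b c → (c * a) * (c * a) ≡ (a * a) * (c * c)
      shuffle₂ = solve-∀
      shuffle₃ : ∀ a b l → a * (b * l) ≡ l * (a * b)
      shuffle₃ = solve-∀
      shuffle₄ : ∀ n l → n * (l * (l * l)) ≡ n * l * (l * l)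
      shuffle₄ = solve-∀
      shuffle₅ : ∀ n a b → n * (a * b) ≡ a * (n * b)
      shuffle₅ = solve-∀
      shuffle₆ : ∀ n a m l → a * (n * n * n * n * (+ 3 * m * l)) ≡ n * l * (+ 3 * m * (n * n * n) * a)
      shuffle₆ = solve-∀
      C = + 3 * M * (n * n * n)
      bound : L₂ * L₂ ≤ C * (L₁ * L₁)
      bound with 0ℤ ℤ.<? L₂
      -- A factor `L₂` is cancelled twice in the other case, so `L₂ = 0` is treated apart.
      ... | no  L₂≯0 = subst (_≤ C * (L₁ * L₁)) (sym (cong₂ _*_ L₂≡0 L₂≡0))
                         (0≤* (0≤* (0≤* {+ 3} (+≤+ z≤n) (ℤₚ.<⇒≤ 0<M)) (0≤* (0≤² n) n≥0)) L₁²≥0)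
        where L₂≡0 : L₂ ≡ 0ℤ
              L₂≡0 = ℤₚ.≤-antisym (ℤₚ.≮⇒≥ L₂≯0) L₂≥0
      ... | yes L₂>0 = *-cancel-≤ (n * L₂) (0<* nonempty L₂>0) (begin
        n * L₂ * (L₂ * L₂)  ≡⟨ shuffle₄ n L₂ ⟨
        n * (L₂ * (L₂ * L₂))  ≤⟨ ℤₚ.*-monoˡ-≤-nonNeg n {{ℤ.nonNegative n≥0}} cubic ⟩
        n * (L₁ * L₁ * L₄)  ≡⟨ shuffle₅ n (L₁ * L₁) L₄ ⟩
        L₁ * L₁ * (n * L₄)  ≤⟨ ℤₚ.*-monoˡ-≤-nonNeg (L₁ * L₁) {{ℤ.nonNegative L₁²≥0}} L₄-convexity ⟩
        L₁ * L₁ * (n * n * n * n * H)  ≤⟨ ℤₚ.*-monoˡ-≤-nonNeg (L₁ * L₁) {{ℤ.nonNegative L₁²≥0}}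
                                                         (ℤₚ.*-monoˡ-≤-nonNeg (n * n * n * n) {{ℤ.nonNegative (0≤* (0≤* (0≤² n) n≥0) n≥0)}} H≤3ML₂) ⟩
        L₁ * L₁ * (n * n * n * n * (+ 3 * M * L₂))   ≡⟨ shuffle₆ n (L₁ * L₁) M L₂ ⟩
        n * L₂ * (C * (L₁ * L₁))  ∎)
        where
        cubic : L₂ * (L₂ * L₂) ≤ L₁ * L₁ * L₄
        -- Eliminates the third moment: `L₂⁴ ≤ (L₁ L₃)² ≤ L₁² L₂ L₄`.
        cubic = *-cancel-≤ L₂ L₂>0 (begin
          L₂ * (L₂ * (L₂ * L₂))  ≡⟨ shuffle₁ L₂ L₂ ⟩
          (L₂ * L₂) * (L₂ * L₂)  ≤⟨ *-mono-≤₀ (0≤² L₂) (0≤² L₂) L₂²≤L₁L₃ L₂²≤L₁L₃ ⟩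
          (L₃ * L₁) * (L₃ * L₁)  ≡⟨ shuffle₂ L₁ L₁ L₃ ⟩
          (L₁ * L₁) * (L₃ * L₃)  ≤⟨ ℤₚ.*-monoˡ-≤-nonNeg (L₁ * L₁) {{ℤ.nonNegative L₁²≥0}} L₃²≤L₂L₄ ⟩
          (L₁ * L₁) * (L₄ * L₂)  ≡⟨ shuffle₃ (L₁ * L₁) L₄ L₂ ⟩
          L₂ * (L₁ * L₁ * L₄)  ∎)

  -- Square roots of -1

  once-allFin : ∀ n (i : Fin n) → Once Finₚ._≟_ (allFin n) i
  once-allFin (suc n) i = trans (cong (_+_ (𝟙 (Fin.zero Finₚ.≟ i))) (trans
    (cong (λ xs → Σ xs (λ x → 𝟙 (x Finₚ.≟ i))) (sym (Listₚ.map-tabulate (λ x → x) Fin.suc)))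
    (Σ-map Fin.suc (allFin n) (λ x → 𝟙 (x Finₚ.≟ i))))) (cases i)
    where
    cases : ∀ i → 𝟙 (Fin.zero Finₚ.≟ i) + Σ (allFin n) (λ x → 𝟙 (Fin.suc x Finₚ.≟ i)) ≡ 1ℤ
    cases Fin.zero = trans (cong (_+_ 1ℤ) (trans (Σ-cong (allFin n) (λ x → 𝟙-no (Fin.suc x Finₚ.≟ Fin.zero) (λ ()))) (Σ-zero (allFin n)))) refl
    cases (Fin.suc j) = trans (+-identityˡ _) (trans (Σ-cong (allFin n) (λ x → 𝟙-cong (Fin.suc x Finₚ.≟ Fin.suc j) (x Finₚ.≟ j) Finₚ.suc-injective (cong Fin.suc)))
      (once-allFin n j))

  𝟙-length : {P : I → Set} (P? : Decidable P) (xs : List I) → Σ xs (λ x → 𝟙 (P? x)) ≡ + length (filter P? xs)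
  𝟙-length P? xs = trans (Σ-cong xs (λ x → sym (*-identityʳ (𝟙 (P? x))))) (trans (sym (Σ-filter P? xs (λ _ → 1ℤ))) (Σ-length (filter P? xs)))

  -- Pair each x with σ x and count the pairs by their element of smaller index.
  involution-parity : (_≟_ : DecidableEquality I) (idx : I → ℕ) → (∀ {x y} → idx x ≡ idx y → x ≡ y) →
    (xs : List I) (σ : I → I) → (∀ x → x ∈ xs → Once _≟_ xs (σ x)) → (∀ x → x ∈ xs → σ (σ x) ≡ x) →
    ∃ λ k → + length xs ≡ + 2 * + k + Σ xs (λ x → 𝟙 (σ x ≟ x))
  involution-parity _≟_ idx idx-injective xs σ σ-once σσ = length (filter lower? xs) , (begin
    + length xs  ≡⟨ Σ-length xs ⟨
    Σ xs (λ _ → 1ℤ)  ≡⟨ Σ-cong-∈ xs trichotomy ⟨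
    Σ xs (λ x → lower x + lower (σ x) + 𝟙 (σ x ≟ x))  ≡⟨ trans (Σ-+ xs _ _) (cong₂ _+_ (Σ-+ xs _ _) refl) ⟩
    Σ xs lower + Σ xs (λ x → lower (σ x)) + fixed  ≡⟨ cong (λ t → Σ xs lower + t + fixed)
                                                                    (Σ-bijection _≟_ _≟_ xs xs σ σ σ-once σ-once σσ σσ lower) ⟩
    Σ xs lower + Σ xs lower + fixed  ≡⟨ cong (_+ fixed) (double (Σ xs lower)) ⟩
    + 2 * Σ xs lower + fixed  ≡⟨ cong (λ t → + 2 * t + fixed) (𝟙-length lower? xs) ⟩
    + 2 * + length (filter lower? xs) + fixed  ∎)
    where
    open ≡-Reasoning
    lower? : Decidable (λ x → idx x ℕ.< idx (σ x))
    lower? x = idx x ℕₚ.<? idx (σ x)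
    lower : _ → ℤ
    lower x = 𝟙 (lower? x)
    fixed = Σ xs (λ x → 𝟙 (σ x ≟ x))
    double : ∀ t → t + t ≡ + 2 * t
    double = solve-∀
    trichotomy : ∀ x → x ∈ xs → lower x + lower (σ x) + 𝟙 (σ x ≟ x) ≡ 1ℤ
    trichotomy x x∈ with ℕₚ.<-cmp (idx x) (idx (σ x))
    ... | tri< lt ¬eq _ = cong₂ _+_ (cong₂ _+_ (𝟙-yes (lower? x) lt)
            (𝟙-no (lower? (σ x)) (λ h → ℕₚ.<-asym lt (subst (λ z → idx (σ x) ℕ.< idx z) (σσ x x∈) h))))
            (𝟙-no (σ x ≟ x) (λ h → ¬eq (cong idx (sym h))))
    ... | tri≈ ¬lt eq ¬gt = cong₂ _+_ (cong₂ _+_ (𝟙-no (lower? x) ¬lt)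
            (𝟙-no (lower? (σ x)) (λ h → ¬gt (subst (λ z → idx (σ x) ℕ.< idx z) (σσ x x∈) h))))
            (𝟙-yes (σ x ≟ x) (idx-injective (sym eq)))
    ... | tri> _ ¬eq gt = cong₂ _+_ (cong₂ _+_ (𝟙-no (lower? x) (ℕₚ.<-asym gt))
            (𝟙-yes (lower? (σ x)) (subst (λ z → idx (σ x) ℕ.< idx z) (sym (σσ x x∈)) gt)))
            (𝟙-no (σ x ≟ x) (λ h → ¬eq (cong idx (sym h))))

  module Field {q : ℕ} (F : FiniteField q) where
    module F = FiniteField F
    open F public using (elems; points; 0≢1; inverse)

    private
      to   = Inverse.to F.enum
      from = Inverse.from F.enum

      to-from : ∀ x → to (from x) ≡ x
      to-from x = Inverse.inverseˡ F.enum refl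

      from-to : ∀ i → from (to i) ≡ i
      from-to i = Inverse.inverseʳ F.enum refl

    finiteRing : FiniteRing
    finiteRing = record
      { Carrier = F.Carrier ; _⊕_ = F._+_ ; _⊗_ = F._*_ ; ⊖_ = F.-_ ; 0# = F.0# ; 1# = F.1#
      ; isCommutativeRing = F.isCommutativeRing ; _≟_ = F._≟_ ; all = elems
      ; once = λ p → trans (Σ-map to (allFin q) _) (trans
          (Σ-cong (allFin q) (λ i → 𝟙-cong (to i F.≟ p) (i Finₚ.≟ from p)
            (λ h → trans (sym (from-to i)) (cong from h)) (λ h → trans (cong to h) (to-from p))))
          (once-allFin q (from p))) }

    open FiniteRing finiteRing public
    module R = CommutativeRing ring
    open IntegerCoefficients ring public

    length-elems : length elems ≡ q
    length-elems = trans (Listₚ.length-map to (allFin q)) (Listₚ.length-tabulate (λ x → x))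

    Σ-elems-1 : Σ elems (λ _ → 1ℤ) ≡ + q
    Σ-elems-1 = trans (Σ-length elems) (cong +_ length-elems)

    zero-product : ∀ x y → x ⊗ y ≡ 0# → x ≡ 0# ⊎ y ≡ 0#
    zero-product x y xy≡0 with x ≟ 0#
    ... | yes x≡0 = inj₁ x≡0
    ... | no  x≢0 with inverse x x≢0
    ...   | x′ , xx′≡1 = inj₂ (begin
      y  ≡⟨ R.*-identityˡ y ⟨
      1# ⊗ y  ≡⟨ cong (_⊗ y) xx′≡1 ⟨
      x ⊗ x′ ⊗ y  ≡⟨ solve 3 (λ x x′ y → x :* x′ :* y := x′ :* (x :* y)) refl x x′ y ⟩
      x′ ⊗ (x ⊗ y)  ≡⟨ cong (x′ ⊗_) xy≡0 ⟩
      x′ ⊗ 0#  ≡⟨ R.zeroʳ x′ ⟩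
      0#  ∎)
      where open ≡-Reasoning

    ≡-from-difference : ∀ {x y} → x ⊕ ⊖ y ≡ 0# → x ≡ y
    ≡-from-difference {x} {y} h = trans (solve 2 (λ x y → x := (x :+ :- y) :+ y) refl x y) (trans (cong (_⊕ y) h) (R.+-identityˡ y))

    ⊖⊖ : ∀ x → ⊖ (⊖ x) ≡ x
    ⊖⊖ = solve 1 (λ x → :- (:- x) := x) refl

    idx : Carrier → ℕ
    idx x = Fin.toℕ (from x)

    idx-injective : ∀ {x y} → idx x ≡ idx y → x ≡ y
    idx-injective {x} {y} h = trans (sym (to-from x)) (trans (cong to (Finₚ.toℕ-injective h)) (to-from y))

    -- If `1 + 1` vanished, translation by `1#` would be an involution without fixed points and
    -- would pair off all the elements.
    odd-order⇒2≢0 : (∀ k → q ≢ 2 ℕ.* k) → 1# ⊕ 1# ≢ 0#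
    odd-order⇒2≢0 odd 2≡0 with involution-parity _≟_ idx idx-injective elems (_⊕ 1#) (λ x _ → once (x ⊕ 1#)) (λ x _ → shift₂ x)
      where
      shift₂ : ∀ x → x ⊕ 1# ⊕ 1# ≡ x
      shift₂ x = trans (R.+-assoc x 1# 1#) (trans (cong (x ⊕_) 2≡0) (R.+-identityʳ x))
    ... | k , eq = odd k (ℤₚ.+-injective (begin
      + q  ≡⟨ cong +_ length-elems ⟨
      + length elems  ≡⟨ eq ⟩
      + 2 * + k + _  ≡⟨ cong (_+_ (+ 2 * + k)) (trans (Σ-cong elems (λ x → 𝟙-no (x ⊕ 1# ≟ x) (no-fixed x))) (Σ-zero elems)) ⟩
      + 2 * + k + 0ℤ  ≡⟨ +-identityʳ _ ⟩
      + 2 * + k  ≡⟨ ℤₚ.pos-* 2 k ⟨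
      + (2 ℕ.* k)  ∎))
      where
      open ≡-Reasoning
      no-fixed : ∀ x → x ⊕ 1# ≢ x
      no-fixed x h = 0≢1 (begin
        0#  ≡⟨ solve 1 (λ x → con 0ℤ := x :+ :- x) refl x ⟩
        x ⊕ ⊖ x  ≡⟨ cong (_⊕ ⊖ x) h ⟨
        x ⊕ 1# ⊕ ⊖ x  ≡⟨ solve 1 (λ x → x :+ con 1ℤ :+ :- x := con 1ℤ) refl x ⟩
        1#  ∎)

    module OddCharacteristic (2≢0 : 1# ⊕ 1# ≢ 0#) where

      self-negative : ∀ x → ⊖ x ≡ x → x ≡ 0#
      self-negative x h with zero-product (1# ⊕ 1#) x (trans (solve 1 (λ x → (con 1ℤ :+ con 1ℤ) :* x := x :+ :- (:- x)) refl x)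
        (trans (cong (λ t → x ⊕ ⊖ t) h) (R.-‿inverseʳ x)))
      ... | inj₁ 2≡0 = contradiction 2≡0 2≢0
      ... | inj₂ x≡0 = x≡0

      -- one representative of each pair {x , - x} with x ≢ 0
      Positive : Carrier → Set
      Positive x = idx x ℕ.< idx (⊖ x)

      positive? : Decidable Positive
      positive? x = idx x ℕₚ.<? idx (⊖ x)

      half : List Carrier
      half = filter positive? elems

      positive⇒≢0 : ∀ {x} → Positive x → x ≢ 0#
      positive⇒≢0 {x} px refl = ℕₚ.<-irrefl (cong idx (sym (solve 0 (:- con 0ℤ := con 0ℤ) refl))) px

      abs : Carrier → Carrier
      abs y with positive? y
      ... | yes _ = y
      ... | no  _ = ⊖ y

      abs-cases : ∀ y → abs y ≡ y ⊎ abs y ≡ ⊖ y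
      abs-cases y with positive? y
      ... | yes _ = inj₁ refl
      ... | no  _ = inj₂ refl

      abs-positive : ∀ {y} → y ≢ 0# → Positive (abs y)
      abs-positive {y} y≢0 with positive? y
      ... | yes p = p
      ... | no ¬p = ℕₚ.≤∧≢⇒< (subst (idx (⊖ y) ℕ.≤_) (cong idx (sym (⊖⊖ y))) (ℕₚ.≮⇒≥ ¬p))
                      (λ h → y≢0 (self-negative y (trans (idx-injective h) (⊖⊖ y))))

      abs-fixed : ∀ {y} → Positive y → abs y ≡ y
      abs-fixed {y} p with positive? y
      ... | yes _ = refl
      ... | no ¬p = contradiction p ¬p

      abs-⊖ : ∀ {y} → y ≢ 0# → abs (⊖ y) ≡ abs y
      abs-⊖ {y} y≢0 with positive? y | positive? (⊖ y)
      ... | yes p | yes p′ = contradiction (subst (λ t → idx (⊖ y) ℕ.< idx t) (⊖⊖ y) p′) (ℕₚ.<-asym p)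
      ... | yes p | no _   = ⊖⊖ y
      ... | no _  | yes _  = refl
      ... | no ¬p | no ¬p′ = contradiction (self-negative y (idx-injective (ℕₚ.≤-antisym (ℕₚ.≮⇒≥ ¬p)
                               (subst (λ t → idx t ℕ.≤ idx (⊖ y)) (⊖⊖ y) (ℕₚ.≮⇒≥ ¬p′))))) y≢0

      ∈half : ∀ {x} → x ∈ half → Positive x
      ∈half x∈ = proj₂ (∈-filter⁻ positive? {xs = elems} x∈)

      once-half : ∀ {x} → Positive x → Once _≟_ half x
      once-half {x} px = Once-filter _≟_ positive? elems x px (once x)

      q≡1+2half : q ≡ 1 ℕ.+ 2 ℕ.* length half
      q≡1+2half = ℤₚ.+-injective (begin
        + q  ≡⟨ Σ-elems-1 ⟨
        Σ elems (λ _ → 1ℤ)  ≡⟨ Σ-cong elems trichotomy ⟨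
        Σ elems (λ x → 𝟙 (x ≟ 0#) + (pos x + pos (⊖ x))) ≡⟨ trans (Σ-+ elems _ _) (cong₂ _+_ (once 0#) (Σ-+ elems _ _)) ⟩
        1ℤ + (Σ elems pos + Σ elems (λ x → pos (⊖ x)))   ≡⟨ cong (λ t → 1ℤ + (Σ elems pos + t))
                                                              (Σ-bijection _≟_ _≟_ elems elems ⊖_ ⊖_ (λ x _ → once (⊖ x)) (λ x _ → once (⊖ x)) (λ x _ → ⊖⊖ x) (λ x _ → ⊖⊖ x) pos) ⟩
        1ℤ + (Σ elems pos + Σ elems pos)   ≡⟨ cong (λ t → 1ℤ + (t + t)) (𝟙-length positive? elems) ⟩
        + (1 ℕ.+ (length half ℕ.+ length half)) ≡⟨ cong (λ t → + (1 ℕ.+ (length half ℕ.+ t))) (sym (ℕₚ.+-identityʳ _)) ⟩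
        + (1 ℕ.+ 2 ℕ.* length half)  ∎)
        where
        open ≡-Reasoning
        pos : Carrier → ℤ
        pos x = 𝟙 (positive? x)
        trichotomy : ∀ x → 𝟙 (x ≟ 0#) + (pos x + pos (⊖ x)) ≡ 1ℤ
        trichotomy x with x ≟ 0#
        ... | yes refl = trans (cong (_+_ 1ℤ) (cong₂ _+_ (𝟙-no (positive? 0#) (λ p → positive⇒≢0 p refl))
                           (𝟙-no (positive? (⊖ 0#)) (λ p → positive⇒≢0 p (solve 0 (:- con 0ℤ := con 0ℤ) refl))))) refl
        ... | no x≢0 with ℕₚ.<-cmp (idx x) (idx (⊖ x))
        ...   | tri< lt _ _ = trans (+-identityˡ _) (cong₂ _+_ (𝟙-yes (positive? x) lt)
                  (𝟙-no (positive? (⊖ x)) (λ p → ℕₚ.<-asym lt (subst (λ t → idx (⊖ x) ℕ.< idx t) (⊖⊖ x) p))))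
        ...   | tri≈ _ eq _ = contradiction (self-negative x (sym (idx-injective eq))) x≢0
        ...   | tri> ¬lt _ gt = trans (+-identityˡ _) (cong₂ _+_ (𝟙-no (positive? x) ¬lt)
                  (𝟙-yes (positive? (⊖ x)) (subst (λ t → idx (⊖ x) ℕ.< idx t) (sym (⊖⊖ x)) gt)))

      -- Conditions under which `f` induces an involution on the classes of `x` and `⊖ x`.
      -- Multiplication by a root of minus one satisfies them, being an involution up to sign, and
      -- so does inversion. The parity of the number `(q - 1) / 2` of classes is then that of the
      -- number of fixed classes.
      module _ (f : Carrier → Carrier) (f≢0 : ∀ {x} → x ≢ 0# → f x ≢ 0#) (f-⊖ : ∀ {x} → x ≢ 0# → f (⊖ x) ≡ ⊖ f x)
               (ff : ∀ {x} → x ≢ 0# → f (f x) ≡ x ⊎ f (f x) ≡ ⊖ x) where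

        half-parity : ∃ λ k → + length half ≡ + 2 * + k + Σ half (λ x → 𝟙 (abs (f x) ≟ x))
        half-parity = involution-parity _≟_ idx idx-injective half (λ x → abs (f x))
          (λ x x∈ → once-half (abs-positive (f≢0 (positive⇒≢0 (∈half x∈))))) involutive
          where
          involutive : ∀ x → x ∈ half → abs (f (abs (f x))) ≡ x
          involutive x x∈ = trans (drop-abs (abs-cases (f x))) abs-ff
            where
            px = ∈half x∈
            x≢0 = positive⇒≢0 px
            abs-ff : abs (f (f x)) ≡ x
            abs-ff with ff x≢0
            ... | inj₁ e = trans (cong abs e) (abs-fixed px)
            ... | inj₂ e = trans (cong abs e) (trans (abs-⊖ x≢0) (abs-fixed px))
            drop-abs : abs (f x) ≡ f x ⊎ abs (f x) ≡ ⊖ f x → abs (f (abs (f x))) ≡ abs (f (f x))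
            drop-abs (inj₁ e) = cong (λ t → abs (f t)) e
            drop-abs (inj₂ e) = trans (cong (λ t → abs (f t)) e) (trans (cong abs (f-⊖ (f≢0 x≢0))) (abs-⊖ (f≢0 (f≢0 x≢0))))

      half-even⇒1mod4 : ∀ {k} → length half ≡ 2 ℕ.* k → q % 4 ≡ 1
      half-even⇒1mod4 {k} h = trans (cong (_% 4) (trans q≡1+2half (cong ℕ.suc (trans (cong (2 ℕ.*_) h) (trans (sym (ℕₚ.*-assoc 2 2 k)) (ℕₚ.*-comm 4 k)))))) ([m+kn]%n≡m%n 1 k 4)

      half-odd⇒3mod4 : ∀ {k} → length half ≡ 1 ℕ.+ 2 ℕ.* k → q % 4 ≡ 3
      half-odd⇒3mod4 {k} h = trans (cong (_% 4) (trans q≡1+2half (cong ℕ.suc (trans (cong (2 ℕ.*_) h) (trans (ℕₚ.*-distribˡ-+ 2 1 (2 ℕ.* k)) (cong (ℕ._+_ 2) (trans (sym (ℕₚ.*-assoc 2 2 k)) (ℕₚ.*-comm 4 k)))))))) ([m+kn]%n≡m%n 3 k 4)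

      -- A class fixed by multiplication with `i` would give `x² = (i x)² = - x²`, hence `x = 0`.
      -- Without fixed classes `(q - 1) / 2` is even, which contradicts `q ≡ 3`.
      no-√-1 : q % 4 ≡ 3 → ∀ i → i ⊗ i ≢ ⊖ 1#
      no-√-1 q≡3 i i²≡-1 = finish (half-parity (i ⊗_) i⊗≢0 (λ {x} _ → solve 2 (λ i x → i :* :- x := :- (i :* x)) refl i x) i⊗i⊗)
        where
        i⊗i⊗ : ∀ {x} → x ≢ 0# → i ⊗ (i ⊗ x) ≡ x ⊎ i ⊗ (i ⊗ x) ≡ ⊖ x
        i⊗i⊗ {x} _ = inj₂ (trans (sym (R.*-assoc i i x)) (trans (cong (_⊗ x) i²≡-1) (solve 1 (λ x → :- con 1ℤ :* x := :- x) refl x)))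
        i⊗≢0 : ∀ {x} → x ≢ 0# → i ⊗ x ≢ 0#
        i⊗≢0 {x} x≢0 h with zero-product i x h
        ... | inj₂ x≡0 = x≢0 x≡0
        ... | inj₁ refl = 0≢1 (trans (solve 0 (con 0ℤ := :- (con 0ℤ :* con 0ℤ)) refl) (trans (cong ⊖_ i²≡-1) (⊖⊖ 1#)))
        square-of-fixed : ∀ {x} → abs (i ⊗ x) ≡ x → i ⊗ x ⊗ (i ⊗ x) ≡ x ⊗ x
        square-of-fixed {x} h with abs-cases (i ⊗ x)
        ... | inj₁ e = cong₂ _⊗_ (trans (sym e) h) (trans (sym e) h)
        ... | inj₂ e = trans (solve 1 (λ y → y :* y := (:- y) :* (:- y)) refl (i ⊗ x)) (cong₂ _⊗_ (trans (sym e) h) (trans (sym e) h))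
        no-fixed : ∀ {x} → x ≢ 0# → abs (i ⊗ x) ≢ x
        no-fixed {x} x≢0 h = ⊥-cases (zero-product x x (self-negative (x ⊗ x) negated))
          where
          open ≡-Reasoning
          negated : ⊖ (x ⊗ x) ≡ x ⊗ x
          negated = begin
            ⊖ (x ⊗ x)  ≡⟨ solve 1 (λ x → :- (x :* x) := :- con 1ℤ :* (x :* x)) refl x ⟩
            ⊖ 1# ⊗ (x ⊗ x)  ≡⟨ cong (_⊗ (x ⊗ x)) i²≡-1 ⟨
            i ⊗ i ⊗ (x ⊗ x)  ≡⟨ solve 2 (λ i x → i :* i :* (x :* x) := i :* x :* (i :* x)) refl i x ⟩
            i ⊗ x ⊗ (i ⊗ x)  ≡⟨ square-of-fixed h ⟩
            x ⊗ x  ∎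
          ⊥-cases : x ≡ 0# ⊎ x ≡ 0# → ⊥
          ⊥-cases (inj₁ x≡0) = x≢0 x≡0
          ⊥-cases (inj₂ x≡0) = x≢0 x≡0
        finish : (∃ λ k → + length half ≡ + 2 * + k + Σ half (λ x → 𝟙 (abs (i ⊗ x) ≟ x))) → ⊥
        finish (k , eq) = 3≢1 (trans (sym q≡3) (half-even⇒1mod4 {k} (ℤₚ.+-injective (trans eq (trans
          (cong (_+_ (+ 2 * + k)) (trans (Σ-cong-∈ half (λ x x∈ → 𝟙-no (abs (i ⊗ x) ≟ x) (no-fixed (positive⇒≢0 (∈half x∈))))) (Σ-zero half)))
          (trans (+-identityʳ _) (sym (ℤₚ.pos-* 2 k))))))))
          where
          3≢1 : 3 ≢ 1
          3≢1 ()

      inv : Carrier → Carrier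
      inv x with x ≟ 0#
      ... | yes _   = 0#
      ... | no  x≢0 = proj₁ (inverse x x≢0)

      inv-right : ∀ {x} → x ≢ 0# → x ⊗ inv x ≡ 1#
      inv-right {x} x≢0 with x ≟ 0#
      ... | yes x≡0 = contradiction x≡0 x≢0
      ... | no  _   = proj₂ (inverse x _)

      inverse-unique : ∀ {x y z} → x ⊗ y ≡ 1# → x ⊗ z ≡ 1# → y ≡ z
      inverse-unique {x} {y} {z} xy xz = begin
        y  ≡⟨ R.*-identityˡ y ⟨
        1# ⊗ y  ≡⟨ cong (_⊗ y) xz ⟨
        x ⊗ z ⊗ y  ≡⟨ solve 3 (λ x y z → x :* z :* y := z :* (x :* y)) refl x y z ⟩
        z ⊗ (x ⊗ y)  ≡⟨ cong (z ⊗_) xy ⟩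
        z ⊗ 1#  ≡⟨ R.*-identityʳ z ⟩
        z  ∎
        where open ≡-Reasoning

      unit≢0 : ∀ {x y} → x ⊗ y ≡ 1# → x ≢ 0#
      unit≢0 {x} {y} xy refl = 0≢1 (trans (sym (R.zeroˡ y)) xy)

      ⊖≢0 : ∀ {x} → x ≢ 0# → ⊖ x ≢ 0#
      ⊖≢0 {x} x≢0 h = x≢0 (trans (sym (⊖⊖ x)) (trans (cong ⊖_ h) (solve 0 (:- con 0ℤ := con 0ℤ) refl)))

      -- A class fixed by inversion has `x² = 1` or `x² = - 1`. If the second never occurs, the
      -- class of `1#` is the only fixed one, and `(q - 1) / 2` is odd, which contradicts `q ≡ 1`.
      √-1 : q % 4 ≡ 1 → ∃ λ i → i ⊗ i ≡ ⊖ 1#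
      √-1 q≡1 with Finₚ.any? (λ i → to i ⊗ to i ≟ ⊖ 1#)
      ... | yes (i , h) = to i , h
      ... | no none = ⊥-elim (finish (half-parity inv inv≢0 inv-⊖ (λ x≢0 → inj₁ (inv-inv x≢0))))
        where
        inv≢0 : ∀ {x} → x ≢ 0# → inv x ≢ 0#
        inv≢0 {x} x≢0 = unit≢0 (trans (R.*-comm (inv x) x) (inv-right x≢0))
        inv-⊖ : ∀ {x} → x ≢ 0# → inv (⊖ x) ≡ ⊖ inv x
        inv-⊖ {x} x≢0 = inverse-unique (inv-right (⊖≢0 x≢0)) (trans (solve 2 (λ x y → :- x :* :- y := x :* y) refl x (inv x)) (inv-right x≢0))
        inv-inv : ∀ {x} → x ≢ 0# → inv (inv x) ≡ x
        inv-inv {x} x≢0 = inverse-unique (inv-right (inv≢0 x≢0)) (trans (R.*-comm (inv x) x) (inv-right x≢0))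
        1≢0 : 1# ≢ 0#
        1≢0 h = 0≢1 (sym h)
        no-root : ∀ x → x ⊗ x ≢ ⊖ 1#
        no-root x h = none (from x , trans (cong₂ _⊗_ (to-from x) (to-from x)) h)
        1⊗1 : 1# ⊗ 1# ≡ 1#
        1⊗1 = R.*-identityˡ 1#
        fixed⇒1 : ∀ {x} → x ∈ half → abs (inv x) ≡ x → x ≡ abs 1#
        fixed⇒1 {x} x∈ h with abs-cases (inv x)
        ... | inj₂ e = contradiction (trans (cong (x ⊗_) (trans (sym h) e)) (trans (solve 2 (λ x y → x :* :- y := :- (x :* y)) refl x (inv x)) (cong ⊖_ (inv-right (positive⇒≢0 (∈half x∈)))))) (no-root x)
        ... | inj₁ e with zero-product (x ⊕ ⊖ 1#) (x ⊕ 1#) (trans (solve 1 (λ x → (x :+ :- con 1ℤ) :* (x :+ con 1ℤ) := x :* x :+ :- con 1ℤ) refl x)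
                           (trans (cong (_⊕ ⊖ 1#) (trans (cong (x ⊗_) (trans (sym h) e)) (inv-right (positive⇒≢0 (∈half x∈))))) (R.-‿inverseʳ 1#)))
        ...   | inj₁ x-1 = trans (sym (abs-fixed (∈half x∈))) (cong abs (≡-from-difference x-1))
        ...   | inj₂ x+1 = trans (sym (abs-fixed (∈half x∈))) (trans (cong abs (≡-from-difference {x} {⊖ 1#} (trans (cong (x ⊕_) (⊖⊖ 1#)) x+1))) (abs-⊖ 1≢0))
        inv-1 : inv 1# ≡ 1#
        inv-1 = inverse-unique (inv-right 1≢0) 1⊗1
        inv-⊖1 : inv (⊖ 1#) ≡ ⊖ 1#
        inv-⊖1 = inverse-unique (inv-right (⊖≢0 1≢0)) (trans (solve 0 (:- con 1ℤ :* :- con 1ℤ := con 1ℤ :* con 1ℤ) refl) 1⊗1)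
        1⇒fixed : ∀ {x} → x ∈ half → x ≡ abs 1# → abs (inv x) ≡ x
        1⇒fixed {x} x∈ h with abs-cases 1#
        ... | inj₁ e = trans (cong (λ t → abs (inv t)) (trans h e)) (trans (cong abs inv-1) (sym h))
        ... | inj₂ e = trans (cong (λ t → abs (inv t)) (trans h e)) (trans (cong abs inv-⊖1) (trans (abs-⊖ 1≢0) (sym h)))
        finish : (∃ λ k → + length half ≡ + 2 * + k + Σ half (λ x → 𝟙 (abs (inv x) ≟ x))) → ⊥
        finish (k , eq) = 1≢3 (trans (sym q≡1) (half-odd⇒3mod4 {k} (ℤₚ.+-injective (trans eq (trans
          (cong (_+_ (+ 2 * + k)) (trans (Σ-cong-∈ half (λ x x∈ → 𝟙-cong (abs (inv x) ≟ x) (x ≟ abs 1#) (fixed⇒1 x∈) (1⇒fixed x∈))) (once-half (abs-positive 1≢0))))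
          (trans (+-comm (+ 2 * + k) 1ℤ) (cong (_+_ 1ℤ) (sym (ℤₚ.pos-* 2 k)))))))))
          where
          1≢3 : 1 ≢ 3
          1≢3 ()

  -- Inert and split planes

  𝟙-× : {P Q R : Set} (r : Dec R) (p : Dec P) (q : Dec Q) → (R → P × Q) → (P → Q → R) → 𝟙 r ≡ 𝟙 p * 𝟙 q
  𝟙-× r (yes p) (yes q) f g = 𝟙-yes r (g p q)
  𝟙-× r (yes p) (no ¬q) f g = 𝟙-no r (λ x → ¬q (proj₂ (f x)))
  𝟙-× r (no ¬p) q  f g = trans (𝟙-no r (λ x → ¬p (proj₁ (f x)))) (sym (*-zeroˡ (𝟙 q)))

  -- m times the projector off the zero frequency, m being the order of the ring
  module MeanZero (K : FiniteRing) where
    open FiniteRing K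
    open GroupRing K using (Σ-bij)
    open IntegerCoefficients ring
    private module KR = CommutativeRing ring

    m : ℤ
    m = Σ all (λ _ → 1ℤ)

    ρ : Carrier → ℤ
    ρ u = m * 𝟙 (u ≟ 0#) - 1ℤ

    Σρ : Σ all ρ ≡ 0ℤ
    Σρ = trans (Σ-- all _ _) (trans (cong (_- m) (trans (Σ-*ˡ all m _) (trans (cong (m *_) (once 0#)) (*-identityʳ m)))) (ℤₚ.+-inverseʳ m))

    Σρ-affine : ∀ ω ω′ → ω ⊗ ω′ ≡ 1# → ∀ c → Σ all (λ x → ρ (c ⊕ ω ⊗ x)) ≡ 0ℤ
    Σρ-affine ω ω′ h c = trans (Σ-bij (λ x → c ⊕ ω ⊗ x) (λ y → ω′ ⊗ (y ⊕ ⊖ c)) left right ρ) Σρ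
      where
      1⊗ : ∀ x → ω ⊗ ω′ ⊗ x ≡ x
      1⊗ x = trans (cong (_⊗ x) h) (KR.*-identityˡ x)
      left : ∀ x → ω′ ⊗ (c ⊕ ω ⊗ x ⊕ ⊖ c) ≡ x
      left x = trans (solve 4 (λ a b c x → b :* (c :+ a :* x :+ :- c) := a :* b :* x) refl ω ω′ c x) (1⊗ x)
      right : ∀ y → c ⊕ ω ⊗ (ω′ ⊗ (y ⊕ ⊖ c)) ≡ y
      right y = trans (cong (c ⊕_) (trans (sym (KR.*-assoc _ _ _)) (1⊗ _))) (solve 2 (λ c y → c :+ (y :+ :- c) := y) refl c y)

    ρ-invariant : ∀ θ θ′ → θ ⊗ θ′ ≡ 1# → ∀ u → ρ (θ ⊗ u) ≡ ρ u
    ρ-invariant θ θ′ h u = cong (λ t → m * t - 1ℤ) (𝟙-cong (θ ⊗ u ≟ 0#) (u ≟ 0#)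
      (λ e → trans (sym (KR.*-identityˡ u)) (trans (cong (_⊗ u) (sym h)) (trans (solve 3 (λ a b u → a :* b :* u := b :* (a :* u)) refl θ θ′ u)
               (trans (cong (θ′ ⊗_) e) (KR.zeroʳ θ′)))))
      (λ e → trans (cong (θ ⊗_) e) (KR.zeroʳ θ)))

    ρ-idempotent : ∀ u → Σ all (λ v → ρ v * ρ (u ⊕ ⊖ v)) ≡ m * ρ u
    ρ-idempotent u = begin
      Σ all (λ v → ρ v * ρ (u ⊕ ⊖ v))
        ≡⟨ Σ-cong all (λ v → expand m (𝟙 (v ≟ 0#)) (ρ (u ⊕ ⊖ v))) ⟩
      Σ all (λ v → m * (𝟙 (v ≟ 0#) * ρ (u ⊕ ⊖ v)) - ρ (u ⊕ ⊖ v))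
        ≡⟨ trans (Σ-- all _ _) (cong₂ _-_ (Σ-*ˡ all m _) refl) ⟩
      m * Σ all (λ v → 𝟙 (v ≟ 0#) * ρ (u ⊕ ⊖ v)) - Σ all (λ v → ρ (u ⊕ ⊖ v))
        ≡⟨ cong₂ (λ s t → m * s - t) (Σ-pick _≟_ all 0# (once 0#) (λ v → ρ (u ⊕ ⊖ v)))
             (trans (Σ-bij (λ v → u ⊕ ⊖ v) (λ v → u ⊕ ⊖ v) reflect reflect ρ) Σρ) ⟩
      m * ρ (u ⊕ ⊖ 0#) - 0ℤ
        ≡⟨ trans (+-identityʳ _) (cong (λ t → m * ρ t) (solve 1 (λ u → u :+ :- con 0ℤ := u) refl u)) ⟩
      m * ρ u ∎
      where
      open ≡-Reasoning
      expand : ∀ m d r → (m * d - 1ℤ) * r ≡ m * (d * r) - r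
      expand = solve-∀
      reflect : ∀ v → u ⊕ ⊖ (u ⊕ ⊖ v) ≡ v
      reflect v = solve 2 (λ u v → u :+ :- (u :+ :- v) := v) refl u v

  module Plane {q : ℕ} (F : FiniteField q) (q>0 : 0ℤ < + q) where
    open Field F public

    Point : Set
    Point = Carrier × Carrier

    _≟ₚ_ : DecidableEquality Point
    _≟ₚ_ = ×ₚ.≡-dec _≟_ _≟_

    _⊕ₚ_ : Point → Point → Point
    (a , b) ⊕ₚ (c , d) = (a ⊕ c , b ⊕ d)

    ⊖ₚ_ : Point → Point
    ⊖ₚ (a , b) = (⊖ a , ⊖ b)

    ⊕ₚ-isAbelianGroup : IsAbelianGroup _≡_ _⊕ₚ_ (0# , 0#) ⊖ₚ_
    ⊕ₚ-isAbelianGroup = record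
      { isGroup = record
        { isMonoid = record
          { isSemigroup = record
            { isMagma = record { isEquivalence = Relation.Binary.PropositionalEquality.isEquivalence ; ∙-cong = cong₂ _⊕ₚ_ }
            ; assoc = λ { (a , b) (c , d) (e , f) → cong₂ _,_ (R.+-assoc a c e) (R.+-assoc b d f) } }
          ; identity = (λ { (a , b) → cong₂ _,_ (R.+-identityˡ a) (R.+-identityˡ b) }) , (λ { (a , b) → cong₂ _,_ (R.+-identityʳ a) (R.+-identityʳ b) }) }
        ; inverse = (λ { (a , b) → cong₂ _,_ (R.-‿inverseˡ a) (R.-‿inverseˡ b) }) , (λ { (a , b) → cong₂ _,_ (R.-‿inverseʳ a) (R.-‿inverseʳ b) })
        ; ⁻¹-cong = cong ⊖ₚ_ }
      ; comm = λ { (a , b) (c , d) → cong₂ _,_ (R.+-comm a c) (R.+-comm b d) } }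

    Q : ℤ
    Q = + q

    Q²>0 : 0ℤ < Q * Q
    Q²>0 = 0<* q>0 q>0

    𝟙-point : ∀ a b c d → 𝟙 ((a , b) ≟ₚ (c , d)) ≡ 𝟙 (a ≟ c) * 𝟙 (b ≟ d)
    𝟙-point a b c d = 𝟙-× ((a , b) ≟ₚ (c , d)) (a ≟ c) (b ≟ d) (λ e → cong proj₁ e , cong proj₂ e) (cong₂ _,_)

    once-points : ∀ p → Once _≟ₚ_ points p
    once-points (c , d) = begin
      Σ points (λ z → 𝟙 (z ≟ₚ (c , d)))
        ≡⟨ Σ-cartesianProduct elems elems _ ⟩
      Σ elems (λ a → Σ elems (λ b → 𝟙 ((a , b) ≟ₚ (c , d))))
        ≡⟨ Σ-cong elems (λ a → Σ-cong elems (λ b → 𝟙-point a b c d)) ⟩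
      Σ elems (λ a → Σ elems (λ b → 𝟙 (a ≟ c) * 𝟙 (b ≟ d)))
        ≡⟨ Σ-product elems elems _ _ ⟩
      Σ elems (λ a → 𝟙 (a ≟ c)) * Σ elems (λ b → 𝟙 (b ≟ d))
        ≡⟨ cong₂ _*_ (once c) (once d) ⟩
      1ℤ ∎
      where open ≡-Reasoning

    size-points : Σ points (λ _ → 1ℤ) ≡ Q * Q
    size-points = trans (Σ-cartesianProduct elems elems _) (trans (Σ-product elems elems (λ _ → 1ℤ) (λ _ → 1ℤ)) (cong₂ _*_ Σ-elems-1 Σ-elems-1))

    norm : Point → Carrier
    norm (a , b) = a ⊗ a ⊕ b ⊗ b

    module Inert (no-root : ∀ i → i ⊗ i ≢ ⊖ 1#) where

      _⊗ₚ_ : Point → Point → Point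
      (a , b) ⊗ₚ (c , d) = (a ⊗ c ⊕ ⊖ (b ⊗ d) , a ⊗ d ⊕ b ⊗ c)

      K : FiniteRing
      K = record
        { Carrier = Point ; _⊕_ = _⊕ₚ_ ; _⊗_ = _⊗ₚ_ ; ⊖_ = ⊖ₚ_ ; 0# = (0# , 0#) ; 1# = (1# , 0#)
        ; isCommutativeRing = record
          { isRing = record
            { +-isAbelianGroup = ⊕ₚ-isAbelianGroup
            ; *-cong = cong₂ _⊗ₚ_
            ; *-assoc = λ { (a , b) (c , d) (e , f) → cong₂ _,_
                (solve 6 (λ a b c d e f → (a :* c :+ :- (b :* d)) :* e :+ :- ((a :* d :+ b :* c) :* f) := a :* (c :* e :+ :- (d :* f)) :+ :- (b :* (c :* f :+ d :* e))) refl a b c d e f)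
                (solve 6 (λ a b c d e f → (a :* c :+ :- (b :* d)) :* f :+ (a :* d :+ b :* c) :* e := a :* (c :* f :+ d :* e) :+ b :* (c :* e :+ :- (d :* f))) refl a b c d e f) }
            ; *-identity = (λ { (a , b) → identityˡ a b }) , (λ { (a , b) → trans (⊗ₚ-comm a b 1# 0#) (identityˡ a b) })
            ; distrib = (λ { (a , b) (c , d) (e , f) → distribˡ a b c d e f })
                      , (λ { (a , b) (c , d) (e , f) → trans (⊗ₚ-comm (c ⊕ e) (d ⊕ f) a b) (trans (distribˡ a b c d e f) (cong₂ _⊕ₚ_ (⊗ₚ-comm a b c d) (⊗ₚ-comm a b e f))) }) }
          ; *-comm = λ { (a , b) (c , d) → ⊗ₚ-comm a b c d } }
        ; _≟_ = _≟ₚ_ ; all = points ; once = once-points }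
        where
        ⊗ₚ-comm : ∀ a b c d → (a , b) ⊗ₚ (c , d) ≡ (c , d) ⊗ₚ (a , b)
        ⊗ₚ-comm a b c d = cong₂ _,_ (solve 4 (λ a b c d → a :* c :+ :- (b :* d) := c :* a :+ :- (d :* b)) refl a b c d)
                                    (solve 4 (λ a b c d → a :* d :+ b :* c := c :* b :+ d :* a) refl a b c d)
        identityˡ : ∀ a b → (1# , 0#) ⊗ₚ (a , b) ≡ (a , b)
        identityˡ a b = cong₂ _,_ (solve 2 (λ a b → con 1ℤ :* a :+ :- (con 0ℤ :* b) := a) refl a b) (solve 2 (λ a b → con 1ℤ :* b :+ con 0ℤ :* a := b) refl a b)
        distribˡ : ∀ a b c d e f → (a , b) ⊗ₚ (c ⊕ e , d ⊕ f) ≡ ((a , b) ⊗ₚ (c , d)) ⊕ₚ ((a , b) ⊗ₚ (e , f))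
        distribˡ a b c d e f = cong₂ _,_
          (solve 6 (λ a b c d e f → a :* (c :+ e) :+ :- (b :* (d :+ f)) := (a :* c :+ :- (b :* d)) :+ (a :* e :+ :- (b :* f))) refl a b c d e f)
          (solve 6 (λ a b c d e f → a :* (d :+ f) :+ b :* (c :+ e) := (a :* d :+ b :* c) :+ (a :* f :+ b :* e)) refl a b c d e f)

      module KR = CommutativeRing (FiniteRing.ring K)

      norm-⊗ : ∀ z w → norm (z ⊗ₚ w) ≡ norm z ⊗ norm w
      norm-⊗ (a , b) (c , d) = solve 4 (λ a b c d → (a :* c :+ :- (b :* d)) :* (a :* c :+ :- (b :* d)) :+ (a :* d :+ b :* c) :* (a :* d :+ b :* c)
        := (a :* a :+ b :* b) :* (c :* c :+ d :* d)) refl a b c d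

      -- A zero with `b ≢ 0#` would make `a / b` a root of minus one.
      anisotropic : ∀ z → norm z ≡ 0# → z ≡ (0# , 0#)
      anisotropic (a , b) h with b ≟ 0#
      ... | yes refl = cong (_, 0#) (reduce (zero-product a a (trans (solve 1 (λ a → a :* a := a :* a :+ con 0ℤ :* con 0ℤ) refl a) h)))
        where reduce : a ≡ 0# ⊎ a ≡ 0# → a ≡ 0#
              reduce (inj₁ e) = e
              reduce (inj₂ e) = e
      ... | no b≢0 with inverse b b≢0
      ...   | b′ , bb′≡1 = contradiction square (no-root (a ⊗ b′))
        where
        open ≡-Reasoning
        square : a ⊗ b′ ⊗ (a ⊗ b′) ≡ ⊖ 1#
        square = begin
          a ⊗ b′ ⊗ (a ⊗ b′)
            ≡⟨ solve 3 (λ a b c → a :* c :* (a :* c) := (a :* a :+ b :* b) :* (c :* c) :+ :- (b :* c :* (b :* c))) refl a b b′ ⟩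
          norm (a , b) ⊗ (b′ ⊗ b′) ⊕ ⊖ (b ⊗ b′ ⊗ (b ⊗ b′))
            ≡⟨ cong₂ (λ s t → s ⊗ (b′ ⊗ b′) ⊕ ⊖ (t ⊗ t)) h bb′≡1 ⟩
          0# ⊗ (b′ ⊗ b′) ⊕ ⊖ (1# ⊗ 1#)
            ≡⟨ solve 1 (λ c → con 0ℤ :* c :+ :- (con 1ℤ :* con 1ℤ) := :- con 1ℤ) refl (b′ ⊗ b′) ⟩
          ⊖ 1# ∎

      conj : Point → Point
      conj (a , b) = (a , ⊖ b)

      conj-norm : ∀ z → z ⊗ₚ conj z ≡ (norm z , 0#)
      conj-norm (a , b) = cong₂ _,_ (solve 2 (λ a b → a :* a :+ :- (b :* :- b) := a :* a :+ b :* b) refl a b)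
                                    (solve 2 (λ a b → a :* :- b :+ b :* a := con 0ℤ) refl a b)

      no-zero-divisors : ∀ z r → z ⊗ₚ r ≡ (0# , 0#) → z ≡ (0# , 0#) ⊎ r ≡ (0# , 0#)
      no-zero-divisors z r h with zero-product (norm z) (norm r) (trans (sym (norm-⊗ z r)) (trans (cong norm h) (solve 0 (con 0ℤ :* con 0ℤ :+ con 0ℤ :* con 0ℤ := con 0ℤ) refl)))
      ... | inj₁ e = inj₁ (anisotropic z e)
      ... | inj₂ e = inj₂ (anisotropic r e)

      invertible : ∀ z → z ≢ (0# , 0#) → ∃ λ z′ → z ⊗ₚ z′ ≡ (1# , 0#)
      invertible z z≢0 with inverse (norm z) (λ h → z≢0 (anisotropic z h))
      ... | n′ , nn′≡1 = conj z ⊗ₚ (n′ , 0#) , trans (sym (KR.*-assoc z (conj z) (n′ , 0#))) (trans (cong (_⊗ₚ (n′ , 0#)) (conj-norm z))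
        (cong₂ _,_ (trans (solve 2 (λ n m → n :* m :+ :- (con 0ℤ :* con 0ℤ) := n :* m) refl (norm z) n′) nn′≡1)
                   (solve 2 (λ n m → n :* con 0ℤ :+ con 0ℤ :* m := con 0ℤ) refl (norm z) n′)))

      open MeanZero K using (ρ; ρ-invariant; ρ-idempotent; Σρ-affine)

      geometry : Geometry
      geometry = record
        { K = K ; conj = conj
        ; conj-⊕ = λ { (a , b) (c , d) → cong (a ⊕ c ,_) (solve 2 (λ b d → :- (b :+ d) := :- b :+ :- d) refl b d) }
        ; conj-⊗ = λ { (a , b) (c , d) → cong₂ _,_ (solve 4 (λ a b c d → a :* c :+ :- (b :* d) := a :* c :+ :- (:- b :* :- d)) refl a b c d)
                                                   (solve 4 (λ a b c d → :- (a :* d :+ b :* c) := a :* :- d :+ :- b :* c) refl a b c d) }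
        ; conj-⊖ = λ _ → refl
        ; conj-conj = λ { (a , b) → cong (a ,_) (⊖⊖ b) }
        ; conj-0 = cong (0# ,_) (solve 0 (:- con 0ℤ := con 0ℤ) refl)
        ; conj-1 = cong (1# ,_) (solve 0 (:- con 0ℤ := con 0ℤ) refl)
        ; regular = λ {z} {w} _ _ r h → no-zero-divisors (z ⊕ₚ w) r h
        ; π = ρ ; M = Q * Q ; 0<M = Q²>0 ; size = size-points
        ; π-invariant = λ {θ} u → ρ-invariant θ (conj θ) u
        ; π-idempotent = λ u → trans (ρ-idempotent u) (cong (_* ρ u) size-points)
        ; π-vanishing = λ ω ω≢0 → Σρ-affine ω (proj₁ (invertible ω ω≢0)) (proj₂ (invertible ω ω≢0)) }

    -- With the swap as conjugation the norm of `(a , b)` is the product `a b`, the isotropic lines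
    -- are parallel to the axes, and the rotations are the pairs of a nonzero scalar and its
    -- inverse.
    module Split where

      _⊗ₚ_ : Point → Point → Point
      (a , b) ⊗ₚ (c , d) = (a ⊗ c , b ⊗ d)

      K : FiniteRing
      K = record
        { Carrier = Point ; _⊕_ = _⊕ₚ_ ; _⊗_ = _⊗ₚ_ ; ⊖_ = ⊖ₚ_ ; 0# = (0# , 0#) ; 1# = (1# , 1#)
        ; isCommutativeRing = record
          { isRing = record
            { +-isAbelianGroup = ⊕ₚ-isAbelianGroup
            ; *-cong = cong₂ _⊗ₚ_
            ; *-assoc = λ { (a , b) (c , d) (e , f) → cong₂ _,_ (R.*-assoc a c e) (R.*-assoc b d f) }
            ; *-identity = (λ { (a , b) → cong₂ _,_ (R.*-identityˡ a) (R.*-identityˡ b) }) , (λ { (a , b) → cong₂ _,_ (R.*-identityʳ a) (R.*-identityʳ b) })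
            ; distrib = (λ { (a , b) (c , d) (e , f) → cong₂ _,_ (R.distribˡ a c e) (R.distribˡ b d f) })
                      , (λ { (a , b) (c , d) (e , f) → cong₂ _,_ (R.distribʳ a c e) (R.distribʳ b d f) }) }
          ; *-comm = λ { (a , b) (c , d) → cong₂ _,_ (R.*-comm a c) (R.*-comm b d) } }
        ; _≟_ = _≟ₚ_ ; all = points ; once = once-points }

      conj : Point → Point
      conj (a , b) = (b , a)

      open MeanZero finiteRing using (m; ρ; ρ-invariant; ρ-idempotent; Σρ-affine)

      -- The product removes both frequency axes, not only the origin. For an `ω` with one zero
      -- coordinate the sum over `x` of `π` still vanishes, thanks to the factor of the other
      -- coordinate.
      π : Point → ℤ
      π (a , b) = ρ a * ρ b

      -- For rotations `(a , 1/a)` and `(c , 1/c)` one coordinate of the sum vanishes only together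
      -- with the other, so a nonzero sum is invertible.
      regular : ∀ {z w} → z ⊗ₚ conj z ≡ (1# , 1#) → w ⊗ₚ conj w ≡ (1# , 1#) → ∀ r → (z ⊕ₚ w) ⊗ₚ r ≡ (0# , 0#) → z ⊕ₚ w ≡ (0# , 0#) ⊎ r ≡ (0# , 0#)
      regular {z₁ , z₂} {w₁ , w₂} uz uw (r₁ , r₂) h = cases (zero-product _ r₁ (cong proj₁ h)) (zero-product _ r₂ (cong proj₂ h))
        where
        open ≡-Reasoning
        transfer : ∀ {a b c d} → a ⊗ b ≡ 1# → c ⊗ d ≡ 1# → a ⊕ c ≡ 0# → b ⊕ d ≡ 0#
        transfer {a} {b} {c} {d} ab cd ac = begin
          b ⊕ d  ≡⟨ solve 2 (λ b d → b :+ d := con 1ℤ :* d :+ con 1ℤ :* b) refl b d ⟩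
          1# ⊗ d ⊕ 1# ⊗ b  ≡⟨ cong₂ (λ s t → s ⊗ d ⊕ t ⊗ b) ab cd ⟨
          a ⊗ b ⊗ d ⊕ c ⊗ d ⊗ b  ≡⟨ solve 4 (λ a b c d → a :* b :* d :+ c :* d :* b := (a :+ c) :* (b :* d)) refl a b c d ⟩
          (a ⊕ c) ⊗ (b ⊗ d)  ≡⟨ cong (_⊗ (b ⊗ d)) ac ⟩
          0# ⊗ (b ⊗ d)  ≡⟨ R.zeroˡ _ ⟩
          0#  ∎
        cases : z₁ ⊕ w₁ ≡ 0# ⊎ r₁ ≡ 0# → z₂ ⊕ w₂ ≡ 0# ⊎ r₂ ≡ 0# → _
        cases (inj₁ e) _  = inj₁ (cong₂ _,_ e (transfer (cong proj₁ uz) (cong proj₁ uw) e))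
        cases (inj₂ _) (inj₁ e) = inj₁ (cong₂ _,_ (transfer (cong proj₂ uz) (cong proj₂ uw) e) e)
        cases (inj₂ e) (inj₂ f) = inj₂ (cong₂ _,_ e f)

      geometry : Geometry
      geometry = record
        { K = K ; conj = conj
        ; conj-⊕ = λ _ _ → refl ; conj-⊗ = λ _ _ → refl ; conj-⊖ = λ _ → refl ; conj-conj = λ _ → refl ; conj-0 = refl ; conj-1 = refl
        ; regular = regular
        ; π = π ; M = Q * Q ; 0<M = Q²>0 ; size = size-points
        ; π-invariant = λ { {c , d} u (a , b) → cong₂ _*_ (ρ-invariant c d (cong proj₁ u) a) (ρ-invariant d c (cong proj₂ u) b) }
        ; π-idempotent = idempotent
        ; π-vanishing = vanishing }
        where
        open ≡-Reasoning
        interchange : ∀ a b c d → (a * b) * (c * d) ≡ (a * c) * (b * d)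
        interchange = solve-∀
        idempotent : ∀ u → Σ points (λ v → π v * π (u ⊕ₚ (⊖ₚ v))) ≡ Q * Q * π u
        idempotent (a , b) = begin
          Σ points (λ v → π v * π ((a , b) ⊕ₚ (⊖ₚ v)))
            ≡⟨ Σ-cartesianProduct elems elems _ ⟩
          Σ elems (λ c → Σ elems (λ d → (ρ c * ρ d) * (ρ (a ⊕ ⊖ c) * ρ (b ⊕ ⊖ d))))
            ≡⟨ Σ-cong elems (λ c → Σ-cong elems (λ d → interchange (ρ c) (ρ d) (ρ (a ⊕ ⊖ c)) (ρ (b ⊕ ⊖ d)))) ⟩
          Σ elems (λ c → Σ elems (λ d → (ρ c * ρ (a ⊕ ⊖ c)) * (ρ d * ρ (b ⊕ ⊖ d))))
            ≡⟨ Σ-product elems elems _ _ ⟩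
          Σ elems (λ c → ρ c * ρ (a ⊕ ⊖ c)) * Σ elems (λ d → ρ d * ρ (b ⊕ ⊖ d))
            ≡⟨ cong₂ _*_ (ρ-idempotent a) (ρ-idempotent b) ⟩
          (m * ρ a) * (m * ρ b)
            ≡⟨ trans (interchange m (ρ a) m (ρ b)) (cong (λ t → t * t * (ρ a * ρ b)) Σ-elems-1) ⟩
          Q * Q * (ρ a * ρ b) ∎
        affine : ∀ ω → ω ≢ 0# → ∀ c → Σ elems (λ x → ρ (c ⊕ ω ⊗ x)) ≡ 0ℤ
        affine ω ω≢0 = Σρ-affine ω (proj₁ (inverse ω ω≢0)) (proj₂ (inverse ω ω≢0))
        factor : ∀ ω₁ ω₂ c₁ c₂ → Σ points (λ x → π ((c₁ , c₂) ⊕ₚ ((ω₁ , ω₂) ⊗ₚ x))) ≡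
                 Σ elems (λ x → ρ (c₁ ⊕ ω₁ ⊗ x)) * Σ elems (λ x → ρ (c₂ ⊕ ω₂ ⊗ x))
        factor ω₁ ω₂ c₁ c₂ = trans (Σ-cartesianProduct elems elems _) (Σ-product elems elems _ _)
        vanishing : ∀ ω → ω ≢ (0# , 0#) → ∀ c → Σ points (λ x → π (c ⊕ₚ (ω ⊗ₚ x))) ≡ 0ℤ
        vanishing (ω₁ , ω₂) ω≢0 (c₁ , c₂) with ω₁ ≟ 0#
        ... | no ω₁≢0 = trans (factor ω₁ ω₂ c₁ c₂) (trans (cong (_* Σ elems (λ x → ρ (c₂ ⊕ ω₂ ⊗ x))) (affine ω₁ ω₁≢0 c₁)) (*-zeroˡ (Σ elems (λ x → ρ (c₂ ⊕ ω₂ ⊗ x)))))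
        ... | yes e with ω₂ ≟ 0#
        ...   | no ω₂≢0 = trans (factor ω₁ ω₂ c₁ c₂) (trans (cong (Σ elems (λ x → ρ (c₁ ⊕ ω₁ ⊗ x)) *_) (affine ω₂ ω₂≢0 c₂)) (*-zeroʳ (Σ elems (λ x → ρ (c₁ ⊕ ω₁ ⊗ x)))))
        ...   | yes f = contradiction (cong₂ _,_ e f) ω≢0

  -- Counting distances

  any-true : (p : I → Bool) {xs : List I} {x : I} → x ∈ xs → p x ≡ true → any p xs ≡ true
  any-true p (here refl) px rewrite px = refl
  any-true p {y ∷ ys} (there x∈) px with p y
  ... | true  = refl
  ... | false = any-true p x∈ px

  does-true : {P : Set} (d : Dec P) → P → does d ≡ true
  does-true (yes _) _ = refl
  does-true (no ¬p) p = contradiction p ¬p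

  𝟙≤1 : {P : Set} (d : Dec P) → 𝟙 d ≤ 1ℤ
  𝟙≤1 (yes _) = ℤₚ.≤-refl
  𝟙≤1 (no _)  = +≤+ z≤n

  Σ-filter-≤ : {P : I → Set} (P? : Decidable P) (xs : List I) (f : I → ℤ) → (∀ x → 0ℤ ≤ f x) → Σ (filter P? xs) f ≤ Σ xs f
  Σ-filter-≤ P? xs f f≥0 = subst (_≤ Σ xs f) (sym (Σ-filter P? xs f)) (Σ-mono xs (λ x →
    subst (𝟙 (P? x) * f x ≤_) (*-identityˡ (f x)) (ℤₚ.*-monoʳ-≤-nonNeg (f x) {{ℤ.nonNegative (f≥0 x)}} (𝟙≤1 (P? x)))))

  -- Expand the product and keep the single `t` equal to `f u`. With `w = 1` this turns a second
  -- moment into a count of coincident pairs; a general `w` allows one value of `t` to be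
  -- suppressed.
  Σ-fibres : (_≟_ : DecidableEquality J) (ts : List J) → (∀ t → Once _≟_ ts t) → (f : I → J) (w : J → ℤ) (xs : List I) →
    Σ ts (λ t → w t * (Σ xs (λ u → 𝟙 (f u ≟ t)) * Σ xs (λ v → 𝟙 (f v ≟ t)))) ≡ Σ xs (λ u → Σ xs (λ v → w (f u) * 𝟙 (f v ≟ f u)))
  Σ-fibres _≟_ ts once f w xs = begin
    Σ ts (λ t → w t * (Σ xs (λ u → 𝟙 (f u ≟ t)) * Σ xs (λ v → 𝟙 (f v ≟ t))))
      ≡⟨ Σ-cong ts (λ t → trans (cong (w t *_) (sym (Σ-product xs xs _ _))) (sym (trans (Σ-cong xs (λ u → Σ-*ˡ xs (w t) _)) (Σ-*ˡ xs (w t) _)))) ⟩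
    Σ ts (λ t → Σ xs (λ u → Σ xs (λ v → w t * (𝟙 (f u ≟ t) * 𝟙 (f v ≟ t)))))
      ≡⟨ trans (Σ-swap ts xs _) (Σ-cong xs (λ u → Σ-swap ts xs _)) ⟩
    Σ xs (λ u → Σ xs (λ v → Σ ts (λ t → w t * (𝟙 (f u ≟ t) * 𝟙 (f v ≟ t)))))
      ≡⟨ Σ-cong xs (λ u → Σ-cong xs (λ v → trans (Σ-cong ts (λ t → trans (rearrange (w t) (𝟙 (f u ≟ t)) (𝟙 (f v ≟ t)))
           (cong (_* (w t * 𝟙 (f v ≟ t))) (𝟙-cong (f u ≟ t) (t ≟ f u) sym sym)))) (Σ-pick _≟_ ts (f u) (once (f u)) (λ t → w t * 𝟙 (f v ≟ t))))) ⟩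
    Σ xs (λ u → Σ xs (λ v → w (f u) * 𝟙 (f v ≟ f u))) ∎
    where
    open ≡-Reasoning
    rearrange : ∀ a b c → a * (b * c) ≡ b * (a * c)
    rearrange = solve-∀

  module Differences (K : FiniteRing) (Es : List (FiniteRing.Carrier K)) where
    open FiniteRing K
    open IntegerCoefficients ring

    -- Kept with multiplicity: one entry for each ordered pair of points.
    diffs : List Carrier
    diffs = map (λ p → proj₁ p ⊕ ⊖ proj₂ p) (cartesianProduct Es Es)

    Σ-diffs : (f : Carrier → ℤ) → Σ diffs f ≡ Σ Es (λ x → Σ Es (λ y → f (x ⊕ ⊖ y)))
    Σ-diffs f = trans (Σ-map _ (cartesianProduct Es Es) f) (Σ-cartesianProduct Es Es _)

    Σ-diffs-1 : Σ diffs (λ _ → 1ℤ) ≡ + length Es * + length Es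
    Σ-diffs-1 = trans (Σ-diffs _) (trans (Σ-cong Es (λ _ → Σ-length Es)) (Σ-const Es (+ length Es)))

    Σ-diffs-0 : (∀ {x} → x ∈ Es → Once _≟_ Es x) → Σ diffs (λ u → 𝟙 (u ≟ 0#)) ≡ + length Es
    Σ-diffs-0 once-Es = trans (Σ-diffs _) (trans (Σ-cong-∈ Es (λ x x∈ → trans (Σ-cong Es (λ y → 𝟙-cong (x ⊕ ⊖ y ≟ 0#) (y ≟ x)
        (λ h → trans (solve 2 (λ x y → y := x :+ :- (x :+ :- y)) refl x y) (trans (cong (λ t → x ⊕ ⊖ t) h) (solve 1 (λ x → x :+ :- con 0ℤ := x) refl x)))
        (λ { refl → solve 1 (λ x → x :+ :- x := con 0ℤ) refl x }))) (once-Es x∈))) (Σ-length Es))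

  module EnergyOfDifferences (G : Geometry) (Es : List (Geometry.Carrier G))
    (dominated : (f : Geometry.Carrier G → ℤ) → (∀ x → 0ℤ ≤ f x) → Σ Es f ≤ Σ (Geometry.all G) f)
    (nonempty : 0ℤ < + length Es) where
    open Geometry G
    open Energy G Es dominated nonempty public using (m₁; m₂; N; m₁≥0; energy-bound)
    open Differences K Es public

    m₁≡ : m₁ ≡ Σ diffs π
    m₁≡ = sym (Σ-diffs π)

    -- With the sum over rotations innermost, the evaluation of `m₂` becomes a count of the
    -- rotations that relate two given differences.
    m₂≡ : m₂ ≡ Σ diffs (λ u → Σ diffs (λ v → Σ units (λ θ → π (u ⊕ θ ⊗ v))))
    m₂≡ = begin
      m₂  ≡⟨ Σ-cong units (λ θ → sym (trans (Σ-diffs _) (Σ-cong Es (λ x → Σ-cong Es (λ y → Σ-diffs _))))) ⟩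
      Σ units (λ θ → Σ diffs (λ u → Σ diffs (λ v → π (u ⊕ θ ⊗ v))))  ≡⟨ trans (Σ-swap units diffs _) (Σ-cong diffs (λ u → Σ-swap units diffs _)) ⟩
      Σ diffs (λ u → Σ diffs (λ v → Σ units (λ θ → π (u ⊕ θ ⊗ v))))  ∎
      where open ≡-Reasoning

  module Distances {q : ℕ} (F : FiniteField q) (q>0 : 0ℤ < + q) (E : FiniteField.Subset F) (nonempty : 0ℤ < + FiniteField.card F E) where
    open Plane F q>0 public

    E? : Decidable (λ x → E x ≡ true)
    E? x = E x Bool.≟ true

    Es : List Point
    Es = filter E? points

    n D : ℤ
    n = + length Es
    D = + FiniteField.cardΔ F E

    n≤Q² : n ≤ Q * Q
    n≤Q² = subst₂′ (Σ-length Es) size-points (Σ-filter-≤ E? points (λ _ → 1ℤ) (λ _ → +≤+ z≤n))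

    once-Es : ∀ {x} → x ∈ Es → Once _≟ₚ_ Es x
    once-Es {x} x∈ = Once-filter _≟ₚ_ E? points x (proj₂ (∈-filter⁻ E? {xs = points} x∈)) (once-points x)

    ∈points : ∀ {x} → x ∈ Es → x ∈ points
    ∈points x∈ = proj₁ (∈-filter⁻ E? {xs = points} x∈)

    E-true : ∀ {x} → x ∈ Es → E x ≡ true
    E-true x∈ = proj₂ (∈-filter⁻ E? {xs = points} x∈)

    ν : Carrier → ℤ
    ν t = Σ Es (λ x → Σ Es (λ y → 𝟙 (norm (x ⊕ₚ (⊖ₚ y)) ≟ t)))

    ν-support : ∀ t → FiniteField.Δ F E t ≢ true → ν t ≡ 0ℤ
    ν-support t t∉Δ = trans (Σ-cong-∈ Es (λ x x∈ → trans (Σ-cong-∈ Es (λ y y∈ → 𝟙-no (norm (x ⊕ₚ (⊖ₚ y)) ≟ t) (λ h → t∉Δ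
      (any-true _ (∈points x∈) (any-true (λ y → E x ∧ E y ∧ does (norm (x ⊕ₚ (⊖ₚ y)) ≟ t)) (∈points y∈)
        (cong₂ _∧_ (E-true x∈) (cong₂ _∧_ (E-true y∈) (does-true (norm (x ⊕ₚ (⊖ₚ y)) ≟ t) h)))))))) (Σ-zero Es))) (Σ-zero Es)

    -- Cauchy-Schwarz against the indicator of the distance set. It is stated for an arbitrary `g`
    -- supported there because the split case applies it to `ν` with distance zero removed.
    distance-Cauchy-Schwarz : (g : Carrier → ℤ) → (∀ t → FiniteField.Δ F E t ≢ true → g t ≡ 0ℤ) →
      Σ elems g * Σ elems g ≤ D * Σ elems (λ t → g t * g t)
    distance-Cauchy-Schwarz g supp = subst (_≤ D * Σ elems (λ t → g t * g t)) (cong (λ s → s * s) (Σ-cong elems restrict))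
      (subst (λ s → Σ elems (λ t → d t * g t) * Σ elems (λ t → d t * g t) ≤ s * Σ elems (λ t → g t * g t)) (trans (Σ-cong elems (λ t → square (Δ? t))) (𝟙-length Δ? elems))
        (Σ-Cauchy-Schwarz elems d g))
      where
      Δ? : Decidable (λ t → FiniteField.Δ F E t ≡ true)
      Δ? t = FiniteField.Δ F E t Bool.≟ true
      d : Carrier → ℤ
      d t = 𝟙 (Δ? t)
      square : {P : Set} (p : Dec P) → 𝟙 p * 𝟙 p ≡ 𝟙 p
      square (yes _) = refl
      square (no _)  = refl
      cases : {P : Set} (p : Dec P) (x : ℤ) → (¬ P → x ≡ 0ℤ) → 𝟙 p * x ≡ x
      cases (yes _) x h = *-identityˡ x
      cases (no ¬p) x h = sym (h ¬p)
      restrict : ∀ t → d t * g t ≡ g t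
      restrict t = cases (Δ? t) (g t) (supp t)

    module InertCount (no-root : ∀ i → i ⊗ i ≢ ⊖ 1#) where
      open Inert no-root
      open Geometry geometry using (units; ∈-units; Unit; once-units)
      open EnergyOfDifferences geometry Es (λ f f≥0 → Σ-filter-≤ E? points f f≥0) nonempty

      0ₚ 1ₚ : Point
      0ₚ = (0# , 0#)
      1ₚ = (1# , 0#)

      S : ℤ
      S = Σ elems (λ t → ν t * ν t)

      ν≡ : ∀ t → ν t ≡ Σ diffs (λ u → 𝟙 (norm u ≟ t))
      ν≡ t = sym (Σ-diffs (λ u → 𝟙 (norm u ≟ t)))

      S≡ : S ≡ Σ diffs (λ u → Σ diffs (λ v → 𝟙 (norm v ≟ norm u)))
      S≡ = trans (Σ-cong elems (λ t → trans (cong₂ _*_ (ν≡ t) (ν≡ t)) (sym (*-identityˡ _))))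
        (trans (Σ-fibres _≟_ elems once norm (λ _ → 1ℤ) diffs) (Σ-cong diffs (λ u → Σ-cong diffs (λ v → *-identityˡ _))))

      Σν : Σ elems ν ≡ n * n
      Σν = trans (Σ-cong elems ν≡) (trans (Σ-swap elems diffs _) (trans (Σ-cong diffs (λ u → trans (Σ-cong elems (λ t → 𝟙-cong (norm u ≟ t) (t ≟ norm u) sym sym)) (once (norm u)))) Σ-diffs-1))

      n⁴≤DS : n * n * (n * n) ≤ D * S
      n⁴≤DS = subst (λ s → s * s ≤ D * S) Σν (distance-Cauchy-Schwarz ν ν-support)

      open MeanZero K using (m; ρ)

      ρ≡ : ∀ u → ρ u ≡ Q * Q * 𝟙 (u ≟ₚ 0ₚ) - 1ℤ
      ρ≡ u = cong (λ s → s * 𝟙 (u ≟ₚ 0ₚ) - 1ℤ) size-points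

      m₁-value : m₁ ≡ Q * Q * n - n * n
      m₁-value = trans m₁≡ (trans (Σ-cong diffs ρ≡) (trans (Σ-- diffs _ _) (cong₂ _-_ (trans (Σ-*ˡ diffs (Q * Q) _) (cong (Q * Q *_) (Σ-diffs-0 once-Es))) Σ-diffs-1)))

      norm-unit : ∀ {θ} → Unit θ → norm θ ≡ 1#
      norm-unit {θ} u = cong proj₁ (trans (sym (conj-norm θ)) u)

      unit-norm : ∀ {θ} → norm θ ≡ 1# → Unit θ
      unit-norm {θ} h = trans (conj-norm θ) (cong (_, 0#) h)

      norm-0 : norm 0ₚ ≡ 0#
      norm-0 = solve 0 (con 0ℤ :* con 0ℤ :+ con 0ℤ :* con 0ℤ := con 0ℤ) refl

      norm-⊖ : ∀ v → norm (⊖ₚ v) ≡ norm v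
      norm-⊖ (a , b) = solve 2 (λ a b → :- a :* :- a :+ :- b :* :- b := a :* a :+ b :* b) refl a b

      -- the rotations taking v to - u
      rotations : ∀ u v → Σ units (λ θ → 𝟙 ((u ⊕ₚ (θ ⊗ₚ v)) ≟ₚ 0ₚ)) ≡ 𝟙 (norm v ≟ norm u) + (N - 1ℤ) * (𝟙 (u ≟ₚ 0ₚ) * 𝟙 (v ≟ₚ 0ₚ))
      rotations u v with v ≟ₚ 0ₚ
      ... | yes refl with u ≟ₚ 0ₚ
      ...   | yes refl = trans (Σ-cong units (λ θ → 𝟙-yes ((0ₚ ⊕ₚ (θ ⊗ₚ 0ₚ)) ≟ₚ 0ₚ) (trans (KR.+-identityˡ _) (KR.zeroʳ θ)))) (trans (Σ-length units)
               (trans (arith N) (cong (_+ (N - 1ℤ) * 1ℤ) (sym (𝟙-yes (norm 0ₚ ≟ norm 0ₚ) refl)))))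
               where arith : ∀ N → N ≡ 1ℤ + (N - 1ℤ) * 1ℤ
                     arith = solve-∀
      ...   | no u≢0 = trans (Σ-cong units (λ θ → 𝟙-no ((u ⊕ₚ (θ ⊗ₚ 0ₚ)) ≟ₚ 0ₚ) (λ h → u≢0 (trans (sym (trans (cong (u ⊕ₚ_) (KR.zeroʳ θ)) (KR.+-identityʳ u))) h))))
               (trans (Σ-zero units) (sym (cong₂ _+_ (𝟙-no (norm 0ₚ ≟ norm u) (λ h → u≢0 (anisotropic u (trans (sym h) norm-0)))) (*-zeroʳ (N - 1ℤ)))))
      rotations u v | no v≢0 = trans (unique (invertible v v≢0)) (sym (trans (cong (λ t → 𝟙 (norm v ≟ norm u) + (N - 1ℤ) * t) (*-zeroʳ (𝟙 (u ≟ₚ 0ₚ)))) (trans (cong (_+_ (𝟙 (norm v ≟ norm u))) (*-zeroʳ (N - 1ℤ))) (+-identityʳ _))))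
        where
        open ≡-Reasoning
        unique : (∃ λ v′ → v ⊗ₚ v′ ≡ 1ₚ) → Σ units (λ θ → 𝟙 ((u ⊕ₚ (θ ⊗ₚ v)) ≟ₚ 0ₚ)) ≡ 𝟙 (norm v ≟ norm u)
        unique (v′ , vv′≡1) = trans (Σ-cong units (λ θ → 𝟙-cong _ (θ ≟ₚ θ₀) (to θ) (from θ))) (count (norm v ≟ norm u))
          where
          θ₀ = (⊖ₚ u) ⊗ₚ v′
          θ₀v : θ₀ ⊗ₚ v ≡ ⊖ₚ u
          θ₀v = trans (KR.*-assoc (⊖ₚ u) v′ v) (trans (cong ((⊖ₚ u) ⊗ₚ_) (trans (KR.*-comm v′ v) vv′≡1)) (KR.*-identityʳ (⊖ₚ u)))
          to : ∀ θ → u ⊕ₚ (θ ⊗ₚ v) ≡ 0ₚ → θ ≡ θ₀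
          to θ h = begin
            θ  ≡⟨ KR.*-identityʳ θ ⟨
            θ ⊗ₚ 1ₚ  ≡⟨ cong (θ ⊗ₚ_) vv′≡1 ⟨
            θ ⊗ₚ (v ⊗ₚ v′)  ≡⟨ KR.*-assoc θ v v′ ⟨
            (θ ⊗ₚ v) ⊗ₚ v′  ≡⟨ cong (_⊗ₚ v′) (Geometry.neg-unique geometry u (θ ⊗ₚ v) h) ⟩
            θ₀  ∎
          from : ∀ θ → θ ≡ θ₀ → u ⊕ₚ (θ ⊗ₚ v) ≡ 0ₚ
          from θ refl = trans (cong (u ⊕ₚ_) θ₀v) (KR.-‿inverseʳ u)
          norm-product : norm θ₀ ⊗ norm v ≡ norm u
          norm-product = trans (sym (norm-⊗ θ₀ v)) (trans (cong norm θ₀v) (norm-⊖ u))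
          norm-v≢0 : norm v ≢ 0#
          norm-v≢0 h = v≢0 (anisotropic v h)
          count : (d : Dec (norm v ≡ norm u)) → Σ units (λ θ → 𝟙 (θ ≟ₚ θ₀)) ≡ 𝟙 d
          count (yes e) = once-units (unit-norm (cancel (norm-product)))
            where
            cancel : norm θ₀ ⊗ norm v ≡ norm u → norm θ₀ ≡ 1#
            cancel h with zero-product (norm θ₀ ⊕ ⊖ 1#) (norm v) (trans (solve 2 (λ a b → (a :+ :- con 1ℤ) :* b := a :* b :+ :- b) refl (norm θ₀) (norm v))
                            (trans (cong (_⊕ ⊖ norm v) (trans h (sym e))) (R.-‿inverseʳ (norm v))))
            ... | inj₁ d = ≡-from-difference d
            ... | inj₂ d = contradiction d norm-v≢0
          count (no ¬e) = trans (Σ-cong-∈ units (λ θ θ∈ → 𝟙-no (θ ≟ₚ θ₀) (λ { refl → ¬e (trans (sym (R.*-identityˡ (norm v)))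
                            (trans (cong (_⊗ norm v) (sym (norm-unit (∈-units θ∈)))) norm-product)) }))) (Σ-zero units)

      -- By anisotropy, differences of equal norm are related by exactly one rotation, except that
      -- all `N` rotations relate zero to zero. The `n²` pairs of zero differences, already counted
      -- once in `S`, account for `(N - 1) n²`.
      m₂-value : m₂ ≡ Q * Q * (S + (N - 1ℤ) * (n * n)) - N * (n * n * (n * n))
      m₂-value = begin
        m₂ ≡⟨ m₂≡ ⟩
        Σ diffs (λ u → Σ diffs (λ v → Σ units (λ θ → ρ (u ⊕ₚ (θ ⊗ₚ v)))))
          ≡⟨ Σ-cong diffs (λ u → Σ-cong diffs (λ v → trans (Σ-cong units (λ θ → ρ≡ (u ⊕ₚ (θ ⊗ₚ v)))) (trans (Σ-- units _ _)
               (cong₂ _-_ (trans (Σ-*ˡ units (Q * Q) _) (cong (Q * Q *_) (rotations u v))) (Σ-length units))))) ⟩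
        Σ diffs (λ u → Σ diffs (λ v → Q * Q * (𝟙 (norm v ≟ norm u) + (N - 1ℤ) * (𝟙 (u ≟ₚ 0ₚ) * 𝟙 (v ≟ₚ 0ₚ))) - N))
          ≡⟨ trans (Σ-cong diffs (λ u → Σ-- diffs _ _)) (Σ-- diffs _ _) ⟩
        Σ diffs (λ u → Σ diffs (λ v → Q * Q * (𝟙 (norm v ≟ norm u) + (N - 1ℤ) * (𝟙 (u ≟ₚ 0ₚ) * 𝟙 (v ≟ₚ 0ₚ))))) - Σ diffs (λ _ → Σ diffs (λ _ → N))
          ≡⟨ cong₂ _-_ (trans (Σ-cong diffs (λ u → Σ-*ˡ diffs (Q * Q) _)) (Σ-*ˡ diffs (Q * Q) _)) count ⟩
        Q * Q * Σ diffs (λ u → Σ diffs (λ v → 𝟙 (norm v ≟ norm u) + (N - 1ℤ) * (𝟙 (u ≟ₚ 0ₚ) * 𝟙 (v ≟ₚ 0ₚ)))) - N * (n * n * (n * n))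
          ≡⟨ cong (λ t → Q * Q * t - N * (n * n * (n * n))) (trans (Σ-cong diffs (λ u → Σ-+ diffs _ _)) (trans (Σ-+ diffs _ _) (cong₂ _+_ (sym S≡)
               (trans (Σ-cong diffs (λ u → Σ-*ˡ diffs (N - 1ℤ) _)) (trans (Σ-*ˡ diffs (N - 1ℤ) _) (cong ((N - 1ℤ) *_)
                 (trans (Σ-product diffs diffs _ _) (cong₂ _*_ (Σ-diffs-0 once-Es) (Σ-diffs-0 once-Es))))))))) ⟩
        Q * Q * (S + (N - 1ℤ) * (n * n)) - N * (n * n * (n * n)) ∎
        where
        open ≡-Reasoning
        length-diffs : + length diffs ≡ n * n
        length-diffs = trans (sym (Σ-length diffs)) Σ-diffs-1
        count : Σ diffs (λ _ → Σ diffs (λ _ → N)) ≡ N * (n * n * (n * n))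
        count = trans (Σ-const diffs _) (trans (cong (+ length diffs *_) (Σ-const diffs N)) (trans (cong (λ t → t * (t * N)) length-diffs) (arith n N)))
          where arith : ∀ n N → n * n * (n * n * N) ≡ N * (n * n * (n * n))
                arith = solve-∀

      -- Hilbert 90: a norm-one element other than -1 is (1 + ti)/(1 - ti) for some t.
      N≤Q+1 : N ≤ Q + 1ℤ
      N≤Q+1 = subst (_≤ Q + 1ℤ) (Σ-length units) (ℤₚ.≤-trans (Σ-mono-∈ units covered) (subst (_≤ Q + 1ℤ) (sym (Σ-+ units _ _))
        (+-mono-≤ (subst₂′ (Σ-swap elems units _) Σ-elems-1 (Σ-mono elems (λ t → at-most-once (param t)))) (at-most-once (⊖ₚ 1ₚ)))))
        where
        open ≡-Reasoning
        at-most-once : ∀ p → Σ units (λ z → 𝟙 (z ≟ₚ p)) ≤ 1ℤ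
        at-most-once p = subst (Σ units (λ z → 𝟙 (z ≟ₚ p)) ≤_) (once-points p) (Σ-filter-≤ _ points _ (λ z → 𝟙≥0 (z ≟ₚ p)))
        denominator : ∀ t → ∃ λ w → (1# , ⊖ t) ⊗ₚ w ≡ 1ₚ
        denominator t = invertible (1# , ⊖ t) (λ h → 0≢1 (sym (cong proj₁ h)))
        param : Carrier → Point
        param t = (1# , t) ⊗ₚ proj₁ (denominator t)
        term≥1 : (xs : List Carrier) (f : Carrier → ℤ) → (∀ x → 0ℤ ≤ f x) → ∀ x → Once _≟_ xs x → 1ℤ ≤ f x → 1ℤ ≤ Σ xs f
        term≥1 xs f f≥0 x once-x fx = ℤₚ.≤-trans fx (subst (_≤ Σ xs f) (Σ-pick _≟_ xs x once-x f)
          (Σ-mono xs (λ y → subst (𝟙 (y ≟ x) * f y ≤_) (*-identityˡ (f y)) (ℤₚ.*-monoʳ-≤-nonNeg (f y) {{ℤ.nonNegative (f≥0 y)}} (𝟙≤1 (y ≟ x))))))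
        covered : ∀ z → z ∈ units → 1ℤ ≤ Σ elems (λ t → 𝟙 (z ≟ₚ param t)) + 𝟙 (z ≟ₚ (⊖ₚ 1ₚ))
        covered (a , b) z∈ with (a ⊕ 1#) ≟ 0#
        ... | no a+1≢0 = ℤₚ.≤-trans (term≥1 elems _ (λ t → 𝟙≥0 ((a , b) ≟ₚ param t)) t (once t) (ℤₚ.≤-reflexive (sym (𝟙-yes ((a , b) ≟ₚ param t) z≡))))
              (i≤j+ (𝟙 ((a , b) ≟ₚ (⊖ₚ 1ₚ))) (𝟙≥0 ((a , b) ≟ₚ (⊖ₚ 1ₚ))) refl)
          where
          r = proj₁ (inverse (a ⊕ 1#) a+1≢0)
          -- The slope of the line through `(- 1 , 0)` and `(a , b)`.
          t = b ⊗ r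
          r-inv : (a ⊕ 1#) ⊗ r ≡ 1#
          r-inv = proj₂ (inverse (a ⊕ 1#) a+1≢0)
          b≡ : b ≡ t ⊗ (a ⊕ 1#)
          b≡ = trans (sym (R.*-identityʳ b)) (trans (cong (b ⊗_) (sym r-inv)) (solve 3 (λ b c r → b :* (c :* r) := b :* r :* c) refl b (a ⊕ 1#) r))
          first : a ⊗ 1# ⊕ ⊖ (b ⊗ ⊖ t) ≡ 1#
          first with zero-product (a ⊕ 1#) (a ⊕ b ⊗ t ⊕ ⊖ 1#) (begin
              (a ⊕ 1#) ⊗ (a ⊕ b ⊗ t ⊕ ⊖ 1#)
                ≡⟨ solve 3 (λ a b t → (a :+ con 1ℤ) :* (a :+ b :* t :+ :- con 1ℤ) := a :* a :+ b :* (t :* (a :+ con 1ℤ)) :+ :- con 1ℤ) refl a b t ⟩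
              a ⊗ a ⊕ b ⊗ (t ⊗ (a ⊕ 1#)) ⊕ ⊖ 1#
                ≡⟨ cong (λ s → a ⊗ a ⊕ b ⊗ s ⊕ ⊖ 1#) (sym b≡) ⟩
              norm (a , b) ⊕ ⊖ 1#
                ≡⟨ cong (_⊕ ⊖ 1#) (norm-unit (∈-units z∈)) ⟩
              1# ⊕ ⊖ 1#
                ≡⟨ R.-‿inverseʳ 1# ⟩
              0# ∎)
          ... | inj₁ e = contradiction e a+1≢0
          ... | inj₂ e = trans (solve 3 (λ a b t → a :* con 1ℤ :+ :- (b :* :- t) := a :+ b :* t) refl a b t) (≡-from-difference e)
          second : a ⊗ ⊖ t ⊕ b ⊗ 1# ≡ t
          second = trans (cong (λ s → a ⊗ ⊖ t ⊕ s ⊗ 1#) b≡) (solve 2 (λ a t → a :* :- t :+ t :* (a :+ con 1ℤ) :* con 1ℤ := t) refl a t)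
          z≡ : (a , b) ≡ param t
          z≡ = begin
            (a , b)  ≡⟨ KR.*-identityʳ (a , b) ⟨
            (a , b) ⊗ₚ 1ₚ  ≡⟨ cong ((a , b) ⊗ₚ_) (proj₂ (denominator t)) ⟨
            (a , b) ⊗ₚ ((1# , ⊖ t) ⊗ₚ proj₁ (denominator t))  ≡⟨ KR.*-assoc (a , b) (1# , ⊖ t) (proj₁ (denominator t)) ⟨
            ((a , b) ⊗ₚ (1# , ⊖ t)) ⊗ₚ proj₁ (denominator t)  ≡⟨ cong (_⊗ₚ proj₁ (denominator t)) (cong₂ _,_ first second) ⟩
            param t  ∎
        ... | yes a+1≡0 = ℤₚ.≤-trans (ℤₚ.≤-reflexive (sym (𝟙-yes ((a , b) ≟ₚ (⊖ₚ 1ₚ)) z≡-1)))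
              (i≤j+ (Σ elems (λ t → 𝟙 ((a , b) ≟ₚ param t))) (Σ≥0 elems (λ t → 𝟙≥0 ((a , b) ≟ₚ param t))) (+-comm (Σ elems (λ t → 𝟙 ((a , b) ≟ₚ param t))) _))
          where
          a≡-1 : a ≡ ⊖ 1#
          a≡-1 = ≡-from-difference (trans (cong (a ⊕_) (⊖⊖ 1#)) a+1≡0)
          b²≡0 : b ⊗ b ≡ 0#
          b²≡0 = begin
            b ⊗ b  ≡⟨ solve 2 (λ a b → b :* b := (a :* a :+ b :* b) :+ :- (a :* a)) refl a b ⟩
            norm (a , b) ⊕ ⊖ (a ⊗ a)  ≡⟨ cong₂ (λ s t → s ⊕ ⊖ (t ⊗ t)) (norm-unit (∈-units z∈)) a≡-1 ⟩
            1# ⊕ ⊖ (⊖ 1# ⊗ ⊖ 1#)  ≡⟨ solve 0 (con 1ℤ :+ :- (:- con 1ℤ :* :- con 1ℤ) := con 0ℤ) refl ⟩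
            0#  ∎
          z≡-1 : (a , b) ≡ ⊖ₚ 1ₚ
          z≡-1 with zero-product b b b²≡0
          ... | inj₁ e = cong₂ _,_ a≡-1 (trans e (solve 0 (con 0ℤ := :- con 0ℤ) refl))
          ... | inj₂ e = cong₂ _,_ a≡-1 (trans e (solve 0 (con 0ℤ := :- con 0ℤ) refl))

      inert-energy : m₂ * m₂ ≤ + 3 * (Q * Q) * (n * n * n) * ((Q * Q * n - n * n) * (Q * Q * n - n * n))
      inert-energy = subst (λ t → m₂ * m₂ ≤ + 3 * (Q * Q) * (n * n * n) * (t * t)) m₁-value energy-bound

  -- Counting in isotropic coordinates

  module SplitCount {q : ℕ} (F : FiniteField q) (q>0 : 0ℤ < + q) (E : FiniteField.Subset F) (nonempty : 0ℤ < + FiniteField.card F E)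
    (2≢0 : FiniteRing._⊕_ (Field.finiteRing F) (FiniteField.1# F) (FiniteField.1# F) ≢ FiniteField.0# F)
    (i : FiniteField.Carrier F) (i² : FiniteRing._⊗_ (Field.finiteRing F) i i ≡ FiniteRing.⊖_ (Field.finiteRing F) (FiniteField.1# F)) where
    open Distances F q>0 E nonempty
    open OddCharacteristic 2≢0 using (inv; inv-right; inverse-unique; unit≢0)
    open Split
    open Geometry geometry using (units; Unit; ∈-units; once-units)

    -- isotropic coordinates
    φ ψ : Point → Point
    φ (x , y) = (x ⊕ i ⊗ y , x ⊕ ⊖ (i ⊗ y))
    ψ (a , b) = (½ ⊗ (a ⊕ b) , ⊖ (½ ⊗ i) ⊗ (a ⊕ ⊖ b))
      where ½ = proj₁ (inverse (1# ⊕ 1#) 2≢0)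

    private
      ½ : Carrier
      ½ = proj₁ (inverse (1# ⊕ 1#) 2≢0)

      half : (1# ⊕ 1#) ⊗ ½ ≡ 1#
      half = proj₂ (inverse (1# ⊕ 1#) 2≢0)

      halves : ∀ x → (1# ⊕ 1#) ⊗ ½ ⊗ x ≡ x
      halves x = trans (cong (_⊗ x) half) (R.*-identityˡ x)

      minus-i² : ⊖ (i ⊗ i) ≡ 1#
      minus-i² = trans (cong ⊖_ i²) (⊖⊖ 1#)

    ψφ : ∀ p → ψ (φ p) ≡ p
    ψφ (x , y) = cong₂ _,_
      (trans (solve 4 (λ h x i y → h :* ((x :+ i :* y) :+ (x :+ :- (i :* y))) := (con 1ℤ :+ con 1ℤ) :* h :* x) refl ½ x i y) (halves x))
      (trans (solve 4 (λ h x i y → :- (h :* i) :* ((x :+ i :* y) :+ :- (x :+ :- (i :* y))) := (con 1ℤ :+ con 1ℤ) :* h :* (:- (i :* i) :* y)) refl ½ x i y)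
        (trans (halves _) (trans (cong (_⊗ y) minus-i²) (R.*-identityˡ y))))

    φψ : ∀ p → φ (ψ p) ≡ p
    φψ (a , b) = cong₂ _,_
      (begin
        ½ ⊗ (a ⊕ b) ⊕ i ⊗ (⊖ (½ ⊗ i) ⊗ (a ⊕ ⊖ b))
          ≡⟨ solve 4 (λ h a b i → h :* (a :+ b) :+ i :* (:- (h :* i) :* (a :+ :- b)) := h :* (a :+ b) :+ :- (i :* i) :* (h :* (a :+ :- b))) refl ½ a b i ⟩
        ½ ⊗ (a ⊕ b) ⊕ ⊖ (i ⊗ i) ⊗ (½ ⊗ (a ⊕ ⊖ b))
          ≡⟨ cong (λ t → ½ ⊗ (a ⊕ b) ⊕ t ⊗ (½ ⊗ (a ⊕ ⊖ b))) minus-i² ⟩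
        ½ ⊗ (a ⊕ b) ⊕ 1# ⊗ (½ ⊗ (a ⊕ ⊖ b))
          ≡⟨ solve 3 (λ h a b → h :* (a :+ b) :+ con 1ℤ :* (h :* (a :+ :- b)) := (con 1ℤ :+ con 1ℤ) :* h :* a) refl ½ a b ⟩
        (1# ⊕ 1#) ⊗ ½ ⊗ a ≡⟨ halves a ⟩
        a ∎)
      (begin
        ½ ⊗ (a ⊕ b) ⊕ ⊖ (i ⊗ (⊖ (½ ⊗ i) ⊗ (a ⊕ ⊖ b)))
          ≡⟨ solve 4 (λ h a b i → h :* (a :+ b) :+ :- (i :* (:- (h :* i) :* (a :+ :- b))) := h :* (a :+ b) :+ :- (:- (i :* i) :* (h :* (a :+ :- b)))) refl ½ a b i ⟩
        ½ ⊗ (a ⊕ b) ⊕ ⊖ (⊖ (i ⊗ i) ⊗ (½ ⊗ (a ⊕ ⊖ b)))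
          ≡⟨ cong (λ t → ½ ⊗ (a ⊕ b) ⊕ ⊖ (t ⊗ (½ ⊗ (a ⊕ ⊖ b)))) minus-i² ⟩
        ½ ⊗ (a ⊕ b) ⊕ ⊖ (1# ⊗ (½ ⊗ (a ⊕ ⊖ b)))
          ≡⟨ solve 3 (λ h a b → h :* (a :+ b) :+ :- (con 1ℤ :* (h :* (a :+ :- b))) := (con 1ℤ :+ con 1ℤ) :* h :* b) refl ½ a b ⟩
        (1# ⊕ 1#) ⊗ ½ ⊗ b ≡⟨ halves b ⟩
        b ∎)
      where open ≡-Reasoning

    φ-difference : ∀ x y → φ (x ⊕ₚ (⊖ₚ y)) ≡ φ x ⊕ₚ (⊖ₚ φ y)
    φ-difference (a , b) (c , d) = cong₂ _,_
      (solve 5 (λ a b c d i → (a :+ :- c) :+ i :* (b :+ :- d) := (a :+ i :* b) :+ :- (c :+ i :* d)) refl a b c d i)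
      (solve 5 (λ a b c d i → (a :+ :- c) :+ :- (i :* (b :+ :- d)) := (a :+ :- (i :* b)) :+ :- (c :+ :- (i :* d))) refl a b c d i)

    hnorm : Point → Carrier
    hnorm (a , b) = a ⊗ b

    hnorm-φ : ∀ p → hnorm (φ p) ≡ norm p
    hnorm-φ (x , y) = trans (solve 3 (λ x i y → (x :+ i :* y) :* (x :+ :- (i :* y)) := x :* x :+ :- (i :* i) :* (y :* y)) refl x i y)
      (trans (cong (λ t → x ⊗ x ⊕ t ⊗ (y ⊗ y)) minus-i²) (cong (x ⊗ x ⊕_) (R.*-identityˡ _)))

    Hs : List Point
    Hs = map φ Es

    length-Hs : + length Hs ≡ n
    length-Hs = cong +_ (Listₚ.length-map φ Es)

    Σ-φ : (f : Point → ℤ) → Σ points (λ x → f (φ x)) ≡ Σ points f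
    Σ-φ = Σ-bijection _≟ₚ_ _≟ₚ_ points points φ ψ (λ x _ → once-points (φ x)) (λ x _ → once-points (ψ x)) (λ x _ → ψφ x) (λ x _ → φψ x)

    open EnergyOfDifferences geometry Hs
      (λ f f≥0 → subst₂′ (sym (Σ-map φ Es f)) (Σ-φ f) (Σ-filter-≤ E? points (λ x → f (φ x)) (λ x → f≥0 (φ x))))
      (subst (0ℤ <_) (sym length-Hs) nonempty)
      public using (m₁; m₂; m₁≡; m₂≡; N; m₁≥0; energy-bound; diffs; Σ-diffs; Σ-diffs-1; Σ-diffs-0)

    diffs-1 : Σ diffs (λ _ → 1ℤ) ≡ n * n
    diffs-1 = trans Σ-diffs-1 (cong (λ t → t * t) length-Hs)

    once-Hs : ∀ {p} → p ∈ Hs → Once _≟ₚ_ Hs p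
    once-Hs {p} p∈ with ∈-map⁻ φ p∈
    ... | x , x∈ , refl = trans (Σ-map φ Es _) (trans (Σ-cong Es (λ y → 𝟙-cong (φ y ≟ₚ φ x) (y ≟ₚ x)
      (λ h → trans (sym (ψφ y)) (trans (cong ψ h) (ψφ x))) (cong φ))) (once-Es x∈))

    0ₚ : Point
    0ₚ = (0# , 0#)

    diffs-0 : Σ diffs (λ u → 𝟙 (u ≟ₚ 0ₚ)) ≡ n
    diffs-0 = trans (Σ-diffs-0 once-Hs) length-Hs

    [_] : Carrier → ℤ
    [ a ] = 𝟙 (a ≟ 0#)

    -- Ordered pairs of points on a common isotropic line, one count for each direction, with the
    -- diagonal included.
    C₁ C₂ : ℤ
    C₁ = Σ diffs (λ u → [ proj₁ u ])
    C₂ = Σ diffs (λ u → [ proj₂ u ])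

    -- The `n` points are distributed over the `Q` parallel lines on which `π` is constant;
    -- Cauchy-Schwarz over these lines bounds the pairs on a common line from below.
    coincidences : (π : Point → Carrier) → (∀ x y → π (x ⊕ₚ (⊖ₚ y)) ≡ π x ⊕ ⊖ π y) →
      n * n ≤ Q * Σ diffs (λ u → [ π u ])
    coincidences π π-difference = subst₂′ (cong (λ s → s * s) total) (cong₂ _*_ Σ-elems-1 squares) (Σ-Cauchy-Schwarz elems (λ _ → 1ℤ) r)
      where
      r : Carrier → ℤ
      r c = Σ Hs (λ x → 𝟙 (π x ≟ c))
      total : Σ elems (λ c → 1ℤ * r c) ≡ n
      total = trans (Σ-cong elems (λ c → *-identityˡ (r c))) (trans (Σ-swap elems Hs _) (trans (Σ-cong Hs (λ x →
        trans (Σ-cong elems (λ c → 𝟙-cong (π x ≟ c) (c ≟ π x) sym sym)) (once (π x)))) (trans (Σ-length Hs) length-Hs)))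
      squares : Σ elems (λ c → r c * r c) ≡ Σ diffs (λ u → [ π u ])
      squares = trans (Σ-cong elems (λ c → sym (*-identityˡ (r c * r c)))) (trans (Σ-fibres _≟_ elems once π (λ _ → 1ℤ) Hs)
        (trans (Σ-cong Hs (λ x → Σ-cong Hs (λ y → trans (*-identityˡ _) (𝟙-cong (π y ≟ π x) (π (x ⊕ₚ (⊖ₚ y)) ≟ 0#)
          (λ h → trans (π-difference x y) (trans (cong (λ t → π x ⊕ ⊖ t) h) (R.-‿inverseʳ (π x))))
          (λ h → sym (≡-from-difference (trans (sym (π-difference x y)) h))))))) (sym (Σ-diffs (λ u → [ π u ])))))

    n²≤QC₁ : n * n ≤ Q * C₁
    n²≤QC₁ = coincidences proj₁ (λ _ _ → refl)

    n²≤QC₂ : n * n ≤ Q * C₂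
    n²≤QC₂ = coincidences proj₂ (λ _ _ → refl)

    [,] : ∀ u → 𝟙 (u ≟ₚ 0ₚ) ≡ [ proj₁ u ] * [ proj₂ u ]
    [,] (a , b) = 𝟙-point a b 0# 0#

    diffs-both : Σ diffs (λ u → [ proj₁ u ] * [ proj₂ u ]) ≡ n
    diffs-both = trans (Σ-cong diffs (λ u → sym ([,] u))) diffs-0

    open MeanZero finiteRing using (m; ρ)

    π≡ : ∀ a b → ρ a * ρ b ≡ Q * Q * ([ a ] * [ b ]) - Q * [ a ] - Q * [ b ] + 1ℤ
    π≡ a b = trans (cong (λ s → (s * [ a ] - 1ℤ) * (s * [ b ] - 1ℤ)) Σ-elems-1) (expand Q [ a ] [ b ])
      where expand : ∀ q a b → (q * a - 1ℤ) * (q * b - 1ℤ) ≡ q * q * (a * b) - q * a - q * b + 1ℤ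
            expand = solve-∀

    Σ-expansion : {I : Set} (xs : List I) (c x : ℤ) (f g h : I → ℤ) →
      Σ xs (λ j → c * f j - x * g j - x * h j + 1ℤ) ≡ c * Σ xs f - x * Σ xs g - x * Σ xs h + Σ xs (λ _ → 1ℤ)
    Σ-expansion xs c x f g h = trans (Σ-+ xs _ _) (cong (_+ Σ xs (λ _ → 1ℤ)) (trans (Σ-- xs _ _) (cong₂ _-_
      (trans (Σ-- xs _ _) (cong₂ _-_ (Σ-*ˡ xs c f) (Σ-*ˡ xs x g))) (Σ-*ˡ xs x h))))

    m₁-value : m₁ ≡ Q * Q * n - Q * C₁ - Q * C₂ + n * n
    m₁-value = trans m₁≡ (trans (Σ-cong diffs (λ { (a , b) → π≡ a b })) (trans (Σ-expansion diffs (Q * Q) Q _ _ _)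
      (cong₂ (λ s t → Q * Q * s - Q * C₁ - Q * C₂ + t) diffs-both diffs-1)))

    nonzero? : Decidable (λ x → x ≢ 0#)
    nonzero? x = ¬? (x ≟ 0#)

    nonzero : List Carrier
    nonzero = filter nonzero? elems

    ∈nonzero : ∀ {x} → x ∈ nonzero → x ≢ 0#
    ∈nonzero x∈ = proj₂ (∈-filter⁻ nonzero? {xs = elems} x∈)

    once-nonzero : ∀ {x} → x ≢ 0# → Once _≟_ nonzero x
    once-nonzero {x} x≢0 = Once-filter _≟_ nonzero? elems x x≢0 (once x)

    inv≢0 : ∀ {x} → x ≢ 0# → inv x ≢ 0#
    inv≢0 {x} x≢0 = unit≢0 (trans (R.*-comm (inv x) x) (inv-right x≢0))

    inv-inv : ∀ {x} → x ≢ 0# → inv (inv x) ≡ x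
    inv-inv {x} x≢0 = inverse-unique (inv-right (inv≢0 x≢0)) (trans (R.*-comm (inv x) x) (inv-right x≢0))

    -- The rotations form the hyperbola `a b = 1`, parametrised by its first coordinate.
    Σ-units : (f : Point → ℤ) → Σ units f ≡ Σ nonzero (λ c → f (c , inv c))
    Σ-units f = sym (Σ-bijection _≟_ _≟ₚ_ nonzero units (λ c → (c , inv c)) proj₁
      (λ c c∈ → once-units (cong₂ _,_ (inv-right (∈nonzero c∈)) (trans (R.*-comm (inv c) c) (inv-right (∈nonzero c∈)))))
      (λ z z∈ → once-nonzero (unit≢0 (cong proj₁ (∈-units z∈)))) (λ _ _ → refl)
      (λ { (a , b) z∈ → cong (a ,_) (inverse-unique (inv-right (unit≢0 (cong proj₁ (∈-units z∈)))) (cong proj₁ (∈-units z∈))) }) f)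

    Σ-nonzero-inv : (f : Carrier → ℤ) → Σ nonzero (λ c → f (inv c)) ≡ Σ nonzero f
    Σ-nonzero-inv = Σ-bijection _≟_ _≟_ nonzero nonzero inv inv (λ c c∈ → once-nonzero (inv≢0 (∈nonzero c∈))) (λ c c∈ → once-nonzero (inv≢0 (∈nonzero c∈)))
      (λ c c∈ → inv-inv (∈nonzero c∈)) (λ c c∈ → inv-inv (∈nonzero c∈))

    Σ-nonzero-1 : Σ nonzero (λ _ → 1ℤ) ≡ Q - 1ℤ
    Σ-nonzero-1 = trans (Σ-filter nonzero? elems (λ _ → 1ℤ)) (trans (Σ-cong elems complement) (trans (Σ-- elems _ _) (cong₂ _-_ Σ-elems-1 (once 0#))))
      where
      complement : ∀ x → 𝟙 (nonzero? x) * 1ℤ ≡ 1ℤ - 𝟙 (x ≟ 0#)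
      complement x with x ≟ 0#
      ... | yes _ = refl
      ... | no _  = refl

    module Solution {r : Carrier} (r≢0 : r ≢ 0#) (p : Carrier) where
      root : Carrier
      root = ⊖ p ⊗ inv r

      root-⊗ : root ⊗ r ≡ ⊖ p
      root-⊗ = trans (solve 3 (λ p s r → :- p :* s :* r := :- p :* (r :* s)) refl p (inv r) r) (trans (cong (⊖ p ⊗_) (inv-right r≢0)) (R.*-identityʳ (⊖ p)))

      to : ∀ c → p ⊕ c ⊗ r ≡ 0# → c ≡ root
      to c h = begin
        c  ≡⟨ R.*-identityʳ c ⟨
        c ⊗ 1#  ≡⟨ cong (c ⊗_) (inv-right r≢0) ⟨
        c ⊗ (r ⊗ inv r)  ≡⟨ solve 4 (λ c r s p → c :* (r :* s) := (p :+ c :* r) :* s :+ :- p :* s) refl c r (inv r) p ⟩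
        (p ⊕ c ⊗ r) ⊗ inv r ⊕ root ≡⟨ cong (λ t → t ⊗ inv r ⊕ root) h ⟩
        0# ⊗ inv r ⊕ root  ≡⟨ trans (cong (_⊕ root) (R.zeroˡ (inv r))) (R.+-identityˡ root) ⟩
        root  ∎
        where open ≡-Reasoning

      from : ∀ c → c ≡ root → p ⊕ c ⊗ r ≡ 0#
      from c refl = trans (cong (p ⊕_) root-⊗) (R.-‿inverseʳ p)

      root≢0 : p ≢ 0# → root ≢ 0#
      root≢0 p≢0 h = p≢0 (trans (sym (⊖⊖ p)) (trans (cong ⊖_ (trans (sym root-⊗) (trans (cong (_⊗ r) h) (R.zeroˡ r)))) (solve 0 (:- con 0ℤ := con 0ℤ) refl)))

    -- Nonzero `p` and `r` are related by exactly one scalar, zero and zero by all `Q - 1`, and a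
    -- mixed pair by none.
    dilations : Carrier → Carrier → ℤ
    dilations p r = (1ℤ - [ p ]) * (1ℤ - [ r ]) + (Q - 1ℤ) * ([ p ] * [ r ])

    count-dilations : ∀ p r → Σ nonzero (λ c → [ p ⊕ c ⊗ r ]) ≡ dilations p r
    count-dilations p r = by (p ≟ 0#) (r ≟ 0#)
      where
      value : ∀ {x y} → [ p ] ≡ x → [ r ] ≡ y → dilations p r ≡ (1ℤ - x) * (1ℤ - y) + (Q - 1ℤ) * (x * y)
      value e f = cong₂ (λ x y → (1ℤ - x) * (1ℤ - y) + (Q - 1ℤ) * (x * y)) e f
      simplify₀₀ : ∀ q → (1ℤ - 0ℤ) * (1ℤ - 0ℤ) + (q - 1ℤ) * (0ℤ * 0ℤ) ≡ 1ℤ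
      simplify₀₀ = solve-∀
      simplify₀₁ : ∀ q → (1ℤ - 0ℤ) * (1ℤ - 1ℤ) + (q - 1ℤ) * (0ℤ * 1ℤ) ≡ 0ℤ
      simplify₀₁ = solve-∀
      simplify₁₀ : ∀ q → (1ℤ - 1ℤ) * (1ℤ - 0ℤ) + (q - 1ℤ) * (1ℤ * 0ℤ) ≡ 0ℤ
      simplify₁₀ = solve-∀
      simplify₁₁ : ∀ q → (1ℤ - 1ℤ) * (1ℤ - 1ℤ) + (q - 1ℤ) * (1ℤ * 1ℤ) ≡ q - 1ℤ
      simplify₁₁ = solve-∀
      sum-zero : ∀ {c} → r ≡ 0# → p ⊕ c ⊗ r ≡ p
      sum-zero {c} refl = trans (cong (p ⊕_) (R.zeroʳ c)) (R.+-identityʳ p)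
      by : Dec (p ≡ 0#) → Dec (r ≡ 0#) → Σ nonzero (λ c → [ p ⊕ c ⊗ r ]) ≡ dilations p r
      by (yes p≡0) (yes r≡0) = trans (Σ-cong nonzero (λ c → 𝟙-yes (p ⊕ c ⊗ r ≟ 0#) (trans (sum-zero r≡0) p≡0)))
        (trans Σ-nonzero-1 (sym (trans (value (𝟙-yes (p ≟ 0#) p≡0) (𝟙-yes (r ≟ 0#) r≡0)) (simplify₁₁ Q))))
      by (no p≢0) (yes r≡0) = trans (Σ-cong nonzero (λ c → 𝟙-no (p ⊕ c ⊗ r ≟ 0#) (λ h → p≢0 (trans (sym (sum-zero r≡0)) h))))
        (trans (Σ-zero nonzero) (sym (trans (value (𝟙-no (p ≟ 0#) p≢0) (𝟙-yes (r ≟ 0#) r≡0)) (simplify₀₁ Q))))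
      by (yes p≡0) (no r≢0) = trans (Σ-cong-∈ nonzero (λ c c∈ → 𝟙-no (p ⊕ c ⊗ r ≟ 0#) (λ h → impossible c∈
          (zero-product c r (trans (sym (R.+-identityˡ _)) (trans (cong (_⊕ c ⊗ r) (sym p≡0)) h))))))
        (trans (Σ-zero nonzero) (sym (trans (value (𝟙-yes (p ≟ 0#) p≡0) (𝟙-no (r ≟ 0#) r≢0)) (simplify₁₀ Q))))
        where impossible : ∀ {c} → c ∈ nonzero → c ≡ 0# ⊎ r ≡ 0# → ⊥
              impossible c∈ (inj₁ e) = ∈nonzero c∈ e
              impossible c∈ (inj₂ e) = r≢0 e
      by (no p≢0) (no r≢0) = trans (Σ-cong nonzero (λ c → 𝟙-cong (p ⊕ c ⊗ r ≟ 0#) (c ≟ root) (to c) (from c)))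
        (trans (once-nonzero (root≢0 p≢0)) (sym (trans (value (𝟙-no (p ≟ 0#) p≢0) (𝟙-no (r ≟ 0#) r≢0)) (simplify₀₀ Q))))
        where
        open Solution r≢0 p

    -- One term per type of orbit of the rotation group: hyperbolas, the two punctured axes, and the
    -- origin. The group acts freely on the first two types and on each axis transitively, so each
    -- related pair there counts once; the origin is fixed by all `Q - 1` rotations.
    rotations : Point → Point → ℤ
    rotations (p , r) (p′ , r′) = (1ℤ - 𝟙 (p ⊗ r ≟ 0#)) * 𝟙 (p′ ⊗ r′ ≟ p ⊗ r)
      + ([ p ] - [ p ] * [ r ]) * ([ p′ ] - [ p′ ] * [ r′ ]) + ([ r ] - [ p ] * [ r ]) * ([ r′ ] - [ p′ ] * [ r′ ])
      + (Q - 1ℤ) * ([ p ] * [ r ] * ([ p′ ] * [ r′ ]))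

    private
      product-zeroˡ : ∀ {x y} → x ≡ 0# → x ⊗ y ≡ 0#
      product-zeroˡ {y = y} refl = R.zeroˡ y
      product-zeroʳ : ∀ {x y} → y ≡ 0# → x ⊗ y ≡ 0#
      product-zeroʳ {x} refl = R.zeroʳ x
      product≢0 : ∀ {x y} → x ≢ 0# → y ≢ 0# → x ⊗ y ≢ 0#
      product≢0 {x} {y} x≢0 y≢0 h with zero-product x y h
      ... | inj₁ e = x≢0 e
      ... | inj₂ e = y≢0 e

    count-rotations : ∀ u v → Σ nonzero (λ c → [ proj₁ u ⊕ c ⊗ proj₁ v ] * [ proj₂ u ⊕ inv c ⊗ proj₂ v ]) ≡ rotations u v
    count-rotations (p , r) (p′ , r′) = by (p ≟ 0#) (p′ ≟ 0#)
      where
      open ≡-Reasoning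
      goal = Σ nonzero (λ c → [ p ⊕ c ⊗ p′ ] * [ r ⊕ inv c ⊗ r′ ])
      value : ∀ {x x′ z} → [ p ] ≡ x → [ p′ ] ≡ x′ → 𝟙 (p ⊗ r ≟ 0#) ≡ z → rotations (p , r) (p′ , r′) ≡
        (1ℤ - z) * 𝟙 (p′ ⊗ r′ ≟ p ⊗ r) + (x - x * [ r ]) * (x′ - x′ * [ r′ ]) + ([ r ] - x * [ r ]) * ([ r′ ] - x′ * [ r′ ]) + (Q - 1ℤ) * (x * [ r ] * (x′ * [ r′ ]))
      value refl refl refl = refl
      simplify₁₁ : ∀ q s a b → (1ℤ - 1ℤ) * s + (1ℤ - 1ℤ * a) * (1ℤ - 1ℤ * b) + (a - 1ℤ * a) * (b - 1ℤ * b) + (q - 1ℤ) * (1ℤ * a * (1ℤ * b))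
        ≡ (1ℤ - a) * (1ℤ - b) + (q - 1ℤ) * (a * b)
      simplify₁₁ = solve-∀
      simplify₁₀ : ∀ q s a b → (1ℤ - 1ℤ) * s + (1ℤ - 1ℤ * a) * (0ℤ - 0ℤ * b) + (a - 1ℤ * a) * (b - 0ℤ * b) + (q - 1ℤ) * (1ℤ * a * (0ℤ * b)) ≡ 0ℤ
      simplify₁₀ = solve-∀
      simplify₀₁ : ∀ q s z a b → (1ℤ - z) * s + (0ℤ - 0ℤ * a) * (1ℤ - 1ℤ * b) + (a - 0ℤ * a) * (b - 1ℤ * b) + (q - 1ℤ) * (0ℤ * a * (1ℤ * b)) ≡ (1ℤ - z) * s
      simplify₀₁ = solve-∀
      simplify₀₀ : ∀ q s z a b → (1ℤ - z) * s + (0ℤ - 0ℤ * a) * (0ℤ - 0ℤ * b) + (a - 0ℤ * a) * (b - 0ℤ * b) + (q - 1ℤ) * (0ℤ * a * (0ℤ * b)) ≡ (1ℤ - z) * s + a * b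
      simplify₀₀ = solve-∀
      by : Dec (p ≡ 0#) → Dec (p′ ≡ 0#) → goal ≡ rotations (p , r) (p′ , r′)
      by (yes p≡0) (yes p′≡0) = trans (Σ-cong nonzero (λ c → trans (cong (_* [ r ⊕ inv c ⊗ r′ ]) (𝟙-yes (p ⊕ c ⊗ p′ ≟ 0#)
          (trans (cong₂ _⊕_ p≡0 (product-zeroʳ p′≡0)) (R.+-identityˡ 0#)))) (*-identityˡ _)))
        (trans (trans (Σ-nonzero-inv (λ c → [ r ⊕ c ⊗ r′ ])) (count-dilations r r′))
          (sym (trans (value (𝟙-yes (p ≟ 0#) p≡0) (𝟙-yes (p′ ≟ 0#) p′≡0) (𝟙-yes (p ⊗ r ≟ 0#) (product-zeroˡ p≡0))) (simplify₁₁ Q (𝟙 (p′ ⊗ r′ ≟ p ⊗ r)) [ r ] [ r′ ]))))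
      by (yes p≡0) (no p′≢0) = trans (Σ-cong-∈ nonzero (λ c c∈ → cong (_* [ r ⊕ inv c ⊗ r′ ]) (𝟙-no (p ⊕ c ⊗ p′ ≟ 0#)
          (λ h → product≢0 (∈nonzero c∈) p′≢0 (trans (sym (R.+-identityˡ _)) (trans (cong (_⊕ c ⊗ p′) (sym p≡0)) h))))))
        (trans (Σ-zero nonzero) (sym (trans (value (𝟙-yes (p ≟ 0#) p≡0) (𝟙-no (p′ ≟ 0#) p′≢0) (𝟙-yes (p ⊗ r ≟ 0#) (product-zeroˡ p≡0))) (simplify₁₀ Q (𝟙 (p′ ⊗ r′ ≟ p ⊗ r)) [ r ] [ r′ ]))))
      by (no p≢0) (yes p′≡0) = trans (Σ-cong nonzero (λ c → cong (_* [ r ⊕ inv c ⊗ r′ ]) (𝟙-no (p ⊕ c ⊗ p′ ≟ 0#)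
          (λ h → p≢0 (trans (sym (trans (cong (p ⊕_) (product-zeroʳ {c} p′≡0)) (R.+-identityʳ p))) h)))))
        (trans (Σ-zero nonzero) (sym (trans (value (𝟙-no (p ≟ 0#) p≢0) (𝟙-yes (p′ ≟ 0#) p′≡0) refl) (trans (simplify₀₁ Q (𝟙 (p′ ⊗ r′ ≟ p ⊗ r)) (𝟙 (p ⊗ r ≟ 0#)) [ r ] [ r′ ]) (vanish (p ⊗ r ≟ 0#))))))
        where
        vanish : (d : Dec (p ⊗ r ≡ 0#)) → (1ℤ - 𝟙 d) * 𝟙 (p′ ⊗ r′ ≟ p ⊗ r) ≡ 0ℤ
        vanish (yes _) = refl
        vanish (no h)  = trans (*-identityˡ _) (𝟙-no (p′ ⊗ r′ ≟ p ⊗ r) (λ e → h (trans (sym e) (product-zeroˡ p′≡0))))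
      by (no p≢0) (no p′≢0) = trans (Σ-cong nonzero (λ c → cong (_* [ r ⊕ inv c ⊗ r′ ]) (𝟙-cong (p ⊕ c ⊗ p′ ≟ 0#) (c ≟ c₀) (to c) (from c))))
        (trans (Σ-pick _≟_ nonzero c₀ (once-nonzero c₀≢0) (λ c → [ r ⊕ inv c ⊗ r′ ]))
          (sym (trans (value (𝟙-no (p ≟ 0#) p≢0) (𝟙-no (p′ ≟ 0#) p′≢0) refl) (trans (simplify₀₀ Q (𝟙 (p′ ⊗ r′ ≟ p ⊗ r)) (𝟙 (p ⊗ r ≟ 0#)) [ r ] [ r′ ]) (match (p ⊗ r ≟ 0#) (r ≟ 0#))))))
        where
        open Solution p′≢0 p renaming (root to c₀; root-⊗ to c₀p′)
        c₀≢0 = root≢0 p≢0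
        k = inv c₀
        p′≡-pk : p′ ≡ ⊖ (p ⊗ k)
        p′≡-pk = begin
          p′  ≡⟨ R.*-identityˡ p′ ⟨
          1# ⊗ p′  ≡⟨ cong (_⊗ p′) (inv-right c₀≢0) ⟨
          c₀ ⊗ k ⊗ p′  ≡⟨ solve 3 (λ c k p → c :* k :* p := c :* p :* k) refl c₀ k p′ ⟩
          c₀ ⊗ p′ ⊗ k  ≡⟨ cong (_⊗ k) c₀p′ ⟩
          ⊖ p ⊗ k  ≡⟨ solve 2 (λ p k → :- p :* k := :- (p :* k)) refl p k ⟩
          ⊖ (p ⊗ k)  ∎
        -- The first coordinate forces `c = c₀`. Multiplied by the nonzero `p`, the remaining
        -- equation in the second coordinate says that the two products of coordinates agree.
        identity : p ⊗ (r ⊕ k ⊗ r′) ≡ p ⊗ r ⊕ ⊖ (p′ ⊗ r′)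
        identity = trans (solve 4 (λ p r k s → p :* (r :+ k :* s) := p :* r :+ :- (:- (p :* k) :* s)) refl p r k r′) (cong (λ t → p ⊗ r ⊕ ⊖ (t ⊗ r′)) (sym p′≡-pk))
        forward : r ⊕ k ⊗ r′ ≡ 0# → p′ ⊗ r′ ≡ p ⊗ r
        forward h = sym (≡-from-difference (trans (sym identity) (product-zeroʳ h)))
        backward : p′ ⊗ r′ ≡ p ⊗ r → r ⊕ k ⊗ r′ ≡ 0#
        backward h with zero-product p (r ⊕ k ⊗ r′) (trans identity (trans (cong (λ t → p ⊗ r ⊕ ⊖ t) h) (R.-‿inverseʳ (p ⊗ r))))
        ... | inj₁ e = contradiction e p≢0
        ... | inj₂ e = e
        match : (d : Dec (p ⊗ r ≡ 0#)) (e : Dec (r ≡ 0#)) → (1ℤ - 𝟙 d) * 𝟙 (p′ ⊗ r′ ≟ p ⊗ r) + 𝟙 e * [ r′ ] ≡ [ r ⊕ k ⊗ r′ ]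
        match (yes pr≡0) (yes r≡0) = trans (+-identityˡ (1ℤ * [ r′ ])) (trans (*-identityˡ _) (𝟙-cong (r′ ≟ 0#) (r ⊕ k ⊗ r′ ≟ 0#)
          (λ h → backward (trans (product-zeroʳ h) (sym pr≡0))) (λ h → cases (zero-product p′ r′ (trans (forward h) pr≡0)))))
          where cases : p′ ≡ 0# ⊎ r′ ≡ 0# → r′ ≡ 0#
                cases (inj₁ e) = contradiction e p′≢0
                cases (inj₂ e) = e
        match (yes pr≡0) (no r≢0)  = contradiction pr≡0 (product≢0 p≢0 r≢0)
        match (no pr≢0)  (yes r≡0) = contradiction (product-zeroʳ r≡0) pr≢0
        match (no pr≢0)  (no r≢0)  = trans (+-identityʳ (1ℤ * 𝟙 (p′ ⊗ r′ ≟ p ⊗ r))) (trans (*-identityˡ _) (𝟙-cong (p′ ⊗ r′ ≟ p ⊗ r) (r ⊕ k ⊗ r′ ≟ 0#) backward forward))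

    -- Distance zero is discarded: its multiplicity is governed by the isotropic lines, that is by
    -- `C₁` and `C₂`, and the hyperbola term of `rotations` excludes it as well.
    g : Carrier → ℤ
    g t = (1ℤ - [ t ]) * ν t

    P S : ℤ
    P = Σ elems g
    S = Σ elems (λ t → g t * g t)

    P²≤DS : P * P ≤ D * S
    P²≤DS = distance-Cauchy-Schwarz g (λ t t∉Δ → trans (cong ((1ℤ - [ t ]) *_) (ν-support t t∉Δ)) (*-zeroʳ (1ℤ - [ t ])))

    ν≡ : ∀ t → ν t ≡ Σ diffs (λ u → 𝟙 (hnorm u ≟ t))
    ν≡ t = sym (trans (Σ-diffs _) (trans (Σ-map φ Es _) (Σ-cong Es (λ x → trans (Σ-map φ Es _) (Σ-cong Es (λ y →
      cong (λ s → 𝟙 (s ≟ t)) (trans (cong hnorm (sym (φ-difference x y))) (hnorm-φ (x ⊕ₚ (⊖ₚ y))))))))))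

    [⊗] : ∀ a b → 1ℤ - [ a ⊗ b ] ≡ 1ℤ - [ a ] - [ b ] + [ a ] * [ b ]
    [⊗] a b = by (a ≟ 0#) (b ≟ 0#)
      where
      by : (d : Dec (a ≡ 0#)) (e : Dec (b ≡ 0#)) → 1ℤ - [ a ⊗ b ] ≡ 1ℤ - 𝟙 d - 𝟙 e + 𝟙 d * 𝟙 e
      by (yes a≡0) (yes _)   = cong (λ t → 1ℤ - t) (𝟙-yes (a ⊗ b ≟ 0#) (product-zeroˡ a≡0))
      by (yes a≡0) (no _)  = cong (λ t → 1ℤ - t) (𝟙-yes (a ⊗ b ≟ 0#) (product-zeroˡ a≡0))
      by (no _)  (yes b≡0) = cong (λ t → 1ℤ - t) (𝟙-yes (a ⊗ b ≟ 0#) (product-zeroʳ b≡0))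
      by (no a≢0)  (no b≢0)  = cong (λ t → 1ℤ - t) (𝟙-no (a ⊗ b ≟ 0#) (product≢0 a≢0 b≢0))

    -- Inclusion-exclusion: a difference has norm zero when it lies on one of the two axes, and the
    -- `n` zero differences lie on both.
    P-value : P ≡ n * n - C₁ - C₂ + n
    P-value = begin
      Σ elems (λ t → (1ℤ - [ t ]) * ν t)
        ≡⟨ Σ-cong elems (λ t → trans (cong ((1ℤ - [ t ]) *_) (ν≡ t)) (sym (Σ-*ˡ diffs (1ℤ - [ t ]) _))) ⟩
      Σ elems (λ t → Σ diffs (λ u → (1ℤ - [ t ]) * 𝟙 (hnorm u ≟ t)))
        ≡⟨ trans (Σ-swap elems diffs _) (Σ-cong diffs (λ u → trans (Σ-cong elems (λ t → trans (*-comm (1ℤ - [ t ]) _) (cong (_* (1ℤ - [ t ])) (𝟙-cong (hnorm u ≟ t) (t ≟ hnorm u) sym sym))))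
             (Σ-pick _≟_ elems (hnorm u) (once (hnorm u)) (λ t → 1ℤ - [ t ])))) ⟩
      Σ diffs (λ u → 1ℤ - [ hnorm u ])
        ≡⟨ Σ-cong diffs (λ { (a , b) → [⊗] a b }) ⟩
      Σ diffs (λ u → 1ℤ - [ proj₁ u ] - [ proj₂ u ] + [ proj₁ u ] * [ proj₂ u ])
        ≡⟨ trans (Σ-+ diffs _ _) (cong₂ _+_ (trans (Σ-- diffs _ _) (cong (_- C₂) (trans (Σ-- diffs _ _) (cong (_- C₁) diffs-1)))) diffs-both) ⟩
      n * n - C₁ - C₂ + n ∎
      where open ≡-Reasoning

    S≡ : S ≡ Σ diffs (λ u → Σ diffs (λ v → (1ℤ - [ hnorm u ]) * 𝟙 (hnorm v ≟ hnorm u)))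
    S≡ = trans (Σ-cong elems (λ t → trans (square (t ≟ 0#) (ν t)) (cong₂ (λ a b → (1ℤ - [ t ]) * (a * b)) (ν≡ t) (ν≡ t))))
      (Σ-fibres _≟_ elems once hnorm (λ t → 1ℤ - [ t ]) diffs)
      where
      square : {P : Set} (d : Dec P) (x : ℤ) → (1ℤ - 𝟙 d) * x * ((1ℤ - 𝟙 d) * x) ≡ (1ℤ - 𝟙 d) * (x * x)
      square (yes _) x = refl
      square (no _)  x = trans (cong₂ _*_ (*-identityˡ x) (*-identityˡ x)) (sym (*-identityˡ (x * x)))

    axis₁ : Σ diffs (λ u → [ proj₁ u ] - [ proj₁ u ] * [ proj₂ u ]) ≡ C₁ - n
    axis₁ = trans (Σ-- diffs _ _) (cong (_-_ C₁) diffs-both)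

    axis₂ : Σ diffs (λ u → [ proj₂ u ] - [ proj₁ u ] * [ proj₂ u ]) ≡ C₂ - n
    axis₂ = trans (Σ-- diffs _ _) (cong (_-_ C₂) diffs-both)

    -- `C₁ - n` and `C₂ - n` count the differences on the two punctured axes, and any two on the
    -- same axis are related by one rotation.
    Σ-rotations : Σ diffs (λ u → Σ diffs (rotations u)) ≡ S + (C₁ - n) * (C₁ - n) + (C₂ - n) * (C₂ - n) + (Q - 1ℤ) * (n * n)
    Σ-rotations = begin
      Σ diffs (λ u → Σ diffs (rotations u))
        ≡⟨ Σ-cong diffs (λ u → trans (Σ-+ diffs _ _) (cong₂ _+_ (trans (Σ-+ diffs _ _) (cong₂ _+_ (Σ-+ diffs _ _) refl)) refl)) ⟩
      Σ diffs (λ u → Σ diffs (t₁ u) + Σ diffs (t₂ u) + Σ diffs (t₃ u) + Σ diffs (t₄ u))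
        ≡⟨ trans (Σ-+ diffs _ _) (cong₂ _+_ (trans (Σ-+ diffs _ _) (cong₂ _+_ (Σ-+ diffs _ _) refl)) refl) ⟩
      Σ diffs (λ u → Σ diffs (t₁ u)) + Σ diffs (λ u → Σ diffs (t₂ u)) + Σ diffs (λ u → Σ diffs (t₃ u)) + Σ diffs (λ u → Σ diffs (t₄ u))
        ≡⟨ cong₂ _+_ (cong₂ _+_ (cong₂ _+_ (sym S≡) (trans (Σ-product diffs diffs _ _) (cong₂ _*_ axis₁ axis₁))) (trans (Σ-product diffs diffs _ _) (cong₂ _*_ axis₂ axis₂)))
             (trans (Σ-cong diffs (λ u → Σ-*ˡ diffs (Q - 1ℤ) _)) (trans (Σ-*ˡ diffs (Q - 1ℤ) _) (cong ((Q - 1ℤ) *_) (trans (Σ-product diffs diffs _ _) (cong₂ _*_ diffs-both diffs-both))))) ⟩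
      S + (C₁ - n) * (C₁ - n) + (C₂ - n) * (C₂ - n) + (Q - 1ℤ) * (n * n) ∎
      where
      open ≡-Reasoning
      t₁ t₂ t₃ t₄ : Point → Point → ℤ
      t₁ u v = (1ℤ - [ hnorm u ]) * 𝟙 (hnorm v ≟ hnorm u)
      t₂ u v = ([ proj₁ u ] - [ proj₁ u ] * [ proj₂ u ]) * ([ proj₁ v ] - [ proj₁ v ] * [ proj₂ v ])
      t₃ u v = ([ proj₂ u ] - [ proj₁ u ] * [ proj₂ u ]) * ([ proj₂ v ] - [ proj₁ v ] * [ proj₂ v ])
      t₄ u v = (Q - 1ℤ) * ([ proj₁ u ] * [ proj₂ u ] * ([ proj₁ v ] * [ proj₂ v ]))

    Σ-dilations : (π : Point → Carrier) (C : ℤ) → Σ diffs (λ u → [ π u ]) ≡ C →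
      Σ diffs (λ u → Σ diffs (λ v → dilations (π u) (π v))) ≡ (n * n - C) * (n * n - C) + (Q - 1ℤ) * (C * C)
    Σ-dilations π C eq = begin
      Σ diffs (λ u → Σ diffs (λ v → dilations (π u) (π v)))
        ≡⟨ trans (Σ-cong diffs (λ u → Σ-+ diffs _ _)) (Σ-+ diffs _ _) ⟩
      Σ diffs (λ u → Σ diffs (λ v → (1ℤ - [ π u ]) * (1ℤ - [ π v ]))) + Σ diffs (λ u → Σ diffs (λ v → (Q - 1ℤ) * ([ π u ] * [ π v ])))
        ≡⟨ cong₂ _+_ (trans (Σ-product diffs diffs _ _) (cong₂ _*_ off off))
             (trans (Σ-cong diffs (λ u → Σ-*ˡ diffs (Q - 1ℤ) _)) (trans (Σ-*ˡ diffs (Q - 1ℤ) _) (cong ((Q - 1ℤ) *_) (trans (Σ-product diffs diffs _ _) (cong₂ _*_ eq eq))))) ⟩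
      (n * n - C) * (n * n - C) + (Q - 1ℤ) * (C * C) ∎
      where
      open ≡-Reasoning
      off : Σ diffs (λ u → 1ℤ - [ π u ]) ≡ n * n - C
      off = trans (Σ-- diffs _ _) (cong₂ _-_ diffs-1 eq)

    -- `π` expands into four terms, and each becomes an orbit count: rotations with weight `Q²`,
    -- dilations of either coordinate with weight `- Q`, and the constant, which counts the `Q - 1`
    -- rotations themselves.
    m₂-value : m₂ ≡ Q * Q * (S + (C₁ - n) * (C₁ - n) + (C₂ - n) * (C₂ - n) + (Q - 1ℤ) * (n * n))
      - Q * ((n * n - C₁) * (n * n - C₁) + (Q - 1ℤ) * (C₁ * C₁)) - Q * ((n * n - C₂) * (n * n - C₂) + (Q - 1ℤ) * (C₂ * C₂))
      + (Q - 1ℤ) * (n * n * (n * n))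
    m₂-value = begin
      m₂
        ≡⟨ m₂≡ ⟩
      Σ diffs (λ u → Σ diffs (λ v → Σ units (λ θ → π (u ⊕ₚ (θ ⊗ₚ v)))))
        ≡⟨ Σ-cong diffs (λ u → Σ-cong diffs (λ v → inner u v)) ⟩
      Σ diffs (λ u → Σ diffs (λ v → Q * Q * rotations u v - Q * dilations (proj₁ u) (proj₁ v) - Q * dilations (proj₂ u) (proj₂ v) + (Q - 1ℤ)))
        ≡⟨ Σ-cong diffs (λ u → trans (Σ-+ diffs _ _) (cong₂ _+_ (trans (Σ-- diffs _ _) (cong₂ _-_ (trans (Σ-- diffs _ _) (cong₂ _-_ (Σ-*ˡ diffs (Q * Q) _) (Σ-*ˡ diffs Q _))) (Σ-*ˡ diffs Q _))) refl)) ⟩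
      Σ diffs (λ u → Q * Q * Σ diffs (rotations u) - Q * Σ diffs (λ v → dilations (proj₁ u) (proj₁ v)) - Q * Σ diffs (λ v → dilations (proj₂ u) (proj₂ v)) + Σ diffs (λ _ → Q - 1ℤ))
        ≡⟨ trans (Σ-+ diffs _ _) (cong₂ _+_ (trans (Σ-- diffs _ _) (cong₂ _-_ (trans (Σ-- diffs _ _) (cong₂ _-_ (Σ-*ˡ diffs (Q * Q) _) (Σ-*ˡ diffs Q _))) (Σ-*ˡ diffs Q _))) refl) ⟩
      Q * Q * Σ diffs (λ u → Σ diffs (rotations u)) - Q * Σ diffs (λ u → Σ diffs (λ v → dilations (proj₁ u) (proj₁ v)))
        - Q * Σ diffs (λ u → Σ diffs (λ v → dilations (proj₂ u) (proj₂ v))) + Σ diffs (λ _ → Σ diffs (λ _ → Q - 1ℤ))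
        ≡⟨ cong₂ _+_ (cong₂ _-_ (cong₂ _-_ (cong (Q * Q *_) Σ-rotations) (cong (Q *_) (Σ-dilations proj₁ C₁ refl))) (cong (Q *_) (Σ-dilations proj₂ C₂ refl))) count ⟩
      _ ∎
      where
      open ≡-Reasoning
      length-diffs : + length diffs ≡ n * n
      length-diffs = trans (sym (Σ-length diffs)) diffs-1
      count : Σ diffs (λ _ → Σ diffs (λ _ → Q - 1ℤ)) ≡ (Q - 1ℤ) * (n * n * (n * n))
      count = trans (Σ-const diffs _) (trans (cong (+ length diffs *_) (Σ-const diffs (Q - 1ℤ))) (trans (cong (λ t → t * (t * (Q - 1ℤ))) length-diffs) (arith n (Q - 1ℤ))))
        where arith : ∀ n N → n * n * (n * n * N) ≡ N * (n * n * (n * n))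
              arith = solve-∀
      inner : ∀ u v → Σ units (λ θ → π (u ⊕ₚ (θ ⊗ₚ v))) ≡ Q * Q * rotations u v - Q * dilations (proj₁ u) (proj₁ v) - Q * dilations (proj₂ u) (proj₂ v) + (Q - 1ℤ)
      inner u@(a , b) v@(c , d) = begin
        Σ units (λ θ → π (u ⊕ₚ (θ ⊗ₚ v)))
          ≡⟨ Σ-units (λ θ → π (u ⊕ₚ (θ ⊗ₚ v))) ⟩
        Σ nonzero (λ t → ρ (a ⊕ t ⊗ c) * ρ (b ⊕ inv t ⊗ d))
          ≡⟨ trans (Σ-cong nonzero (λ t → π≡ (a ⊕ t ⊗ c) (b ⊕ inv t ⊗ d))) (Σ-expansion nonzero (Q * Q) Q _ _ _) ⟩
        Q * Q * Σ nonzero (λ t → [ a ⊕ t ⊗ c ] * [ b ⊕ inv t ⊗ d ]) - Q * Σ nonzero (λ t → [ a ⊕ t ⊗ c ]) - Q * Σ nonzero (λ t → [ b ⊕ inv t ⊗ d ]) + Σ nonzero (λ _ → 1ℤ)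
          ≡⟨ cong₂ _+_ (cong₂ _-_ (cong₂ _-_ (cong (Q * Q *_) (count-rotations u v)) (cong (Q *_) (count-dilations a c)))
               (cong (Q *_) (trans (Σ-nonzero-inv (λ t → [ b ⊕ t ⊗ d ])) (count-dilations b d)))) Σ-nonzero-1 ⟩
        _ ∎

    split-energy : m₂ * m₂ ≤ + 3 * (Q * Q) * (n * n * n) * (m₁ * m₁)
    split-energy = subst (λ t → m₂ * m₂ ≤ + 3 * (Q * Q) * (t * t * t) * (m₁ * m₁)) length-Hs energy-bound

  -- The final inequalities

  -- This is how estimates with √3 are closed: counting gives `x < w ≤ y`, the extension bound gives
  -- `y² ≤ x²`, and no root is extracted.
  squeeze : ∀ {x y w : ℤ} → 0ℤ ≤ x → x < w → w ≤ y → y * y ≤ x * x → ⊥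
  squeeze {x} {y} {w} 0≤x x<w w≤y y²≤x² = ℤₚ.<⇒≱ (ℤₚ.<-≤-trans x<w w≤y) (ℤₚ.≮⇒≥ (λ x<y → ℤₚ.<⇒≱ (square-< x<y) y²≤x²))
    where
    square-< : x < y → x * x < y * y
    square-< x<y = i<j+ ((y - x) * (y - x) + + 2 * x * (y - x))
      (0<+ (0<* d>0 d>0) (0≤* (0≤* {+ 2} (+≤+ z≤n) 0≤x) (ℤₚ.<⇒≤ d>0))) (identity x y)
      where
      d>0 : 0ℤ < y - x
      d>0 = subst (_< y - x) (ℤₚ.+-inverseʳ x) (ℤₚ.+-monoˡ-< (- x) x<y)
      identity : ∀ x y → y * y ≡ x * x + ((y - x) * (y - x) + + 2 * x * (y - x))
      identity = solve-∀

  cube-mono : ∀ {a b : ℤ} → 0ℤ ≤ a → a ≤ b → a * a * a ≤ b * b * b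
  cube-mono {a} {b} 0≤a a≤b = *-mono-≤₀ {a * a} {b * b} {a} {b} (0≤² a) 0≤a (*-mono-≤₀ {a} {b} {a} {b} 0≤a 0≤a a≤b a≤b) a≤b

  cube-cancel-≤ : ∀ {a b : ℤ} → 0ℤ ≤ b → a * a * a ≤ b * b * b → a ≤ b
  cube-cancel-≤ {a} {b} 0≤b h with b ℤ.<? a
  ... | no  b≮a = ℤₚ.≮⇒≥ b≮a
  ... | yes b<a = ⊥-elim (ℤₚ.<⇒≱ strict h)
    where
    0<a = ℤₚ.≤-<-trans 0≤b b<a
    0<d = subst (_< a - b) (ℤₚ.+-inverseʳ b) (ℤₚ.+-monoˡ-< (- b) b<a)
    strict : b * b * b < a * a * a
    strict = i<j+ ((a - b) * (a * a) + (a - b) * (a * b + b * b)) (0<+ (0<* 0<d (0<* 0<a 0<a)) (0≤* (ℤₚ.<⇒≤ 0<d) (0≤+ (0≤* (ℤₚ.<⇒≤ 0<a) 0≤b) (0≤² b)))) (identity a b)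
      where
      identity : ∀ a b → a * a * a ≡ b * b * b + ((a - b) * (a * a) + (a - b) * (a * b + b * b))
      identity = solve-∀

  *-monoˡ : ∀ {a b : ℤ} (c : ℤ) → 0ℤ ≤ c → a ≤ b → c * a ≤ c * b
  *-monoˡ c 0≤c a≤b = ℤₚ.*-monoˡ-≤-nonNeg c {{ℤ.nonNegative 0≤c}} a≤b

  diff≥0 : ∀ {a b : ℤ} → a ≤ b → 0ℤ ≤ b - a
  diff≥0 = ℤₚ.i≤j⇒0≤j-i

  square-*-mono : ∀ x y {z} → x * x ≤ z → (y * x) * (y * x) ≤ y * y * z
  square-*-mono x y {z} h = subst (_≤ y * y * z) (identity y x) (*-monoˡ (y * y) (0≤² y) h)
    where identity : ∀ y x → y * y * (x * x) ≡ (y * x) * (y * x)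
          identity = solve-∀

  module InertBound (q n D N S m₂ : ℤ) (q≥1 : 1ℤ ≤ q) (n>0 : 0ℤ < n) (n≤q² : n ≤ q * q) (large : q * q * q * q ≤ n * n * n)
    (D≥0 : 0ℤ ≤ D) (N≤q+1 : N ≤ q + 1ℤ) (n⁴≤DS : n * n * (n * n) ≤ D * S)
    (m₂≡ : m₂ ≡ q * q * (S + (N - 1ℤ) * (n * n)) - N * (n * n * (n * n)))
    (bound : m₂ * m₂ ≤ + 3 * (q * q) * (n * n * n) * ((q * q * n - n * n) * (q * q * n - n * n))) where

    open ℤₚ.≤-Reasoning

    q>0 : 0ℤ < q
    q>0 = ℤₚ.<-≤-trans (ℤ.+<+ (s≤s z≤n)) q≥1

    n≥q : q ≤ n
    n≥q = cube-cancel-≤ (ℤₚ.<⇒≤ n>0) (ℤₚ.≤-trans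
      (subst (_≤ q * q * q * q) (*-identityʳ (q * q * q)) (*-monoˡ (q * q * q) (0≤* (0≤² q) (ℤₚ.<⇒≤ q>0)) q≥1)) large)

    D>0 : 0ℤ < D
    D>0 = ℤₚ.≤∧≢⇒< D≥0 (λ { refl → ℤₚ.<⇒≱ (0<* (0<* n>0 n>0) (0<* n>0 n>0)) n⁴≤DS })

    -- The part of `q² S` outside `m₂`, with the number of rotations replaced by its upper bound
    -- `q + 1`.
    R : ℤ
    R = (q + 1ℤ) * (n * n * (n * n)) - q * q * q * (n * n)

    -- As `n ≥ q`, the coefficient `n² (n² - q²)` of `N` is nonnegative, so an upper bound for `N`
    -- may be inserted.
    q²S≤ : q * q * S ≤ m₂ + R
    q²S≤ = i≤j+ ((q + 1ℤ - N) * (n * n * ((n - q) * (n + q))))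
      (0≤* (diff≥0 N≤q+1) (0≤* (0≤² n) (0≤* (diff≥0 n≥q) (0≤+ (ℤₚ.<⇒≤ n>0) (ℤₚ.<⇒≤ q>0)))))
      (trans (cong (_+ R) m₂≡) (identity q n N S))
      where
      identity : ∀ q n N S → q * q * (S + (N - 1ℤ) * (n * n)) - N * (n * n * (n * n)) + ((q + 1ℤ) * (n * n * (n * n)) - q * q * q * (n * n))
        ≡ q * q * S + (q + 1ℤ - N) * (n * n * ((n - q) * (n + q)))
      identity = solve-∀

    W : ℤ
    W = q * q * (n * n * (n * n)) - D * R

    W≤Dm₂ : W ≤ D * m₂
    W≤Dm₂ = i≤j+ (q * q * (D * S - n * n * (n * n)) + D * (m₂ + R - q * q * S))
      (0≤+ (0≤* (0≤² q) (diff≥0 n⁴≤DS)) (0≤* D≥0 (diff≥0 q²S≤))) (identity q (n * n * (n * n)) D S m₂ R)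
      where
      identity : ∀ q x D S m R → D * m ≡ q * q * x - D * R + (q * q * (D * S - x) + D * (m + R - q * q * S))
      identity = solve-∀

    -- An integer bound for `q n^(3/2) (q² n - n²)`, which is the root of the energy bound without
    -- its factor 3. It uses `q² - n ≤ q (q - 1)` and then `q⁴ ≤ n³`.
    κ : ℤ
    κ = n * n * (n * n) * (q - 1ℤ)

    κ-large : q * q * (n * n * n) * ((q * q * n - n * n) * (q * q * n - n * n)) ≤ κ * κ
    κ-large = begin
      q * q * (n * n * n) * ((q * q * n - n * n) * (q * q * n - n * n)) ≡⟨ eq₁ q n ⟩
      n * n * n * (n * n) * (q * q * ((q * q - n) * (q * q - n)))  ≤⟨ *-monoˡ _ n⁵≥0 (*-monoˡ _ (0≤² q) (*-mono-≤₀ (diff≥0 n≤q²) (diff≥0 n≤q²) small small)) ⟩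
      n * n * n * (n * n) * (q * q * (q * (q - 1ℤ) * (q * (q - 1ℤ))))   ≡⟨ eq₂ q n ⟩
      n * n * n * (n * n) * ((q - 1ℤ) * (q - 1ℤ)) * (q * q * q * q)  ≤⟨ *-monoˡ _ (0≤* n⁵≥0 (0≤² (q - 1ℤ))) large ⟩
      n * n * n * (n * n) * ((q - 1ℤ) * (q - 1ℤ)) * (n * n * n)  ≡⟨ eq₃ q n ⟩
      κ * κ ∎
      where
      n⁵≥0 : 0ℤ ≤ n * n * n * (n * n)
      n⁵≥0 = 0≤* (0≤* (0≤² n) (ℤₚ.<⇒≤ n>0)) (0≤² n)
      small : q * q - n ≤ q * (q - 1ℤ)
      small = i≤j+ (n - q) (diff≥0 n≥q) (identity q n)
        where identity : ∀ q n → q * (q - 1ℤ) ≡ q * q - n + (n - q)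
              identity = solve-∀
      eq₁ : ∀ q n → q * q * (n * n * n) * ((q * q * n - n * n) * (q * q * n - n * n)) ≡ n * n * n * (n * n) * (q * q * ((q * q - n) * (q * q - n)))
      eq₁ = solve-∀
      eq₂ : ∀ q n → n * n * n * (n * n) * (q * q * (q * (q - 1ℤ) * (q * (q - 1ℤ)))) ≡ n * n * n * (n * n) * ((q - 1ℤ) * (q - 1ℤ)) * (q * q * q * q)
      eq₂ = solve-∀
      eq₃ : ∀ q n → n * n * n * (n * n) * ((q - 1ℤ) * (q - 1ℤ)) * (n * n * n) ≡ n * n * (n * n) * (q - 1ℤ) * (n * n * (n * n) * (q - 1ℤ))
      eq₃ = solve-∀

    -- If √3 `D` were at most `A = q - D`, the energy bound would give `D m₂ ≤ κ A`. But `W ≤ D m₂`,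
    -- and `W` exceeds `κ A` by `D q³ n² + n⁴ (A - D)`, where `D ≤ A`.
    conclusion : D ≤ q → (q - D) * (q - D) < + 3 * (D * D)
    conclusion D≤q = ℤₚ.≰⇒> (λ large-A → squeeze (0≤* κ≥0 A≥0) (κA<W large-A) W≤Dm₂ (Dm₂²≤ large-A))
      where
      A = q - D
      A≥0 : 0ℤ ≤ A
      A≥0 = diff≥0 D≤q
      κ≥0 : 0ℤ ≤ κ
      κ≥0 = 0≤* (0≤² (n * n)) (diff≥0 q≥1)
      module _ (large-A : + 3 * (D * D) ≤ A * A) where
        D≤A : D ≤ A
        D≤A = ℤₚ.≮⇒≥ (λ A<D → ℤₚ.<⇒≱ (ℤₚ.≤-<-trans (*-mono-≤₀ A≥0 A≥0 (ℤₚ.<⇒≤ A<D) (ℤₚ.<⇒≤ A<D))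
          (i<j+ (+ 2 * (D * D)) (0<* {+ 2} (ℤ.+<+ (s≤s z≤n)) (0<* D>0 D>0)) (identity (D * D)))) large-A)
          where identity : ∀ d → + 3 * d ≡ d + + 2 * d
                identity = solve-∀
        κA<W : κ * A < W
        κA<W = i<j+ (D * (q * q * q * (n * n)) + n * n * (n * n) * (A - D))
          (0<+ (0<* D>0 (0<* (0<* (0<* q>0 q>0) q>0) (0<* n>0 n>0))) (0≤* (0≤² (n * n)) (diff≥0 D≤A))) (identity q n D)
          where
          identity : ∀ q n D → q * q * (n * n * (n * n)) - D * ((q + 1ℤ) * (n * n * (n * n)) - q * q * q * (n * n))
            ≡ n * n * (n * n) * (q - 1ℤ) * (q - D) + (D * (q * q * q * (n * n)) + n * n * (n * n) * (q - D - D))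
          identity = solve-∀
        Dm₂²≤ : D * m₂ * (D * m₂) ≤ κ * A * (κ * A)
        Dm₂²≤ = begin
          D * m₂ * (D * m₂)  ≤⟨ square-*-mono m₂ D bound ⟩
          D * D * (+ 3 * (q * q) * (n * n * n) * ((q * q * n - n * n) * (q * q * n - n * n))) ≡⟨ eq₁ D (q * q) (n * n * n) ((q * q * n - n * n) * (q * q * n - n * n)) ⟩
          + 3 * (D * D) * (q * q * (n * n * n) * ((q * q * n - n * n) * (q * q * n - n * n))) ≤⟨ *-mono-≤₀ (0≤* {+ 3} (+≤+ z≤n) (0≤² D))
              (0≤* (0≤* (0≤² q) (0≤* (0≤² n) (ℤₚ.<⇒≤ n>0))) (0≤² (q * q * n - n * n))) large-A κ-large ⟩
          A * A * (κ * κ)  ≡⟨ eq₂ A κ ⟩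
          κ * A * (κ * A)  ∎
          where
          eq₁ : ∀ D a b c → D * D * (+ 3 * a * b * c) ≡ + 3 * (D * D) * (a * b * c)
          eq₁ = solve-∀
          eq₂ : ∀ a k → a * a * (k * k) ≡ k * a * (k * a)
          eq₂ = solve-∀

  module SplitBound (q n D S C₁ C₂ P m₁ m₂ m : ℤ) (q≥512 : + 512 ≤ q) (n>0 : 0ℤ < n) (n≤q² : n ≤ q * q) (large : q * q * q * q ≤ n * n * n)
    (D≥0 : 0ℤ ≤ D) (m≥0 : 0ℤ ≤ m) (m≤n : m ≤ n) (m-small : + 8 * (m + 1ℤ) ≤ q * q)
    (n²≤qC₁ : n * n ≤ q * C₁) (n²≤qC₂ : n * n ≤ q * C₂) (P²≤DS : P * P ≤ D * S)
    (P≡ : P ≡ n * n - C₁ - C₂ + n) (m₁≥0 : 0ℤ ≤ m₁) (m₁≡ : m₁ ≡ q * q * n - q * C₁ - q * C₂ + n * n)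
    (m₂≡ : m₂ ≡ q * q * (S + (C₁ - n) * (C₁ - n) + (C₂ - n) * (C₂ - n) + (q - 1ℤ) * (n * n))
      - q * ((n * n - C₁) * (n * n - C₁) + (q - 1ℤ) * (C₁ * C₁)) - q * ((n * n - C₂) * (n * n - C₂) + (q - 1ℤ) * (C₂ * C₂))
      + (q - 1ℤ) * (n * n * (n * n)))
    (bound : m₂ * m₂ ≤ + 3 * (q * q) * (n * n * n) * (m₁ * m₁)) where

    open ℤₚ.≤-Reasoning

    -- γ / q is the excess of pairs on isotropic lines over the expected 2n²/q; it lowers P, but lowers m₁ and R as well.
    γ R W Z A b : ℤ
    γ = q * C₁ + q * C₂ - + 2 * (n * n)
    R = (q - 1ℤ) * (n * n * (n * n)) - q * q * (q - 1ℤ) * (n * n) - + 2 * (n * n * ((n - q) * (n - q))) - + 2 * (n * (n - q)) * γ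
    W = (n * n * (q - + 2) + q * n - γ) * (n * n * (q - + 2) + q * n - γ) - D * R
    Z = n * (q * q + + 2) - γ
    A = (q - + 2) * (q - + 2) - D * q
    b = q * q - m - 1ℤ

    n≥0 = ℤₚ.<⇒≤ n>0

    q>0 : 0ℤ < q
    q>0 = ℤₚ.<-≤-trans (ℤ.+<+ (s≤s z≤n)) q≥512
    q≥0 = ℤₚ.<⇒≤ q>0

    γ≥0 : 0ℤ ≤ γ
    γ≥0 = subst (0ℤ ≤_) (identity (q * C₁) (q * C₂) (n * n)) (0≤+ (diff≥0 n²≤qC₁) (diff≥0 n²≤qC₂))
      where identity : ∀ a b c → a - c + (b - c) ≡ a + b - + 2 * c
            identity = solve-∀

    -- Here `512 = 8³` enters: `n³ ≥ q⁴ ≥ 512 q³`.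
    n≥8q : + 8 * q ≤ n
    n≥8q = cube-cancel-≤ n≥0 (begin
      + 8 * q * (+ 8 * q) * (+ 8 * q)   ≡⟨ eq q ⟩
      q * q * q * + 512  ≤⟨ *-monoˡ (q * q * q) (0≤* (0≤² q) q≥0) q≥512 ⟩
      q * q * q * q  ≤⟨ large ⟩
      n * n * n  ∎)
      where eq : ∀ q → + 8 * q * (+ 8 * q) * (+ 8 * q) ≡ q * q * q * + 512
            eq = solve-∀

    m₁≡′ : m₁ ≡ q * q * n - n * n - γ
    m₁≡′ = trans m₁≡ (identity (q * q * n) (q * C₁) (q * C₂) (n * n))
      where identity : ∀ x a b c → x - a - b + c ≡ x - c - (a + b - + 2 * c)
            identity = solve-∀

    q²S≡ : q * q * S ≡ m₂ + R
    q²S≡ = trans (identity q n S C₁ C₂) (cong (_+ R) (sym m₂≡))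
      where
      identity : ∀ q n S a b → q * q * S ≡ q * q * (S + (a - n) * (a - n) + (b - n) * (b - n) + (q - 1ℤ) * (n * n))
        - q * ((n * n - a) * (n * n - a) + (q - 1ℤ) * (a * a)) - q * ((n * n - b) * (n * n - b) + (q - 1ℤ) * (b * b))
        + (q - 1ℤ) * (n * n * (n * n))
        + ((q - 1ℤ) * (n * n * (n * n)) - q * q * (q - 1ℤ) * (n * n) - + 2 * (n * n * ((n - q) * (n - q))) - + 2 * (n * (n - q)) * (q * a + q * b - + 2 * (n * n)))
      identity = solve-∀

    qP≡ : q * P ≡ n * n * (q - + 2) + q * n - γ
    qP≡ = trans (cong (q *_) P≡) (identity q n C₁ C₂)
      where identity : ∀ q n a b → q * (n * n - a - b + n) ≡ n * n * (q - + 2) + q * n - (q * a + q * b - + 2 * (n * n))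
            identity = solve-∀

    W≤Dm₂ : W ≤ D * m₂
    W≤Dm₂ = i≤j+ (q * q * (D * S - P * P)) (0≤* (0≤² q) (diff≥0 P²≤DS)) (sym (trans (cong₂ (λ s t → s * s - D * R + t) (sym qP≡)
        (trans (identity₁ q D S P) (cong (λ t → D * t - q * P * (q * P)) q²S≡))) (identity₂ (q * P) D m₂ R)))
      where
      identity₁ : ∀ q D S P → q * q * (D * S - P * P) ≡ D * (q * q * S) - q * P * (q * P)
      identity₁ = solve-∀
      identity₂ : ∀ p D m R → p * p - D * R + (D * (m + R) - p * p) ≡ D * m
      identity₂ = solve-∀

    7q²≤8b : + 7 * (q * q) ≤ + 8 * b
    7q²≤8b = i≤j+ (q * q - + 8 * (m + 1ℤ)) (diff≥0 m-small) (identity (q * q) m)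
      where identity : ∀ x m → + 8 * (x - m - 1ℤ) ≡ + 7 * x + (x - + 8 * (m + 1ℤ))
            identity = solve-∀

    b≥0 : 0ℤ ≤ b
    b≥0 = *-cancel-≤ (+ 8) (ℤ.+<+ (s≤s z≤n)) (ℤₚ.≤-trans (0≤* {+ 7} (+≤+ z≤n) (0≤² q)) 7q²≤8b)

    -- The step that realises the saving `q^(-2/3)`: `b` stands for `q² (1 - t)` with
    -- `t = (m + 1) / q²`, and `m ≤ n` gives `q² - n ≤ q² - m`. The summand `2 n` in `Z` pays for
    -- having `m + 1` in place of `m`, because `2 b ≥ q²`.
    Zb≥q²m₁ : q * q * m₁ ≤ Z * b
    Zb≥q²m₁ = subst (λ t → q * q * t ≤ Z * b) (sym m₁≡′)
      (i≤j+ (γ * (m + 1ℤ) + n * (q * q * (n - m)) + n * (+ 2 * b - q * q))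
        (0≤+ (0≤+ (0≤* γ≥0 (0≤+ m≥0 (+≤+ z≤n))) (0≤* n≥0 (0≤* (0≤² q) (diff≥0 m≤n)))) (0≤* n≥0 2b-q²≥0)) (identity q n γ m))
      where
      2b-q²≥0 : 0ℤ ≤ + 2 * b - q * q
      2b-q²≥0 = *-cancel-≤ (+ 4) (ℤ.+<+ (s≤s z≤n)) (subst (0ℤ ≤_) (arith b (q * q)) (0≤+ (diff≥0 7q²≤8b) (0≤* {+ 3} (+≤+ z≤n) (0≤² q))))
        where arith : ∀ b x → + 8 * b - + 7 * x + + 3 * x ≡ + 4 * (+ 2 * b - x)
              arith = solve-∀
      identity : ∀ q n g m → (n * (q * q + + 2) - g) * (q * q - m - 1ℤ)
        ≡ q * q * (q * q * n - n * n - g) + (g * (m + 1ℤ) + n * (q * q * (n - m)) + n * (+ 2 * (q * q - m - 1ℤ) - q * q))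
      identity = solve-∀

    Z≥0 : 0ℤ ≤ Z
    Z≥0 = subst (0ℤ ≤_) (trans (cong (_+ (n * n + + 2 * n)) m₁≡′) (identity q n γ)) (0≤+ m₁≥0 (0≤+ (0≤² n) (0≤* {+ 2} (+≤+ z≤n) n≥0)))
      where identity : ∀ q n g → q * q * n - n * n - g + (n * n + + 2 * n) ≡ n * (q * q + + 2) - g
            identity = solve-∀

    module Contradiction (A≥0 : 0ℤ ≤ A) (large-A : + 3 * (D * D) * (b * b) ≤ q * q * (A * A)) where

      -- Otherwise `2 A ≤ q²`, while `8 b ≥ 7 q²`. After scaling by 256, `large-A` would then
      -- compare at least `3 · 49 q⁶` on the left with at most `64 q⁶` on the right; the gap is 83.
      2D<q : + 2 * D < q
      2D<q = ℤₚ.≰⇒> (λ q≤2D → ℤₚ.<⇒≱ (too-large q≤2D) (begin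
        + 192 * (q * q) * (b * b)  ≤⟨ i≤j+ (+ 192 * ((+ 2 * D - q) * (+ 2 * D + q) * (b * b)))
                                                            (0≤* {+ 192} (+≤+ z≤n) (0≤* (0≤* (diff≥0 q≤2D) (0≤+ (0≤* {+ 2} (+≤+ z≤n) D≥0) q≥0)) (0≤² b))) (eq₁ q D b) ⟩
        + 256 * (+ 3 * (D * D) * (b * b))  ≤⟨ *-monoˡ (+ 256) (+≤+ z≤n) large-A ⟩
        + 256 * (q * q * (A * A))  ≡⟨ eq₂ (q * q) A ⟩
        + 64 * (q * q) * (+ 2 * A * (+ 2 * A))  ≤⟨ *-monoˡ (+ 64 * (q * q)) (0≤* {+ 64} (+≤+ z≤n) (0≤² q)) (*-mono-≤₀ (0≤* {+ 2} (+≤+ z≤n) A≥0) (0≤* {+ 2} (+≤+ z≤n) A≥0) (2A≤ q≤2D) (2A≤ q≤2D)) ⟩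
        + 64 * (q * q) * (q * q * (q * q))  ∎))
        where
        2A≤ : q ≤ + 2 * D → + 2 * A ≤ q * q
        2A≤ q≤2D = i≤j+ (+ 8 * (q - + 1) + q * (+ 2 * D - q)) (0≤+ (0≤* {+ 8} (+≤+ z≤n) (diff≥0 (ℤₚ.≤-trans (+≤+ (s≤s z≤n)) q≥512))) (0≤* q≥0 (diff≥0 q≤2D))) (identity q D)
          where identity : ∀ q D → q * q ≡ + 2 * ((q - + 2) * (q - + 2) - D * q) + (+ 8 * (q - + 1) + q * (+ 2 * D - q))
                identity = solve-∀
        eq₁ : ∀ q D b → + 256 * (+ 3 * (D * D) * (b * b)) ≡ + 192 * (q * q) * (b * b) + + 192 * ((+ 2 * D - q) * (+ 2 * D + q) * (b * b))
        eq₁ = solve-∀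
        eq₂ : ∀ x a → + 256 * (x * (a * a)) ≡ + 64 * x * (+ 2 * a * (+ 2 * a))
        eq₂ = solve-∀
        eq₃ : ∀ x b → x * (+ 3 * (+ 8 * b * (+ 8 * b))) ≡ + 192 * x * (b * b)
        eq₃ = solve-∀
        eq₄ : ∀ x → x * (+ 3 * (+ 7 * x * (+ 7 * x))) ≡ + 64 * x * (x * x) + + 83 * (x * (x * x))
        eq₄ = solve-∀
        too-large : q ≤ + 2 * D → + 64 * (q * q) * (q * q * (q * q)) < + 192 * (q * q) * (b * b)
        too-large _ = ℤₚ.<-≤-trans (i<j+ (+ 83 * (q * q * (q * q * (q * q)))) (0<* {+ 83} (ℤ.+<+ (s≤s z≤n)) (0<* q²>0 (0<* q²>0 q²>0))) (eq₄ (q * q)))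
          (subst (q * q * (+ 3 * (+ 7 * (q * q) * (+ 7 * (q * q)))) ≤_) (eq₃ (q * q) b)
            (*-monoˡ (q * q) (0≤² q) (*-monoˡ (+ 3) (+≤+ z≤n) (*-mono-≤₀ 7q²≥0 7q²≥0 7q²≤8b 7q²≤8b))))
          where
          q²>0 = 0<* q>0 q>0
          7q²≥0 : 0ℤ ≤ + 7 * (q * q)
          7q²≥0 = 0≤* {+ 7} (+≤+ z≤n) (0≤² q)

      4A≥q² : q * q ≤ + 4 * A
      4A≥q² = i≤j+ (q * (q - + 16) + + 16 + + 2 * (q * (q - + 2 * D)))
        (0≤+ (0≤+ (0≤* q≥0 (diff≥0 (ℤₚ.≤-trans (+≤+ (ℕₚ.m≤m+n 16 496)) q≥512))) (+≤+ z≤n)) (0≤* {+ 2} (+≤+ z≤n) (0≤* q≥0 (diff≥0 (ℤₚ.<⇒≤ 2D<q))))) (identity q D)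
        where identity : ∀ q D → + 4 * ((q - + 2) * (q - + 2) - D * q) ≡ q * q + (q * (q - + 16) + + 16 + + 2 * (q * (q - + 2 * D)))
              identity = solve-∀

      -- Makes the coefficient of `γ` in the final comparison nonnegative: through `P` the excess
      -- costs `2 q³ n² γ` in `q² W`, and through `Z` it saves `n³ A γ` on the other side.
      nA≥ : + 2 * (q * q * q) ≤ n * A
      nA≥ = *-cancel-≤ (+ 4) (ℤ.+<+ (s≤s z≤n)) (begin
        + 4 * (+ 2 * (q * q * q))   ≡⟨ eq₁ q ⟩
        + 8 * q * (q * q)  ≤⟨ *-mono-≤₀ (0≤* {+ 8} (+≤+ z≤n) q≥0) (0≤² q) n≥8q 4A≥q² ⟩
        n * (+ 4 * A)  ≡⟨ eq₂ n A ⟩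
        + 4 * (n * A)  ∎)
        where
        eq₁ : ∀ q → + 4 * (+ 2 * (q * q * q)) ≡ + 8 * q * (q * q)
        eq₁ = solve-∀
        eq₂ : ∀ n a → n * (+ 4 * a) ≡ + 4 * (n * a)
        eq₂ = solve-∀

      -- `q P = n (q - 1) (n - q) + m₁` is positive, so some pair of points has nonzero distance.
      D>0 : 0ℤ < D
      D>0 = ℤₚ.≤∧≢⇒< D≥0 (λ { refl → ℤₚ.<⇒≱ P²>0 P²≤DS })
        where
        P²>0 : 0ℤ < P * P
        P²>0 = ℤₚ.≤∧≢⇒< (0≤² P) (λ h → ℤₚ.<⇒≢ qP>0 (sym (trans (cong (q *_) (square-zero P (sym h))) (*-zeroʳ q))))
          where
          square-zero : ∀ p → p * p ≡ 0ℤ → p ≡ 0ℤ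
          square-zero p h with ℤₚ.i*j≡0⇒i≡0∨j≡0 p h
          ... | inj₁ e = e
          ... | inj₂ e = e
          qP>0 : 0ℤ < q * P
          qP>0 = subst (0ℤ <_) (sym (trans qP≡ (identity q n γ))) (0<+ (0<* (0<* n>0 q-1>0) n-q>0) (subst (0ℤ ≤_) m₁≡′ m₁≥0))
            where
            q-1>0 : 0ℤ < q - 1ℤ
            q-1>0 = ℤₚ.<-≤-trans (ℤ.+<+ (s≤s z≤n)) (ℤₚ.+-monoˡ-≤ (- 1ℤ) q≥512)
            n-q>0 : 0ℤ < n - q
            n-q>0 = ℤₚ.<-≤-trans (0<* {+ 7} (ℤ.+<+ (s≤s z≤n)) q>0) (subst (_≤ n - q) (arith q) (ℤₚ.+-monoˡ-≤ (- q) n≥8q))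
              where arith : ∀ q → + 8 * q - q ≡ + 7 * q
                    arith = solve-∀
            identity : ∀ q n g → n * n * (q - + 2) + q * n - g ≡ n * (q - 1ℤ) * (n - q) + (q * q * n - n * n - g)
            identity = solve-∀

      -- Here `n³ Z` plays the part that `κ` has in the inert case. The surplus consists of the
      -- positive `D q² n⁴` and of `rest`, a sum of nonnegative terms in which everything linear in
      -- `γ` is gathered last, except for what the square of `q n - γ` contains.
      q²W>κA : n * n * n * Z * A < q * q * W
      q²W>κA = i<j+ (D * (q * q) * (n * n * (n * n)) + rest) (0<+ (0<* (0<* D>0 (0<* q>0 q>0)) (0<* n²>0 n²>0)) rest≥0) (identity q n D γ)
        where
        n²>0 = 0<* n>0 n>0
        n²≥0 = 0≤² n
        n³≥0 : 0ℤ ≤ n * n * n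
        n³≥0 = 0≤* n²≥0 n≥0
        q-2≥0 : 0ℤ ≤ q - + 2
        q-2≥0 = diff≥0 (ℤₚ.≤-trans (+≤+ (s≤s (s≤s z≤n))) q≥512)
        n-q≥0 : 0ℤ ≤ n - q
        n-q≥0 = diff≥0 (ℤₚ.≤-trans (i≤j+ (+ 7 * q) (0≤* {+ 7} (+≤+ z≤n) q≥0) (arith q)) n≥8q)
          where arith : ∀ q → + 8 * q ≡ q + + 7 * q
                arith = solve-∀
        rest : ℤ
        rest = q * q * ((q * n - γ) * (q * n - γ)) + + 2 * (n * n * n * (q * (q - + 2) * (q * q - n))) + + 2 * (n * n * (n * n)) * (+ 2 * (q - + 2) + D * q)
          + D * (q * q) * (q * q * (q - 1ℤ) * (n * n)) + + 2 * (D * (q * q) * (n * n * ((n - q) * (n - q))))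
          + γ * (n * n * (n * A - + 2 * (q * q * q)) + + 4 * (q * q * (n * n)) + + 2 * (D * (q * q) * (n * (n - q))))
        rest≥0 : 0ℤ ≤ rest
        rest≥0 = 0≤+ (0≤+ (0≤+ (0≤+ (0≤+ (0≤* (0≤² q) (0≤² (q * n - γ)))
          (0≤* {+ 2} (+≤+ z≤n) (0≤* n³≥0 (0≤* (0≤* q≥0 q-2≥0) (diff≥0 n≤q²)))))
          (0≤* (0≤* {+ 2} (+≤+ z≤n) (0≤² (n * n))) (0≤+ (0≤* {+ 2} (+≤+ z≤n) q-2≥0) (0≤* D≥0 q≥0))))
          (0≤* (0≤* D≥0 (0≤² q)) (0≤* (0≤* (0≤² q) (diff≥0 (ℤₚ.≤-trans (+≤+ (s≤s z≤n)) q≥512))) n²≥0)))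
          (0≤* {+ 2} (+≤+ z≤n) (0≤* (0≤* D≥0 (0≤² q)) (0≤* n²≥0 (0≤² (n - q))))))
          (0≤* γ≥0 (0≤+ (0≤+ (0≤* n²≥0 (diff≥0 nA≥)) (0≤* {+ 4} (+≤+ z≤n) (0≤* (0≤² q) n²≥0))) (0≤* {+ 2} (+≤+ z≤n) (0≤* (0≤* D≥0 (0≤² q)) (0≤* n≥0 n-q≥0)))))
        identity : ∀ q n D g → q * q * ((n * n * (q - + 2) + q * n - g) * (n * n * (q - + 2) + q * n - g)
          - D * ((q - 1ℤ) * (n * n * (n * n)) - q * q * (q - 1ℤ) * (n * n) - + 2 * (n * n * ((n - q) * (n - q))) - + 2 * (n * (n - q)) * g))
          ≡ n * n * n * (n * (q * q + + 2) - g) * ((q - + 2) * (q - + 2) - D * q) + (D * (q * q) * (n * n * (n * n)) +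
            (q * q * ((q * n - g) * (q * n - g)) + + 2 * (n * n * n * (q * (q - + 2) * (q * q - n))) + + 2 * (n * n * (n * n)) * (+ 2 * (q - + 2) + D * q)
          + D * (q * q) * (q * q * (q - 1ℤ) * (n * n)) + + 2 * (D * (q * q) * (n * n * ((n - q) * (n - q))))
          + g * (n * n * (n * ((q - + 2) * (q - + 2) - D * q) - + 2 * (q * q * q)) + + 4 * (q * q * (n * n)) + + 2 * (D * (q * q) * (n * (n - q))))))
        identity = solve-∀

      contradictory : ⊥
      contradictory = squeeze (0≤* (0≤* n³≥0 Z≥0) A≥0) q²W>κA (*-monoˡ (q * q) (0≤² q) W≤Dm₂)
        -- The additional factor `q²` on the left sets free the `q⁴` that `large` replaces by `n³`;
        -- it returns with `large-A` on the right and cancels.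
        (*-cancel-≤ (q * q) (0<* q>0 q>0) (begin
          q * q * (q * q * (D * m₂) * (q * q * (D * m₂)))  ≡⟨ eq₁ q D m₂ ⟩
          q * q * (q * q) * (q * q) * (D * D) * (m₂ * m₂)  ≤⟨ *-monoˡ _ (0≤* (0≤* (0≤² (q * q)) (0≤² q)) (0≤² D)) bound ⟩
          q * q * (q * q) * (q * q) * (D * D) * (+ 3 * (q * q) * (n * n * n) * (m₁ * m₁)) ≡⟨ eq₂ q D (n * n * n) m₁ ⟩
          + 3 * (D * D) * (n * n * n) * (q * q * q * q * (q * q * m₁ * (q * q * m₁))) ≤⟨ *-monoˡ _ 3D²n³≥0 (*-mono-≤₀ q⁴≥0 (0≤² (q * q * m₁)) large (*-mono-≤₀ q²m₁≥0 q²m₁≥0 Zb≥q²m₁ Zb≥q²m₁)) ⟩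
          + 3 * (D * D) * (n * n * n) * (n * n * n * (Z * b * (Z * b)))  ≡⟨ eq₃ D (n * n * n) Z b ⟩
          n * n * n * Z * (n * n * n * Z) * (+ 3 * (D * D) * (b * b))  ≤⟨ *-monoˡ _ (0≤² (n * n * n * Z)) large-A ⟩
          n * n * n * Z * (n * n * n * Z) * (q * q * (A * A))  ≡⟨ eq₄ (n * n * n * Z) (q * q) A ⟩
          q * q * (n * n * n * Z * A * (n * n * n * Z * A))  ∎))
        where
        n³≥0 : 0ℤ ≤ n * n * n
        n³≥0 = 0≤* (0≤² n) n≥0
        3D²n³≥0 : 0ℤ ≤ + 3 * (D * D) * (n * n * n)
        3D²n³≥0 = 0≤* (0≤* {+ 3} (+≤+ z≤n) (0≤² D)) n³≥0
        q⁴≥0 : 0ℤ ≤ q * q * q * q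
        q⁴≥0 = 0≤* (0≤* (0≤² q) q≥0) q≥0
        q²m₁≥0 : 0ℤ ≤ q * q * m₁
        q²m₁≥0 = 0≤* (0≤² q) m₁≥0
        eq₁ : ∀ q D m → q * q * (q * q * (D * m) * (q * q * (D * m))) ≡ q * q * (q * q) * (q * q) * (D * D) * (m * m)
        eq₁ = solve-∀
        eq₂ : ∀ q D c m → q * q * (q * q) * (q * q) * (D * D) * (+ 3 * (q * q) * c * (m * m)) ≡ + 3 * (D * D) * c * (q * q * q * q * (q * q * m * (q * q * m)))
        eq₂ = solve-∀
        eq₃ : ∀ D c Z b → + 3 * (D * D) * c * (c * (Z * b * (Z * b))) ≡ c * Z * (c * Z) * (+ 3 * (D * D) * (b * b))
        eq₃ = solve-∀
        eq₄ : ∀ k x a → k * k * (x * (a * a)) ≡ x * (k * a * (k * a))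
        eq₄ = solve-∀

    -- These are the two alternatives of `Lt√3` for a nonnegative second argument.
    conclusion : A < 0ℤ ⊎ q * q * (A * A) < + 3 * (D * D) * (b * b)
    conclusion with A ℤ.<? 0ℤ | q * q * (A * A) ℤ.<? + 3 * (D * D) * (b * b)
    ... | yes A<0 | _  = inj₁ A<0
    ... | no _  | yes lt = inj₂ lt
    ... | no A≮0  | no ¬lt = ⊥-elim (Contradiction.contradictory (ℤₚ.≮⇒≥ A≮0) (ℤₚ.≮⇒≥ ¬lt))

  -- Passage from integers to rational numbers

  -- i / (d + 1)
  fraction : ℤ → ℕ → ℚ
  fraction i d = ℚ.fromℚᵘ (ℚᵘ.mkℚᵘ i d)

  -- At `+ n` this unfolds to `⟦ n ⟧`, so its homomorphism laws apply directly to the terms of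
  -- `GtEpsQ`.
  ι : ℤ → ℚ
  ι i = fraction i 0

  toℚᵘ-fraction : ∀ i d → ℚ.toℚᵘ (fraction i d) ℚᵘ.≃ ℚᵘ.mkℚᵘ i d
  toℚᵘ-fraction i d = ℚₚ.toℚᵘ-fromℚᵘ (ℚᵘ.mkℚᵘ i d)

  ι-+ : ∀ i j → ι (i + j) ≡ ι i ℚ.+ ι j
  ι-+ i j = ℚₚ.toℚᵘ-injective (ℚᵘₚ.≃-trans (toℚᵘ-fraction (i + j) 0) (ℚᵘₚ.≃-trans (ℚᵘ.*≡* (identity i j))
    (ℚᵘₚ.≃-sym (ℚᵘₚ.≃-trans (ℚₚ.toℚᵘ-homo-+ (ι i) (ι j)) (ℚᵘₚ.+-cong (toℚᵘ-fraction i 0) (toℚᵘ-fraction j 0))))))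
    where identity : ∀ i j → (i + j) * 1ℤ ≡ (i * 1ℤ + j * 1ℤ) * 1ℤ
          identity = solve-∀

  ι-* : ∀ i j → ι (i * j) ≡ ι i ℚ.* ι j
  ι-* i j = ℚₚ.toℚᵘ-injective (ℚᵘₚ.≃-trans (toℚᵘ-fraction (i * j) 0) (ℚᵘₚ.≃-trans (ℚᵘ.*≡* refl)
    (ℚᵘₚ.≃-sym (ℚᵘₚ.≃-trans (ℚₚ.toℚᵘ-homo-* (ι i) (ι j)) (ℚᵘₚ.*-cong (toℚᵘ-fraction i 0) (toℚᵘ-fraction j 0))))))

  ι-neg : ∀ i → ι (- i) ≡ ℚ.- ι i
  ι-neg i = ℚₚ.toℚᵘ-injective (ℚᵘₚ.≃-trans (toℚᵘ-fraction (- i) 0) (ℚᵘₚ.≃-sym (ℚᵘₚ.≃-trans (ℚₚ.toℚᵘ-homo‿- (ι i)) (ℚᵘₚ.-‿cong (toℚᵘ-fraction i 0)))))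

  ι-- : ∀ i j → ι (i - j) ≡ ι i ℚ.- ι j
  ι-- i j = trans (ι-+ i (- j)) (cong (ι i ℚ.+_) (ι-neg j))

  ι-mono-< : ∀ {i j} → i < j → ι i ℚ.< ι j
  ι-mono-< {i} {j} i<j = ℚₚ.toℚᵘ-cancel-< (ℚᵘₚ.<-respˡ-≃ (ℚᵘₚ.≃-sym (toℚᵘ-fraction i 0)) (ℚᵘₚ.<-respʳ-≃ (ℚᵘₚ.≃-sym (toℚᵘ-fraction j 0))
    (ℚᵘ.*<* (subst₂< (sym (*-identityʳ i)) (sym (*-identityʳ j)) i<j))))

  ι-mono-≤ : ∀ {i j} → i ≤ j → ι i ℚ.≤ ι j
  ι-mono-≤ {i} {j} i≤j with i ℤ.≟ j
  ... | yes refl = ℚₚ.≤-refl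
  ... | no  i≢j  = ℚₚ.<⇒≤ (ι-mono-< (ℤₚ.≤∧≢⇒< i≤j i≢j))

  fraction-* : ∀ i d → fraction i d ℚ.* ι (+ suc d) ≡ ι i
  fraction-* i d = ℚₚ.toℚᵘ-injective (ℚᵘₚ.≃-trans (ℚₚ.toℚᵘ-homo-* (fraction i d) (ι (+ suc d)))
    (ℚᵘₚ.≃-trans (ℚᵘₚ.*-cong (toℚᵘ-fraction i d) (toℚᵘ-fraction (+ suc d) 0)) (ℚᵘₚ.≃-trans (ℚᵘ.*≡* identity) (ℚᵘₚ.≃-sym (toℚᵘ-fraction i 0)))))
    where
    identity : i * + suc d * 1ℤ ≡ i * + (suc d ℕ.* 1)
    identity = trans (*-identityʳ _) (cong (λ k → i * + k) (sym (ℕₚ.*-identityʳ (suc d))))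

  pos-^2 : ∀ a → + (a ℕ.^ 2) ≡ + a * + a
  pos-^2 a = trans (ℤₚ.pos-* a (a ℕ.* 1)) (cong (λ t → + a * + t) (ℕₚ.*-identityʳ a))

  pos-^3 : ∀ a → + (a ℕ.^ 3) ≡ + a * + a * + a
  pos-^3 a = trans (ℤₚ.pos-* a (a ℕ.^ 2)) (trans (cong (+ a *_) (pos-^2 a)) (sym (ℤₚ.*-assoc (+ a) (+ a) (+ a))))

  pos-^4 : ∀ a → + (a ℕ.^ 4) ≡ + a * + a * + a * + a
  pos-^4 a = trans (ℤₚ.pos-* a (a ℕ.^ 3)) (trans (cong (+ a *_) (pos-^3 a)) (rearrange (+ a)))
    where rearrange : ∀ a → a * (a * a * a) ≡ a * a * a * a
          rearrange = solve-∀

  odd⇒≢2k : ∀ {q} l → q ≡ 1 ℕ.+ l ℕ.* 2 → ∀ k → q ≢ 2 ℕ.* k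
  odd⇒≢2k {q} l eq k h = 1≢0 (trans (sym (trans (cong (_% 2) eq) ([m+kn]%n≡m%n 1 l 2))) (trans (cong (_% 2) (trans h (ℕₚ.*-comm 2 k))) (m*n%n≡0 k 2)))
    where
    1≢0 : 1 ≢ 0
    1≢0 ()

  3mod4-odd : ∀ {q} → q % 4 ≡ 3 → ∀ k → q ≢ 2 ℕ.* k
  3mod4-odd {q} h = odd⇒≢2k (1 ℕ.+ q / 4 ℕ.* 2) (trans (m≡m%n+[m/n]*n q 4) (trans (cong (ℕ._+ q / 4 ℕ.* 4) h)
    (cong (3 ℕ.+_) (sym (ℕₚ.*-assoc (q / 4) 2 2)))))

  1mod4-odd : ∀ {q} → q % 4 ≡ 1 → ∀ k → q ≢ 2 ℕ.* k
  1mod4-odd {q} h = odd⇒≢2k (q / 4 ℕ.* 2) (trans (m≡m%n+[m/n]*n q 4) (trans (cong (ℕ._+ q / 4 ℕ.* 4) h)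
    (cong (1 ℕ.+_) (sym (ℕₚ.*-assoc (q / 4) 2 2)))))

  -- Trade the factor `c³` for `x` to reach `x³`, then cube `x ≤ c M`.
  cube-root-≥ : ∀ c x M → 0ℤ < c → 0ℤ ≤ x → c * c * c ≤ x → x ≤ c * M → x * x ≤ M * M * M
  cube-root-≥ c x M c>0 x≥0 c³≤x x≤cM = *-cancel-≤ (c * c * c) (0<* (0<* c>0 c>0) c>0) (begin
    c * c * c * (x * x)  ≤⟨ ℤₚ.*-monoʳ-≤-nonNeg (x * x) {{ℤ.nonNegative (0≤² x)}} c³≤x ⟩
    x * (x * x)  ≡⟨ ℤₚ.*-assoc x x x ⟨
    x * x * x  ≤⟨ cube-mono x≥0 x≤cM ⟩
    c * M * (c * M) * (c * M)  ≡⟨ identity c M ⟩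
    c * c * c * (M * M * M)  ∎)
    where
    open ℤₚ.≤-Reasoning
    identity : ∀ c M → c * M * (c * M) * (c * M) ≡ c * c * c * (M * M * M)
    identity = solve-∀

  -- The witness t = (m + 1) / q² has to exceed q^(-2/3), and t ≤ 1/8 keeps 1 - t away from 0.
  small-root : ∀ q N → 512 ℕ.≤ q → 0ℤ < + N → + q * + q * + q * + q ≤ + N * + N * + N → ∃ λ m → m ℕ.≤ N × + 8 * (+ m + 1ℤ) ≤ + q * + q × + q * + q * + q * + q ≤ + m * + m * + m
  small-root q N q≥512 nonempty large with 16 ℕ.* N ℕ.≤? q ℕ.* q
  -- Here `m = n` serves, since `8 (n + 1) ≤ 16 n` for `n ≥ 1`.
  ... | yes 16n≤q² = N , ℕₚ.≤-refl , i≤j+ (+ q * + q - + 16 * n + + 8 * (n - 1ℤ)) (0≤+ (diff≥0 16n≤q²′) (0≤* {+ 8} (+≤+ z≤n) (diff≥0 (ℤₚ.i<j⇒suc[i]≤j nonempty)))) (identity n (+ q * + q)) , large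
    where
    n = + N
    16n≤q²′ : + 16 * n ≤ + q * + q
    16n≤q²′ = subst₂′ (ℤₚ.pos-* 16 N) (ℤₚ.pos-* q q) (+≤+ 16n≤q²)
    identity : ∀ n x → x ≡ + 8 * (n + 1ℤ) + (x - + 16 * n + + 8 * (n - 1ℤ))
    identity = solve-∀
  -- Now `m` is `q² / 16` rounded down. Rounding loses less than a factor two, so `q² ≤ 32 m`, and
  -- `32³ ≤ 512² ≤ q²` turns this into `q⁴ ≤ m³`.
  ... | no 16n≰q² = m , m≤n , i≤j+ (x - M * + 16 + + 8 * (M - 1ℤ)) (0≤+ (diff≥0 16m≤q²) (0≤* {+ 8} (+≤+ z≤n) (diff≥0 M≥1))) (identity₁ M x) ,
      subst (_≤ M * M * M) (identity₂ (+ q)) (cube-root-≥ (+ 32) x M (ℤ.+<+ (s≤s z≤n)) x≥0 (ℤₚ.≤-trans (+≤+ (ℕₚ.≤ᵇ⇒≤ 32768 262144 _)) 512²≤x) x≤32M)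
    where
    m = (q ℕ.* q) / 16
    M = + m
    x = + q * + q
    x≥0 : 0ℤ ≤ x
    x≥0 = 0≤² (+ q)
    16m≤q² : M * + 16 ≤ x
    16m≤q² = subst₂′ (ℤₚ.pos-* m 16) (ℤₚ.pos-* q q) (+≤+ (m/n*n≤m (q ℕ.* q) 16))
    x≤ : x ≤ + 15 + M * + 16
    x≤ = subst₂′ (trans (cong +_ (sym (m≡m%n+[m/n]*n (q ℕ.* q) 16))) (ℤₚ.pos-* q q)) (cong (_+_ (+ 15)) (ℤₚ.pos-* m 16))
           (+≤+ (ℕₚ.+-monoˡ-≤ (m ℕ.* 16) (ℕₚ.≤-pred (m%n<n (q ℕ.* q) 16))))
    512²≤x : + 262144 ≤ x
    512²≤x = *-mono-≤₀ {+ 512} {+ q} {+ 512} {+ q} (+≤+ z≤n) (+≤+ z≤n) (+≤+ q≥512) (+≤+ q≥512)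
    M≥1 : 1ℤ ≤ M
    M≥1 = ℤₚ.≮⇒≥ (λ M<1 → ℤₚ.<⇒≱ (ℤ.+<+ (ℕₚ.<ᵇ⇒< 31 262144 _)) (ℤₚ.≤-trans 512²≤x (ℤₚ.≤-trans x≤
      (ℤₚ.+-monoʳ-≤ (+ 15) (ℤₚ.*-monoʳ-≤-nonNeg (+ 16) (ℤₚ.<⇒≤ M<1))))))
    x≤32M : x ≤ + 32 * M
    x≤32M = ℤₚ.≤-trans x≤ (i≤j+ (+ 15 * (M - 1ℤ) + M) (0≤+ (0≤* {+ 15} (+≤+ z≤n) (diff≥0 M≥1)) (+≤+ z≤n)) (identity₄ M))
      where identity₄ : ∀ M → + 32 * M ≡ + 15 + M * + 16 + (+ 15 * (M - 1ℤ) + M)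
            identity₄ = solve-∀
    m≤n : m ℕ.≤ N
    m≤n = ℕₚ.*-cancelˡ-≤ {m} {N} 16 (ℕₚ.≤-trans (subst (ℕ._≤ q ℕ.* q) (ℕₚ.*-comm m 16) (m/n*n≤m (q ℕ.* q) 16)) (ℕₚ.<⇒≤ (ℕₚ.≰⇒> 16n≰q²)))
    identity₁ : ∀ M x → x ≡ + 8 * (M + 1ℤ) + (x - M * + 16 + + 8 * (M - 1ℤ))
    identity₁ = solve-∀
    identity₂ : ∀ q → q * q * (q * q) ≡ q * q * q * q
    identity₂ = solve-∀

  -- The two residue classes of `q`

  module _ {q : ℕ} (F : FiniteField q) (E : FiniteField.Subset F) (q≥1 : 1 ℕ.≤ q) (large : q ℕ.^ 4 ℕ.≤ FiniteField.card F E ℕ.^ 3) where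

    q>0 : 0ℤ < + q
    q>0 = ℤ.+<+ q≥1

    large′ : + q * + q * + q * + q ≤ + FiniteField.card F E * + FiniteField.card F E * + FiniteField.card F E
    large′ = subst₂′ (pos-^4 q) (pos-^3 (FiniteField.card F E)) (+≤+ large)

    nonempty : 0ℤ < + FiniteField.card F E
    nonempty = ℤₚ.≤∧≢⇒< (+≤+ z≤n) (λ h → ℤₚ.<⇒≱ (0<* (0<* (0<* q>0 q>0) q>0) q>0)
      (subst (λ n → + q * + q * + q * + q ≤ n * n * n) (sym h) large′))

    inert-case : q % 4 ≡ 3 → GtQOver1+√3 q (FiniteField.cardΔ F E)
    inert-case q≡3 = by (FiniteField.cardΔ F E ℕ.≤? q)
      where
      by : Dec (FiniteField.cardΔ F E ℕ.≤ q) → GtQOver1+√3 q (FiniteField.cardΔ F E)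
      by (yes D≤q) = ℤₚ.drop‿+<+ (subst₂< (sym (trans (pos-^2 (q ℕ.∸ d)) (cong (λ t → t * t) (trans (sym (ℤₚ.⊖-≥ D≤q)) (sym (ℤₚ.m-n≡m⊖n q d))))))
                        (sym (trans (ℤₚ.pos-* 3 (d ℕ.^ 2)) (cong (+ 3 *_) (pos-^2 d)))) (conclusion (+≤+ D≤q)))
        where
        d = FiniteField.cardΔ F E
        open Field F using (odd-order⇒2≢0)
        open Field.OddCharacteristic F (odd-order⇒2≢0 (3mod4-odd q≡3)) using (no-√-1)
        open Distances F q>0 E nonempty
        open InertCount (no-√-1 q≡3)
        open EnergyOfDifferences (Inert.geometry (no-√-1 q≡3)) Es (λ f f≥0 → Σ-filter-≤ E? points f f≥0) nonempty using (m₂; N)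
        open InertBound Q n D N S m₂ (+≤+ q≥1) nonempty n≤Q² large′ (+≤+ z≤n) N≤Q+1 n⁴≤DS m₂-value inert-energy
      -- The truncated difference `q ∸ D` is zero here, and the claim reduces to `0 < 3 D²`.
      by (no D≰q) = subst (λ t → t ℕ.^ 2 ℕ.< 3 ℕ.* (FiniteField.cardΔ F E ℕ.^ 2)) (sym (ℕₚ.m≤n⇒m∸n≡0 (ℕₚ.<⇒≤ (ℕₚ.≰⇒> D≰q))))
          (positive (ℕₚ.<-≤-trans (s≤s z≤n) (ℕₚ.≰⇒> D≰q)))
        where
        positive : ∀ {d} → 0 ℕ.< d → 0 ℕ.< 3 ℕ.* (d ℕ.^ 2)
        positive {suc d} _ = s≤s z≤n

    split-case : 512 ℕ.≤ q → q % 4 ≡ 1 → GtEpsQ q (FiniteField.cardΔ F E)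
    -- Each rational inequality is checked after multiplication by a power of `T = q²`, which clears
    -- the denominator of `t` and leaves an integer inequality.
    split-case q≥512 q≡1 = t , t>0 , t³>q⁻² , inj₁ (Y≥0 , Sum.map X<0 X²<3Y² conclusion)
      where
      d = FiniteField.cardΔ F E
      root = small-root q (FiniteField.card F E) q≥512 nonempty large′
      m′ : ℕ
      m′ = proj₁ root
      2≢0 = Field.odd-order⇒2≢0 F (1mod4-odd q≡1)
      imaginary = Field.OddCharacteristic.√-1 F 2≢0 q≡1
      open Distances F q>0 E nonempty using (n; D; Q; n≤Q²)
      open SplitCount F q>0 E nonempty 2≢0 (proj₁ imaginary) (proj₂ imaginary) using (S; C₁; C₂; P; P²≤DS; P-value; n²≤QC₁; n²≤QC₂; m₁; m₂; m₁-value; m₂-value; m₁≥0; split-energy)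
      m : ℤ
      m = + m′
      open SplitBound Q n D S C₁ C₂ P m₁ m₂ m (+≤+ q≥512) nonempty n≤Q² large′ (+≤+ z≤n) (+≤+ z≤n) (+≤+ (proj₁ (proj₂ root))) (proj₁ (proj₂ (proj₂ root)))
        n²≤QC₁ n²≤QC₂ P²≤DS P-value m₁≥0 m₁-value m₂-value split-energy using (A; b; b≥0; conclusion)
      open ℚₚ.≤-Reasoning

      t : ℚ
      t = fraction (m + 1ℤ) (ℕ.pred (q ℕ.^ 2))

      T : ℚ
      T = ι (Q * Q)

      q²≡ : + suc (ℕ.pred (q ℕ.^ 2)) ≡ Q * Q
      q²≡ = trans (cong +_ (ℕₚ.suc-pred (q ℕ.^ 2) {{ℕ.>-nonZero (ℤₚ.drop‿+<+ (subst (0ℤ <_) (sym (pos-^2 q)) (0<* q>0 q>0)))}})) (pos-^2 q)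

      tT : t ℚ.* T ≡ ι (m + 1ℤ)
      tT = trans (cong (λ z → t ℚ.* ι z) (sym q²≡)) (fraction-* (m + 1ℤ) (ℕ.pred (q ℕ.^ 2)))

      T>0 : 0ℚ ℚ.< T
      T>0 = ι-mono-< (0<* q>0 q>0)

      instance
        _ = ℚ.positive T>0

      TT-positive : ℚ.Positive (T ℚ.* T)
      TT-positive = ℚ.positive (subst (ℚ._< T ℚ.* T) (ℚₚ.*-zeroʳ T) (ℚₚ.*-monoʳ-<-pos T T>0))

      t>0 : 0ℚ ℚ.< t
      t>0 = ℚₚ.*-cancelʳ-<-nonNeg T {{ℚₚ.pos⇒nonNeg T}} (begin-strict
        0ℚ ℚ.* T  ≡⟨ ℚₚ.*-zeroˡ T ⟩
        0ℚ  <⟨ ι-mono-< (ℤₚ.<-≤-trans (ℤ.+<+ (s≤s z≤n)) (ℤₚ.+-monoˡ-≤ 1ℤ (+≤+ (z≤n {m′})))) ⟩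
        ι (m + 1ℤ)  ≡⟨ tT ⟨
        t ℚ.* T  ∎)

      -- Only `q⁴ ≤ m³` is at hand; the `+ 1` in the numerator of `t` supplies the strictness.
      q⁴<[m+1]³ : Q * Q * (Q * Q) < (m + 1ℤ) * (m + 1ℤ) * (m + 1ℤ)
      q⁴<[m+1]³ = ℤₚ.≤-<-trans (subst (_≤ m * m * m) (ℤₚ.*-assoc (Q * Q) Q Q) (proj₂ (proj₂ (proj₂ root))))
        (i<j+ (+ 3 * (m * m) + + 3 * m + 1ℤ) (subst (0ℤ <_) (+-comm 1ℤ (+ 3 * (m * m) + + 3 * m)) (0<+ {1ℤ} (ℤ.+<+ (s≤s z≤n)) (0≤+ (0≤* {+ 3} (+≤+ z≤n) (0≤² m)) (0≤* {+ 3} {m} (+≤+ z≤n) (+≤+ z≤n))))) (identity m))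
        where identity : ∀ m → (m + 1ℤ) * (m + 1ℤ) * (m + 1ℤ) ≡ m * m * m + (+ 3 * (m * m) + + 3 * m + 1ℤ)
              identity = solve-∀

      t³>q⁻² : 1ℚ ℚ.< t ℚ.* t ℚ.* t ℚ.* ⟦ q ℕ.^ 2 ⟧
      t³>q⁻² = ℚₚ.*-cancelˡ-<-nonNeg (T ℚ.* T) {{ℚₚ.pos⇒nonNeg (T ℚ.* T) {{TT-positive}}}} (begin-strict
        T ℚ.* T ℚ.* 1ℚ  ≡⟨ ℚₚ.*-identityʳ (T ℚ.* T) ⟩
        T ℚ.* T  ≡⟨ ι-* (Q * Q) (Q * Q) ⟨
        ι (Q * Q * (Q * Q))  <⟨ ι-mono-< q⁴<[m+1]³ ⟩
        ι ((m + 1ℤ) * (m + 1ℤ) * (m + 1ℤ))  ≡⟨ trans (ι-* ((m + 1ℤ) * (m + 1ℤ)) (m + 1ℤ)) (cong (ℚ._* ι (m + 1ℤ)) (ι-* (m + 1ℤ) (m + 1ℤ))) ⟩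
        ι (m + 1ℤ) ℚ.* ι (m + 1ℤ) ℚ.* ι (m + 1ℤ)  ≡⟨ cong (λ z → z ℚ.* z ℚ.* z) tT ⟨
        t ℚ.* T ℚ.* (t ℚ.* T) ℚ.* (t ℚ.* T)  ≡⟨ solve 2 (λ t T → t :* T :* (t :* T) :* (t :* T) := T :* T :* (t :* t :* t :* T)) refl t T ⟩
        T ℚ.* T ℚ.* (t ℚ.* t ℚ.* t ℚ.* T)  ≡⟨ cong (λ z → T ℚ.* T ℚ.* (t ℚ.* t ℚ.* t ℚ.* ι z)) (pos-^2 q) ⟨
        T ℚ.* T ℚ.* (t ℚ.* t ℚ.* t ℚ.* ⟦ q ℕ.^ 2 ⟧)  ∎)
        where open +-*-Solver using (solve; _:=_; _:*_)

      X Y : ℚ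
      X = ⟦ (q ℕ.∸ 2) ℕ.^ 2 ⟧ ℚ.- ⟦ d ℕ.* q ⟧
      Y = ⟦ q ℕ.* d ⟧ ℚ.* (1ℚ ℚ.- t)

      X≡ : X ≡ ι A
      X≡ = trans (sym (ι-- (+ ((q ℕ.∸ 2) ℕ.^ 2)) (+ (d ℕ.* q)))) (cong ι (cong₂ _-_
        (trans (pos-^2 (q ℕ.∸ 2)) (cong (λ z → z * z) (trans (sym (ℤₚ.⊖-≥ 2≤q)) (sym (ℤₚ.m-n≡m⊖n q 2))))) (ℤₚ.pos-* d q)))
        where 2≤q : 2 ℕ.≤ q
              2≤q = ℕₚ.≤-trans (s≤s (s≤s z≤n)) q≥512

      TY : T ℚ.* Y ≡ ι (Q * D * b)
      TY = begin-equality
        T ℚ.* (⟦ q ℕ.* d ⟧ ℚ.* (1ℚ ℚ.- t))  ≡⟨ solve 3 (λ T u t → T :* (u :* (con 1ℚ :- t)) := u :* (T :- t :* T)) refl T ⟦ q ℕ.* d ⟧ t ⟩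
        ⟦ q ℕ.* d ⟧ ℚ.* (T ℚ.- t ℚ.* T)  ≡⟨ cong₂ (λ u z → ι u ℚ.* (T ℚ.- z)) (ℤₚ.pos-* q d) tT ⟩
        ι (Q * D) ℚ.* (T ℚ.- ι (m + 1ℤ))  ≡⟨ cong (ι (Q * D) ℚ.*_) (ι-- (Q * Q) (m + 1ℤ)) ⟨
        ι (Q * D) ℚ.* ι (Q * Q - (m + 1ℤ))  ≡⟨ ι-* (Q * D) (Q * Q - (m + 1ℤ)) ⟨
        ι (Q * D * (Q * Q - (m + 1ℤ)))  ≡⟨ cong (λ z → ι (Q * D * z)) (identity (Q * Q) m) ⟩
        ι (Q * D * b)  ∎
        where
        open +-*-Solver using (solve; _:=_; _:+_; _:*_; _:-_; con)
        identity : ∀ x m → x - (m + 1ℤ) ≡ x - m - 1ℤ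
        identity = solve-∀

      Y≥0 : 0ℚ ℚ.≤ Y
      Y≥0 = ℚₚ.*-cancelˡ-≤-pos T (begin
        T ℚ.* 0ℚ  ≡⟨ ℚₚ.*-zeroʳ T ⟩
        0ℚ  ≤⟨ ι-mono-≤ (0≤* (0≤* {Q} {D} (+≤+ z≤n) (+≤+ z≤n)) b≥0) ⟩
        ι (Q * D * b)   ≡⟨ TY ⟨
        T ℚ.* Y  ∎)

      X<0 : A < 0ℤ → X ℚ.< 0ℚ
      X<0 A<0 = subst (ℚ._< 0ℚ) (sym X≡) (ι-mono-< A<0)

      X²<3Y² : Q * Q * (A * A) < + 3 * (D * D) * (b * b) → X ℚ.* X ℚ.< ⟦ 3 ⟧ ℚ.* (Y ℚ.* Y)
      X²<3Y² lt = ℚₚ.*-cancelˡ-<-nonNeg (T ℚ.* T) {{ℚₚ.pos⇒nonNeg (T ℚ.* T) {{TT-positive}}}} (begin-strict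
        T ℚ.* T ℚ.* (X ℚ.* X)  ≡⟨ cong (λ z → T ℚ.* T ℚ.* (z ℚ.* z)) X≡ ⟩
        T ℚ.* T ℚ.* (ι A ℚ.* ι A)  ≡⟨ cong₂ ℚ._*_ (ι-* (Q * Q) (Q * Q)) (ι-* A A) ⟨
        ι (Q * Q * (Q * Q)) ℚ.* ι (A * A)  ≡⟨ ι-* (Q * Q * (Q * Q)) (A * A) ⟨
        ι (Q * Q * (Q * Q) * (A * A))  ≡⟨ cong ι (ℤₚ.*-assoc (Q * Q) (Q * Q) (A * A)) ⟩
        ι (Q * Q * (Q * Q * (A * A)))  <⟨ ι-mono-< (ℤₚ.*-monoˡ-<-pos (Q * Q) {{ℤ.positive (0<* q>0 q>0)}} lt) ⟩
        ι (Q * Q * (+ 3 * (D * D) * (b * b)))  ≡⟨ cong ι (identity Q D b) ⟩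
        ι (+ 3 * (Q * D * b * (Q * D * b)))  ≡⟨ trans (ι-* (+ 3) (Q * D * b * (Q * D * b))) (cong (ι (+ 3) ℚ.*_) (ι-* (Q * D * b) (Q * D * b))) ⟩
        ⟦ 3 ⟧ ℚ.* (ι (Q * D * b) ℚ.* ι (Q * D * b))  ≡⟨ cong (λ z → ⟦ 3 ⟧ ℚ.* (z ℚ.* z)) TY ⟨
        ⟦ 3 ⟧ ℚ.* (T ℚ.* Y ℚ.* (T ℚ.* Y))  ≡⟨ solve 3 (λ c T Y → c :* (T :* Y :* (T :* Y)) := T :* T :* (c :* (Y :* Y))) refl ⟦ 3 ⟧ T Y ⟩
        T ℚ.* T ℚ.* (⟦ 3 ⟧ ℚ.* (Y ℚ.* Y))  ∎)
        where
        open +-*-Solver using (solve; _:=_; _:+_; _:*_; _:-_; con)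
        identity : ∀ q D b → q * q * (+ 3 * (D * D) * (b * b)) ≡ + 3 * (q * D * b * (q * D * b))
        identity = solve-∀

  order≥1 : ∀ {q} → q % 4 ≡ 3 → 1 ℕ.≤ q
  order≥1 {suc q} _ = s≤s z≤n

open import Defs
open import Data.Nat using (ℕ; _≤_; _^_; _%_; _*_)
open import Data.Nat.Properties using (≤-trans; m≤m+n)
open import Data.Product using (_×_; _,_; ∃-syntax)
open import Relation.Binary.PropositionalEquality using (_≡_)

theorem2p2 : ((q : ℕ) → OddPrimePower q → q % 4 ≡ 3 → (F : FiniteField q) → (E : FiniteField.Subset F)
    → q ^ 4 ≤ FiniteField.card F E ^ 3 → GtQOver1+√3 q (FiniteField.cardΔ F E))
    × (∃[ Q ] ((q : ℕ) → Q ≤ q → OddPrimePower q → q % 4 ≡ 1 → (F : FiniteField q) → (E : FiniteField.Subset F)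
    → q ^ 4 ≤ FiniteField.card F E ^ 3 → GtEpsQ q (FiniteField.cardΔ F E)))
theorem2p2 =
  (λ q _ q≡3 F E large → DistanceSets.inert-case F E (DistanceSets.order≥1 q≡3) large q≡3) ,
  -- The threshold is the `8³` of `n≥8q`; the other places that need `q` to be large ask for less.
  512 , λ q q≥512 _ q≡1 F E large → DistanceSets.split-case F E (≤-trans (m≤m+n 1 511) q≥512) large q≥512 q≡1
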